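{- Let $G$ be a graph that is $(P_5,\textit{HVN})$-free. Then $\chi(G)\leq \omega(G)+3$.
   Context: Throughout, graphs are finite, simple and connected. $P_5$ is the path on 5 vertices. An HVN is the graph consisting of a complete graph $K_4$ together with one additional vertex adjacent to exactly two vertices of the $K_4$. A graph is $(H_1,H_2)$-free if it contains neither $H_1$ nor $H_2$ as an induced subgraph. $\chi(G)$ denotes the chromatic number and $\omega(G)$ the clique number of $G$. -}

module Defs where

open import Data.Nat using (ℕ; suc; _<_)
open import Data.Fin using (Fin)
open import Data.Bool using (Bool; true; false)
open import Data.Product using (Σ; _×_; ∃-syntax)
open import Data.List using (List; []; _∷_)
open import Relation.Binary.PropositionalEquality using (_≡_; _≢_)
open import Relation.Nullary using (¬_)
open import Function.Definitions using (Injective)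

record Graph : Set where
  field
    n     : ℕ
    adj   : Fin n → Fin n → Bool
    sym   : ∀ u v → adj u v ≡ adj v u
    irrefl : ∀ v → adj v v ≡ false

open Graph public

Adj : (G : Graph) → Fin (n G) → Fin (n G) → Set
Adj G u v = adj G u v ≡ true

data Walk (G : Graph) : Fin (n G) → Fin (n G) → Set where
  here : ∀ {v} → Walk G v v
  step : ∀ {u w v} → Adj G u w → Walk G w v → Walk G u v

Connected : Graph → Set
Connected G = ∀ u v → Walk G u v

InducedSub : Graph → Graph → Set
InducedSub H G =
  Σ (Fin (n H) → Fin (n G)) λ f →
    Injective _≡_ _≡_ f × (∀ u v → adj G (f u) (f v) ≡ adj H u v)

_-free : Graph → Graph → Set
(H -free) G = ¬ InducedSub H G

open import Data.Fin using (zero; suc)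

p5adj : Fin 5 → Fin 5 → Bool
p5adj zero (suc zero) = true
p5adj (suc zero) zero = true
p5adj (suc zero) (suc (suc zero)) = true
p5adj (suc (suc zero)) (suc zero) = true
p5adj (suc (suc zero)) (suc (suc (suc zero))) = true
p5adj (suc (suc (suc zero))) (suc (suc zero)) = true
p5adj (suc (suc (suc zero))) (suc (suc (suc (suc zero)))) = true
p5adj (suc (suc (suc (suc zero)))) (suc (suc (suc zero))) = true
p5adj _ _ = false

P5 : Graph
P5 = record { n = 5 ; adj = p5adj ; sym = s ; irrefl = i }
  where
  s : ∀ u v → p5adj u v ≡ p5adj v u
  s zero zero = _≡_.refl
  s zero (suc zero) = _≡_.refl
  s zero (suc (suc zero)) = _≡_.refl
  s zero (suc (suc (suc zero))) = _≡_.refl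
  s zero (suc (suc (suc (suc zero)))) = _≡_.refl
  s (suc zero) zero = _≡_.refl
  s (suc zero) (suc zero) = _≡_.refl
  s (suc zero) (suc (suc zero)) = _≡_.refl
  s (suc zero) (suc (suc (suc zero))) = _≡_.refl
  s (suc zero) (suc (suc (suc (suc zero)))) = _≡_.refl
  s (suc (suc zero)) zero = _≡_.refl
  s (suc (suc zero)) (suc zero) = _≡_.refl
  s (suc (suc zero)) (suc (suc zero)) = _≡_.refl
  s (suc (suc zero)) (suc (suc (suc zero))) = _≡_.refl
  s (suc (suc zero)) (suc (suc (suc (suc zero)))) = _≡_.refl
  s (suc (suc (suc zero))) zero = _≡_.refl
  s (suc (suc (suc zero))) (suc zero) = _≡_.refl
  s (suc (suc (suc zero))) (suc (suc zero)) = _≡_.refl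
  s (suc (suc (suc zero))) (suc (suc (suc zero))) = _≡_.refl
  s (suc (suc (suc zero))) (suc (suc (suc (suc zero)))) = _≡_.refl
  s (suc (suc (suc (suc zero)))) zero = _≡_.refl
  s (suc (suc (suc (suc zero)))) (suc zero) = _≡_.refl
  s (suc (suc (suc (suc zero)))) (suc (suc zero)) = _≡_.refl
  s (suc (suc (suc (suc zero)))) (suc (suc (suc zero))) = _≡_.refl
  s (suc (suc (suc (suc zero)))) (suc (suc (suc (suc zero)))) = _≡_.refl
  i : ∀ v → p5adj v v ≡ false
  i zero = _≡_.refl
  i (suc zero) = _≡_.refl
  i (suc (suc zero)) = _≡_.refl
  i (suc (suc (suc zero))) = _≡_.refl
  i (suc (suc (suc (suc zero)))) = _≡_.refl

-- HVN: K4 on {0,1,2,3} plus vertex 4 adjacent exactly to 0 and 1.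
hvnadj : Fin 5 → Fin 5 → Bool
hvnadj zero (suc zero) = true
hvnadj zero (suc (suc zero)) = true
hvnadj zero (suc (suc (suc zero))) = true
hvnadj zero (suc (suc (suc (suc zero)))) = true
hvnadj (suc zero) zero = true
hvnadj (suc zero) (suc (suc zero)) = true
hvnadj (suc zero) (suc (suc (suc zero))) = true
hvnadj (suc zero) (suc (suc (suc (suc zero)))) = true
hvnadj (suc (suc zero)) zero = true
hvnadj (suc (suc zero)) (suc zero) = true
hvnadj (suc (suc zero)) (suc (suc (suc zero))) = true
hvnadj (suc (suc (suc zero))) zero = true
hvnadj (suc (suc (suc zero))) (suc zero) = true
hvnadj (suc (suc (suc zero))) (suc (suc zero)) = true
hvnadj (suc (suc (suc (suc zero)))) zero = true
hvnadj (suc (suc (suc (suc zero)))) (suc zero) = true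
hvnadj _ _ = false

HVN : Graph
HVN = record { n = 5 ; adj = hvnadj ; sym = s ; irrefl = i }
  where
  s : ∀ u v → hvnadj u v ≡ hvnadj v u
  s zero zero = _≡_.refl
  s zero (suc zero) = _≡_.refl
  s zero (suc (suc zero)) = _≡_.refl
  s zero (suc (suc (suc zero))) = _≡_.refl
  s zero (suc (suc (suc (suc zero)))) = _≡_.refl
  s (suc zero) zero = _≡_.refl
  s (suc zero) (suc zero) = _≡_.refl
  s (suc zero) (suc (suc zero)) = _≡_.refl
  s (suc zero) (suc (suc (suc zero))) = _≡_.refl
  s (suc zero) (suc (suc (suc (suc zero)))) = _≡_.refl
  s (suc (suc zero)) zero = _≡_.refl
  s (suc (suc zero)) (suc zero) = _≡_.refl
  s (suc (suc zero)) (suc (suc zero)) = _≡_.refl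
  s (suc (suc zero)) (suc (suc (suc zero))) = _≡_.refl
  s (suc (suc zero)) (suc (suc (suc (suc zero)))) = _≡_.refl
  s (suc (suc (suc zero))) zero = _≡_.refl
  s (suc (suc (suc zero))) (suc zero) = _≡_.refl
  s (suc (suc (suc zero))) (suc (suc zero)) = _≡_.refl
  s (suc (suc (suc zero))) (suc (suc (suc zero))) = _≡_.refl
  s (suc (suc (suc zero))) (suc (suc (suc (suc zero)))) = _≡_.refl
  s (suc (suc (suc (suc zero)))) zero = _≡_.refl
  s (suc (suc (suc (suc zero)))) (suc zero) = _≡_.refl
  s (suc (suc (suc (suc zero)))) (suc (suc zero)) = _≡_.refl
  s (suc (suc (suc (suc zero)))) (suc (suc (suc zero))) = _≡_.refl
  s (suc (suc (suc (suc zero)))) (suc (suc (suc (suc zero)))) = _≡_.refl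
  i : ∀ v → hvnadj v v ≡ false
  i zero = _≡_.refl
  i (suc zero) = _≡_.refl
  i (suc (suc zero)) = _≡_.refl
  i (suc (suc (suc zero))) = _≡_.refl
  i (suc (suc (suc (suc zero)))) = _≡_.refl

HasClique : Graph → ℕ → Set
HasClique G k =
  Σ (Fin k → Fin (n G)) λ f →
    Injective _≡_ _≡_ f × (∀ i j → i ≢ j → Adj G (f i) (f j))

IsCliqueNumber : Graph → ℕ → Set
IsCliqueNumber G w = HasClique G w × ¬ HasClique G (suc w)

Colourable : Graph → ℕ → Set
Colourable G k =
  Σ (Fin (n G) → Fin k) λ c → ∀ u v → Adj G u v → c u ≢ c v

{-# OPTIONS --safe #-}

-- In an HVN-free graph every neighbourhood is paw-free, and a connected triangle-free P₅-free graph is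
-- bipartite or a blown-up pentagon, hence 3-colourable; this settles ω ≤ 2.
--
-- ω ≥ 4: the vertices missing exactly one vertex of a maximum clique K form, together with K, a complete
-- ω-partite graph M, whose i-th part gets colour i, and every vertex outside M sees at most one part.
-- By P₅-freeness each component of G − M splits into layers N and T such that every vertex of N is complete
-- or anticomplete to every component of T, and the components of both layers lie in neighbourhoods.  By
-- Olariu's theorem these components are triangle-free or complete multipartite; N takes its colours from the
-- bottom and T from the top of the palette, with three colours to spare for the few conflicts.
--
-- ω = 3: if no neighbourhood contains a pentagon, three bipartite layers suffice.  Otherwise fix a 5-wheel
-- and sort the vertices by their neighbours on it.  Excluding P₅ and K₄ determines the adjacencies between
-- most of the classes, which is a finite check, and six colours can be distributed over the classes; the
-- vertices without neighbours on the rim are again coloured in two layers.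
module Submission where

open import Defs
open import Data.Nat using (ℕ; _+_)
open import Data.Nat using (_∸_; _≤_; _<_; z≤n; s≤s; _≤?_; _<?_)
import Data.Nat as ℕ
import Data.Nat.Properties as ℕ
open import Data.Bool using (Bool; true; false; not; _∨_; if_then_else_)
import Data.Bool.Properties as Bool
open import Data.Fin using (Fin; zero; suc; _≟_; toℕ; inject₁; inject≤; fromℕ<; combine; join; splitAt)
import Data.Fin as Fin
open import Data.Fin.Patterns
open import Data.Fin.Properties using (all?; any?; ¬∀⟶∃¬; <-cmp; pigeonhole; toℕ<n; toℕ-injective; toℕ-fromℕ<; inject₁-injective; inject≤-injective; combine-injective; splitAt-join)
open import Data.List using (List; []; _∷_; allFin; applyUpTo; cartesianProduct; filter; length; _++_)
import Data.List as List
open import Data.List.Properties using (length-applyUpTo; length-++)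
open import Data.List.Membership.Propositional using () renaming (_∈_ to _∈ˡ_)
open import Data.List.Membership.Propositional.Properties using (∈-allFin; ∈-applyUpTo⁻; ∈-cartesianProduct⁺; ∈-filter⁺; ∈-filter⁻; ∈-lookup)
open import Data.List.Relation.Unary.Any using (here; there)
open import Data.List.Relation.Unary.All as All using (All; []; _∷_)
open import Data.List.Relation.Unary.AllPairs as AllPairs using (AllPairs; []; _∷_)
import Data.List.Relation.Unary.AllPairs.Properties as AllPairs
open import Data.List.Relation.Unary.Unique.Propositional using (Unique)
open import Data.List.Relation.Unary.Unique.Propositional.Properties using (allFin⁺; applyUpTo⁺₁; filter⁺)
open import Data.Product using (Σ-syntax; ∃; ∃-syntax; _×_; _,_; proj₁; proj₂)
open import Data.Sum using (_⊎_; inj₁; inj₂; [_,_]′)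
open import Data.Sum.Properties using (inj₁-injective; inj₂-injective)
import Data.Sum.Properties as Sum
open import Data.Empty using (⊥; ⊥-elim)
open import Data.Unit using (⊤; tt)
open import Data.Vec using (Vec; []; _∷_; lookup; tabulate)
open import Data.Vec.Properties using (lookup∘tabulate)
open import Function using (_∘_; case_of_)
open import Relation.Binary.Definitions using (tri<; tri≈; tri>)
open import Relation.Binary.PropositionalEquality using (_≡_; _≢_; refl; cong; cong₂; subst; subst₂; trans) renaming (sym to ≡-sym)
open import Relation.Nullary using (¬_; Dec; yes; no; contradiction)
open import Relation.Nullary.Decidable using (_×-dec_; _⊎-dec_; _→-dec_; ¬?; map′; from-yes; decidable-stable; ⌊_⌋)

-- For ω ≥ 4, any two indices of the clique leave at least two more, and these supply the vertices
-- for the HVNs in the arguments around K. For ω = 3 that source dries up and K₄-freeness takes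
-- over, which makes that case a separate proof with six colours. Where the 3 comes from when ω ≥ 4:
-- a component of G - M gives up the colour of one part that it sees, which leaves ω + 2 colours.
-- Each component of a layer has a common neighbour, so it has at most ω - 1 parts or is
-- triangle-free and 3-colourable. If a component of N with q parts is complete to a component of T
-- with p parts, then q + p ≤ ω, so the lowest q and the highest p + 1 of the ω + 2 colours are
-- disjoint. If a vertex above sees the component below only partially, it loses a single colour,
-- and p + 1 colours suffice for p parts with one forbidden colour each. Triangle-free components
-- above take the three highest colours, which no component below reaches.

-- Induced subgraphs, finite searches and greedy assignments

induced : (H G : Graph) (f : Fin (n H) → Fin (n G)) →
          (∀ i j → i ≡ j ⊎ ∃[ k ] adj H i k ≢ adj H j k) →
          (∀ i j → adj G (f i) (f j) ≡ adj H i j) → InducedSub H G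
induced H G f twin-free eq = f , inj , eq
  where
  inj : ∀ {i j} → f i ≡ f j → i ≡ j
  inj {i} {j} fi≡fj with twin-free i j
  ... | inj₁ i≡j = i≡j
  -- Vertices with different neighbourhoods in `H` cannot have the same image, so adjacency alone
  -- forces injectivity. Hence the later statements about P₅ and HVN need no distinctness
  -- assumptions.
  ... | inj₂ (k , i≢j) =
    contradiction (trans (≡-sym (eq i k)) (trans (cong (λ x → adj G x (f k)) fi≡fj) (eq j k))) i≢j

twinFree? : (H : Graph) → Dec (∀ i j → i ≡ j ⊎ ∃[ k ] adj H i k ≢ adj H j k)
twinFree? H = all? λ i → all? λ j → (i ≟ j) ⊎-dec any? λ k → ¬? (adj H i k Bool.≟ adj H j k)

next : Fin 5 → Fin 5
next 0F = 1F
next 1F = 2F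
next 2F = 3F
next 3F = 4F
next 4F = 0F

-- The vertices of a blown-up pentagon seeing i and i + 2.
pentagonColour : Fin 5 → Fin 3
pentagonColour 0F = 0F
pentagonColour 1F = 1F
pentagonColour 2F = 0F
pentagonColour 3F = 2F
pentagonColour 4F = 1F

-- Class `i` sees the cycle at `i` and `i + 2`, so classes of equal colour share a neighbour on the
-- cycle, and an edge between them would close a triangle.
pentagonColour-meet : ∀ i j → pentagonColour i ≡ pentagonColour j →
  i ≡ j ⊎ i ≡ next (next j) ⊎ next (next i) ≡ j
pentagonColour-meet = from-yes (all? λ i → all? λ j → (pentagonColour i ≟ pentagonColour j) →-dec
  ((i ≟ j) ⊎-dec (i ≟ next (next j)) ⊎-dec (next (next i) ≟ j)))

next⁵ : ∀ i → next (next (next (next (next i)))) ≡ i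
next⁵ = from-yes (all? λ i → next (next (next (next (next i)))) ≟ i)

module _ {X : Set} where

  first : X → {P : X → Set} → (∀ x → Dec (P x)) → List X → X
  first d P? []       = d
  first d P? (x ∷ xs) = case P? x of λ { (yes _) → x ; (no _) → first d P? xs }

  first-sat : ∀ {d} {P : X → Set} (P? : ∀ x → Dec (P x)) {y xs} → y ∈ˡ xs → P y → P (first d P? xs)
  first-sat P? {xs = x ∷ xs} y∈ Py with P? x | y∈
  ... | yes Px | _         = Px
  ... | no ¬Px | here refl = contradiction Py ¬Px
  ... | no _   | there y∈′ = first-sat P? y∈′ Py

  -- Needed so that all vertices of one part of a complete multipartite component choose the same
  -- representative in `rep`.
  first-cong : ∀ {d e} {P Q : X → Set} (P? : ∀ x → Dec (P x)) (Q? : ∀ x → Dec (Q x)) →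
               (∀ {x} → P x → Q x) → (∀ {x} → Q x → P x) → ∀ {y xs} → y ∈ˡ xs → P y →
               first d P? xs ≡ first e Q? xs
  first-cong P? Q? to from {xs = x ∷ xs} y∈ Py with P? x | Q? x | y∈
  ... | yes _ | yes _ | _ = refl
  ... | yes Px | no ¬Qx | _ = contradiction (to Px) ¬Qx
  ... | no ¬Px | yes Qx | _ = contradiction (from Qx) ¬Px
  ... | no ¬Px | no _ | here refl = contradiction Py ¬Px
  ... | no _ | no _ | there y∈′ = first-cong P? Q? to from y∈′ Py

  allPairs : ∀ {R : X → X → Set} {xs} → Unique xs → (∀ {x y} → x ∈ˡ xs → y ∈ˡ xs → x ≢ y → R x y) → AllPairs R xs
  allPairs []         r = []
  allPairs (x∉ ∷ uxs) r = All.tabulate (λ y∈ → r (here refl) (there y∈) (All.lookup x∉ y∈)) ∷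
                          allPairs uxs (λ x∈ y∈ → r (there x∈) (there y∈))

  allPairs-lookup : ∀ {R : X → X → Set} {xs} → AllPairs R xs → ∀ i j → i Fin.< j → R (List.lookup xs i) (List.lookup xs j)
  allPairs-lookup {xs = x ∷ xs} (rx ∷ _) zero (suc j) _ = All.lookup rx (∈-lookup j)
  allPairs-lookup (_ ∷ rs) (suc i) (suc j) (s≤s i<j) = allPairs-lookup rs i j i<j

indexOf : ∀ {m} → Fin m → List (Fin m) → ℕ
indexOf v []       = 0
indexOf v (x ∷ xs) = case v ≟ x of λ { (yes _) → 0 ; (no _) → ℕ.suc (indexOf v xs) }

indexOf-< : ∀ {m} {v : Fin m} {xs} → v ∈ˡ xs → indexOf v xs < length xs
indexOf-< {v = v} {x ∷ xs} v∈ with v ≟ x | v∈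
... | yes _ | _ = s≤s z≤n
... | no v≢x | here v≡x = contradiction v≡x v≢x
... | no _ | there v∈′ = s≤s (indexOf-< v∈′)

indexOf-injective : ∀ {m} {u v : Fin m} {xs} → u ∈ˡ xs → v ∈ˡ xs → indexOf u xs ≡ indexOf v xs → u ≡ v
indexOf-injective {u = u} {v} {x ∷ xs} u∈ v∈ eq with u ≟ x | v ≟ x | u∈ | v∈
... | yes u≡x | yes v≡x | _ | _ = trans u≡x (≡-sym v≡x)
... | no u≢x | _ | here u≡x | _ = contradiction u≡x u≢x
... | no _ | no v≢x | _ | here v≡x = contradiction v≡x v≢x
... | no _ | no _ | there u∈′ | there v∈′ = indexOf-injective u∈′ v∈′ (ℕ.suc-injective eq)

maximal : ∀ {X : Set} {C : X → Set} (C? : ∀ x → Dec (C x)) (_⊑_ : X → X → Set) →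
          (∀ {x y z} → x ⊑ y → y ⊑ z → x ⊑ z) → (∀ {x y} → C x → C y → x ⊑ y ⊎ y ⊑ x) →
          (xs : List X) → (∀ {x} → C x → ¬ x ∈ˡ xs) ⊎ ∃[ m ] C m × (∀ {x} → C x → x ∈ˡ xs → x ⊑ m)
maximal C? _⊑_ ⊑-trans total [] = inj₁ λ _ ()
maximal {C = C} C? _⊑_ ⊑-trans total (x ∷ xs) with C? x | maximal C? _⊑_ ⊑-trans total xs
... | no ¬Cx | inj₁ none = inj₁ λ where
  Cy (here refl) → ¬Cx Cy
  Cy (there y∈)  → none Cy y∈
... | no ¬Cx | inj₂ (m , Cm , top) = inj₂ (m , Cm , λ where
  Cy (here refl) → contradiction Cy ¬Cx
  Cy (there y∈)  → top Cy y∈)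
... | yes Cx | inj₁ none = inj₂ (x , Cx , λ where
  Cy (here refl) → [ (λ p → p) , (λ p → p) ]′ (total Cx Cx)
  Cy (there y∈)  → contradiction y∈ (none Cy))
... | yes Cx | inj₂ (m , Cm , top) with total Cx Cm
... | inj₁ x⊑m = inj₂ (m , Cm , λ where
  Cy (here refl) → x⊑m
  Cy (there y∈)  → top Cy y∈)
... | inj₂ m⊑x = inj₂ (x , Cx , λ where
  Cy (here refl) → [ (λ p → p) , (λ p → p) ]′ (total Cx Cx)
  Cy (there y∈)  → ⊑-trans (top Cy y∈) m⊑x)

Painting : ∀ {m} → (Fin m → ℕ) → List (Fin m) → List ℕ → Set
Painting {m} bad rs cs = Σ[ g ∈ (Fin m → ℕ) ]
  (∀ {r} → r ∈ˡ rs → g r ∈ˡ cs × g r ≢ bad r) × (∀ {r s} → r ∈ˡ rs → s ∈ˡ rs → g r ≡ g s → r ≡ s)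

-- One forbidden colour per vertex costs only one extra colour: of any two colours one is allowed.
greedy : ∀ {m} (bad : Fin m → ℕ) (rs : List (Fin m)) (cs : List ℕ) → Unique cs → length rs < length cs →
         Painting bad rs cs
greedy bad [] cs _ _ = (λ _ → 0) , (λ ()) , λ ()
greedy bad (r ∷ rs) (c ∷ []) _ (s≤s ())
greedy {m} bad (r ∷ rs) (c ∷ d ∷ cs) ((c≢d ∷ c∉) ∷ d∉ ∷ ucs) (s≤s (s≤s len)) = pick (c ℕ.≟ bad r)
  where
  module Extend (c₀ : ℕ) (c₀≢ : c₀ ≢ bad r) (rest : List ℕ) (uniq : Unique rest) (fresh : ¬ c₀ ∈ˡ rest)
                (len : length rs < length rest) (c₀∈ : c₀ ∈ˡ c ∷ d ∷ cs)
                (sub : ∀ {x} → x ∈ˡ rest → x ∈ˡ c ∷ d ∷ cs) where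
    ih = greedy bad rs rest uniq len
    g₀ = proj₁ ih
    g : Fin m → ℕ
    g s = case s ≟ r of λ { (yes _) → c₀ ; (no _) → g₀ s }
    tail : ∀ {s} → s ∈ˡ r ∷ rs → s ≢ r → s ∈ˡ rs
    tail (here s≡r) s≢r = contradiction s≡r s≢r
    tail (there s∈) _   = s∈
    good : ∀ {s} → s ∈ˡ r ∷ rs → g s ∈ˡ c ∷ d ∷ cs × g s ≢ bad s
    good {s} s∈ with s ≟ r
    ... | yes refl = c₀∈ , c₀≢
    ... | no s≢r = let (g∈ , g≢) = proj₁ (proj₂ ih) (tail s∈ s≢r) in sub g∈ , g≢
    inj : ∀ {s t} → s ∈ˡ r ∷ rs → t ∈ˡ r ∷ rs → g s ≡ g t → s ≡ t
    inj {s} {t} s∈ t∈ eq with s ≟ r | t ≟ r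
    ... | yes s≡r | yes t≡r = trans s≡r (≡-sym t≡r)
    ... | yes _ | no t≢r = contradiction (subst (_∈ˡ rest) (≡-sym eq) (proj₁ (proj₁ (proj₂ ih) (tail t∈ t≢r)))) fresh
    ... | no s≢r | yes _ = contradiction (subst (_∈ˡ rest) eq (proj₁ (proj₁ (proj₂ ih) (tail s∈ s≢r)))) fresh
    ... | no s≢r | no t≢r = proj₂ (proj₂ ih) (tail s∈ s≢r) (tail t∈ t≢r) eq
    result : Painting bad (r ∷ rs) (c ∷ d ∷ cs)
    result = g , (λ {s} → good {s}) , (λ {s} {t} → inj {s} {t})
  pick : Dec (c ≡ bad r) → Painting bad (r ∷ rs) (c ∷ d ∷ cs)
  pick (no c≢) = Extend.result c c≢ (d ∷ cs) (d∉ ∷ ucs)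
    (λ { (here c≡d) → c≢d c≡d ; (there c∈) → All.lookup c∉ c∈ refl }) (s≤s len) (here refl) there
  -- The colour `c` is forbidden only for `r`; it remains available to the other vertices.
  pick (yes c≡) = Extend.result d (λ d≡ → c≢d (trans c≡ (≡-sym d≡))) (c ∷ cs) (c∉ ∷ ucs)
    (λ { (here d≡c) → c≢d (≡-sym d≡c) ; (there d∈) → All.lookup d∉ d∈ refl }) (s≤s len) (there (here refl))
    (λ { (here e) → here e ; (there x∈) → there (there x∈) })

avoid : ∀ {m} → 4 ≤ m → (a b c : Fin m) → ∃[ d ] d ≢ a × d ≢ b × d ≢ c
avoid {m} 4≤m a b c with any? (λ d → ¬? (d ≟ a) ×-dec ¬? (d ≟ b) ×-dec ¬? (d ≟ c))
... | yes found = found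
... | no none = collide (pigeonhole (s≤s (s≤s (s≤s (s≤s z≤n)))) name)
  where
  pick : Fin 3 → Fin m
  pick = λ { 0F → a ; 1F → b ; 2F → c }
  named : ∀ d → ∃[ i ] d ≡ pick i
  named d with d ≟ a | d ≟ b | d ≟ c
  ... | yes e | _ | _ = 0F , e
  ... | no _ | yes e | _ = 1F , e
  ... | no _ | no _ | yes e = 2F , e
  ... | no p | no q | no r = contradiction (d , p , q , r) none
  name : Fin 4 → Fin 3
  name i = proj₁ (named (inject≤ i 4≤m))
  collide : ∃[ i ] ∃[ j ] i Fin.< j × name i ≡ name j → _
  collide (i , j , i<j , eq) = contradiction
    (cong toℕ (inject≤-injective 4≤m 4≤m i j (trans (proj₂ (named (inject≤ i 4≤m)))
      (trans (cong pick eq) (≡-sym (proj₂ (named (inject≤ j 4≤m))))))))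
    (ℕ.<⇒≢ i<j)

-- The increasing enumeration of the naturals other than `i`: the palette of a component that gives
-- up the colour of part `i`.
skip : ℕ → ℕ → ℕ
skip i k = case k <? i of λ { (yes _) → k ; (no _) → ℕ.suc k }

skip-≢ : ∀ i k → skip i k ≢ i
skip-≢ i k eq with k <? i
... | yes k<i = ℕ.<⇒≢ k<i eq
... | no k≮i = k≮i (ℕ.≤-reflexive eq)

skip-injective : ∀ i {j k} → skip i j ≡ skip i k → j ≡ k
skip-injective i {j} {k} eq with j <? i | k <? i
... | yes _ | yes _ = eq
... | no _ | no _ = ℕ.suc-injective eq
... | yes j<i | no k≮i = contradiction (ℕ.<-trans (ℕ.≤-reflexive (≡-sym eq)) j<i) k≮i
... | no j≮i | yes k<i = contradiction (ℕ.<-trans (ℕ.≤-reflexive eq) k<i) j≮i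

skip-< : ∀ i {k m} → k < m → skip i k < ℕ.suc m
skip-< i {k} k<m with k <? i
... | yes _ = ℕ.m<n⇒m<1+n k<m
... | no _ = s≤s k<m

skip-high : ∀ i {k} → i ≤ k → skip i k ≡ ℕ.suc k
skip-high i {k} i≤k with k <? i
... | yes k<i = contradiction i≤k (ℕ.<⇒≱ k<i)
... | no _ = refl

-- Five-wheels with two more vertices

ring : Fin 5 → Fin 5 → Bool
ring 0F 1F = true
ring 1F 0F = true
ring 1F 2F = true
ring 2F 1F = true
ring 2F 3F = true
ring 3F 2F = true
ring 3F 4F = true
ring 4F 3F = true
ring 4F 0F = true
ring 0F 4F = true
ring _  _  = false

wheelAdj : Fin 6 → Fin 6 → Bool
wheelAdj 0F      0F      = false
wheelAdj 0F      (suc _) = true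
wheelAdj (suc _) 0F      = true
wheelAdj (suc i) (suc j) = ring i j

Profile : Set
Profile = Fin 6 → Bool

-- The wheel together with two vertices (0F and 1F) of given profiles.
extend : Profile → Profile → Bool → Fin 8 → Fin 8 → Bool
extend p q b 0F            0F            = false
extend p q b 0F            1F            = b
extend p q b 0F            (suc (suc k)) = p k
extend p q b 1F            0F            = b
extend p q b 1F            1F            = false
extend p q b 1F            (suc (suc k)) = q k
extend p q b (suc (suc k)) 0F            = p k
extend p q b (suc (suc k)) 1F            = q k
extend p q b (suc (suc k)) (suc (suc l)) = wheelAdj k l

infixr 6 _&&_

_&&_ : Bool → Bool → Bool
true  && b = b
false && b = false

some : ∀ {m} → (Fin m → Bool) → Bool
some {ℕ.zero}  p = false
some {ℕ.suc m} p = if p 0F then true else some (λ i → p (suc i))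

&&-true : ∀ {a b} → a && b ≡ true → a ≡ true × b ≡ true
&&-true {true} eq = refl , eq

some-true : ∀ {m} (p : Fin m → Bool) → some p ≡ true → ∃[ i ] p i ≡ true
some-true {ℕ.suc m} p eq with p 0F in p0
... | true  = 0F , p0
... | false with some-true (λ i → p (suc i)) eq
...   | i , pi = suc i , pi

module _ {m : ℕ} (M : Fin m → Fin m → Bool) where

  pathFrom pathThrough cliqueOn edgeIn : Fin m → Fin m → Bool
  pathFrom a b = some λ c → M b c && not (M a c) &&
                 some λ d → M c d && not (M a d) && not (M b d) &&
                 some λ e → M d e && not (M a e) && not (M b e) && not (M c e)
  pathThrough b c = some λ a → M a b && not (M a c) &&
                    some λ d → M c d && not (M a d) && not (M b d) &&
                    some λ e → M d e && not (M a e) && not (M b e) && not (M c e)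
  cliqueOn a b = some λ c → M a c && M b c && some λ d → M a d && M b d && M c d
  -- Up to reversal an edge of a P₅ is its first or its second one, so these calls cover every
  -- position of the edge.
  edgeIn a b = pathFrom a b ∨ pathFrom b a ∨ pathThrough a b ∨ pathThrough b a ∨ cliqueOn a b

-- Both certify an induced P₅ or a K₄; nothing is claimed about a negative answer, so it is enough to
-- search through the edges at one of the two extra vertices.
edgeClash clash : Profile → Profile → Bool
edgeClash p q = edgeIn (extend p q true) 0F 1F
clash p q = some λ k → extend p q false 0F k && edgeIn (extend p q false) 0F k

-- Indices are modulo 5.  The neighbours on the rim are: none (Z), all (F), i ± 1 (A), i and i ± 1 (B),
-- all but i ± 1 (D), all but i (E).  The Booleans record adjacency to the hub, which is excluded for B, D, E.
data Class : Set where
  Z F   : Bool → Class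
  A     : Bool → Fin 5 → Class
  B D E : Fin 5 → Class

profile : Class → Profile
profile (Z h)   0F      = h
profile (F h)   0F      = h
profile (A h i) 0F      = h
profile (B i)   0F      = false
profile (D i)   0F      = false
profile (E i)   0F      = false
profile (Z h)   (suc j) = false
profile (F h)   (suc j) = true
profile (A h i) (suc j) = ring i j
profile (B i)   (suc j) = ring i j ∨ ⌊ i ≟ j ⌋
profile (D i)   (suc j) = not (ring i j)
profile (E i)   (suc j) = not ⌊ i ≟ j ⌋

-- Finite checks on the classes of vertices

allBool? : {P : Bool → Set} → (∀ b → Dec (P b)) → Dec (∀ b → P b)
allBool? P? = map′ (λ { (f , t) → λ { false → f ; true → t } }) (λ f → f false , f true) (P? false ×-dec P? true)

anyBool? : {P : Bool → Set} → (∀ b → Dec (P b)) → Dec (∃ P)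
anyBool? P? = map′ (λ { (inj₁ p) → false , p ; (inj₂ p) → true , p })
                   (λ { (false , p) → inj₁ p ; (true , p) → inj₂ p }) (P? false ⊎-dec P? true)

allVec? : ∀ {k} {P : Vec Bool k → Set} → (∀ s → Dec (P s)) → Dec (∀ s → P s)
allVec? {ℕ.zero}  P? = map′ (λ { p [] → p }) (λ f → f []) (P? [])
allVec? {ℕ.suc k} P? = map′ (λ { f (b ∷ s) → f b s }) (λ f b s → f (b ∷ s))
                            (allBool? λ b → allVec? λ s → P? (b ∷ s))

anyClass? : {P : Class → Set} → (∀ c → Dec (P c)) → Dec (∃ P)
anyClass? {P} P? = map′ to from
  ((anyBool? λ b → P? (Z b)) ⊎-dec (anyBool? λ b → P? (F b)) ⊎-dec (anyBool? λ b → any? λ i → P? (A b i)) ⊎-dec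
   (any? λ i → P? (B i)) ⊎-dec (any? λ i → P? (D i)) ⊎-dec (any? λ i → P? (E i)))
  where
  to : _ → ∃ P
  to (inj₁ (h , p)) = Z h , p
  to (inj₂ (inj₁ (h , p))) = F h , p
  to (inj₂ (inj₂ (inj₁ (h , i , p)))) = A h i , p
  to (inj₂ (inj₂ (inj₂ (inj₁ (i , p))))) = B i , p
  to (inj₂ (inj₂ (inj₂ (inj₂ (inj₁ (i , p)))))) = D i , p
  to (inj₂ (inj₂ (inj₂ (inj₂ (inj₂ (i , p)))))) = E i , p
  from : ∃ P → _
  from (Z h , p)   = inj₁ (h , p)
  from (F h , p)   = inj₂ (inj₁ (h , p))
  from (A h i , p) = inj₂ (inj₂ (inj₁ (h , i , p)))
  from (B i , p)   = inj₂ (inj₂ (inj₂ (inj₁ (i , p))))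
  from (D i , p)   = inj₂ (inj₂ (inj₂ (inj₂ (inj₁ (i , p)))))
  from (E i , p)   = inj₂ (inj₂ (inj₂ (inj₂ (inj₂ (i , p)))))

-- The test for two non-adjacent vertices, applied to a single vertex in both places. This is
-- legitimate because a certified clash refers only to adjacencies and never to distinctness of
-- places.
record Absurd (p : Profile) : Set where
  constructor by-clash
  field clashes : clash p p ≡ true

record Apart (c d : Class) : Set where
  constructor by-clash
  field clashes : edgeClash (profile c) (profile d) ≡ true

record Joined (c d : Class) : Set where
  constructor by-clash
  field clashes : clash (profile c) (profile d) ≡ true

Exclusive : Class → Class → Set
Exclusive c d = Apart c d × Joined c d

absurd? : ∀ p → Dec (Absurd p)
absurd? p = map′ by-clash Absurd.clashes (clash p p Bool.≟ true)

apart? : ∀ c d → Dec (Apart c d)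
apart? c d = map′ by-clash Apart.clashes (edgeClash (profile c) (profile d) Bool.≟ true)

joined? : ∀ c d → Dec (Joined c d)
joined? c d = map′ by-clash Joined.clashes (clash (profile c) (profile d) Bool.≟ true)

exclusive? : ∀ c d → Dec (Exclusive c d)
exclusive? c d = apart? c d ×-dec joined? c d

private
  ring? : ∀ i j → Dec (ring i j ≡ true)
  ring? i j = ring i j Bool.≟ true

opaque

  -- For instance, a single rim neighbour or exactly two consecutive ones start a P₅ along the rim,
  -- and the hub completes a K₄ on two consecutive rim neighbours.
  classify : (s : Vec Bool 6) → Absurd (lookup s) ⊎ ∃[ c ] ∀ k → lookup s k ≡ profile c k
  classify = from-yes (allVec? λ s → absurd? (lookup s) ⊎-dec
                                     anyClass? λ c → all? λ k → lookup s k Bool.≟ profile c k)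

  F-F : ∀ h h′ → Apart (F h) (F h′)
  F-F = from-yes (allBool? λ h → allBool? λ h′ → apart? (F h) (F h′))

  F-B : ∀ h i → Apart (F h) (B i)
  F-B = from-yes (allBool? λ h → all? λ i → apart? (F h) (B i))

  F-D : ∀ h i → Apart (F h) (D i)
  F-D = from-yes (allBool? λ h → all? λ i → apart? (F h) (D i))

  F-E : ∀ h i → Apart (F h) (E i)
  F-E = from-yes (allBool? λ h → all? λ i → apart? (F h) (E i))

  E-E : ∀ i j → Apart (E i) (E j)
  E-E = from-yes (all? λ i → all? λ j → apart? (E i) (E j))

  -- `H` stands for the classes `A true i`: these vertices see the hub and imitate the rim vertex
  -- `i`, which is itself one of them.
  H-H : ∀ i j → ring i j ≡ true ⊎ Apart (A true i) (A true j)
  H-H = from-yes (all? λ i → all? λ j → ring? i j ⊎-dec apart? (A true i) (A true j))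

  A-A : ∀ i j → i ≡ j ⊎ Apart (A false i) (A false j)
  A-A = from-yes (all? λ i → all? λ j → (i ≟ j) ⊎-dec apart? (A false i) (A false j))

  A-A-exclusive : ∀ i j → ring i j ≡ true → Exclusive (A false i) (A false j)
  A-A-exclusive = from-yes (all? λ i → all? λ j → ring? i j →-dec exclusive? (A false i) (A false j))

  A-D : ∀ i j → i ≡ j ⊎ Apart (A false i) (D j)
  A-D = from-yes (all? λ i → all? λ j → (i ≟ j) ⊎-dec apart? (A false i) (D j))

  A-D-joined : ∀ i → Joined (A false i) (D i)
  A-D-joined = from-yes (all? λ i → joined? (A false i) (D i))

  D-D : ∀ i j → ring i j ≡ true ⊎ Apart (D i) (D j)
  D-D = from-yes (all? λ i → all? λ j → ring? i j ⊎-dec apart? (D i) (D j))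

  D-D-joined : ∀ i → Joined (D i) (D (next i))
  D-D-joined = from-yes (all? λ i → joined? (D i) (D (next i)))

  D-E : ∀ i j → i ≡ next (next j) ⊎ j ≡ next (next i) ⊎ Apart (D i) (E j)
  D-E = from-yes (all? λ i → all? λ j → (i ≟ next (next j)) ⊎-dec (j ≟ next (next i)) ⊎-dec apart? (D i) (E j))

  B-A : ∀ i j → Exclusive (B i) (A false j) ⊎ i ≡ j × Apart (B i) (A false j)
  B-A = from-yes (all? λ i → all? λ j → exclusive? (B i) (A false j) ⊎-dec
                  (i ≟ j) ×-dec apart? (B i) (A false j))

  B-D : ∀ i j → i ≡ j ⊎ Exclusive (B i) (D j)
  B-D = from-yes (all? λ i → all? λ j → (i ≟ j) ⊎-dec exclusive? (B i) (D j))

  B-H : ∀ i j → Apart (B i) (A true j) ⊎ i ≡ j ⊎ ring i j ≡ true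
  B-H = from-yes (all? λ i → all? λ j → apart? (B i) (A true j) ⊎-dec (i ≟ j) ⊎-dec ring? i j)

  Z-A : ∀ h h′ i → Apart (Z h) (A h′ i)
  Z-A = from-yes (allBool? λ h → allBool? λ h′ → all? λ i → apart? (Z h) (A h′ i))

  Z-B : ∀ h i → Apart (Z h) (B i)
  Z-B = from-yes (allBool? λ h → all? λ i → apart? (Z h) (B i))

  -- Once `B m` is occupied, the other classes `B i` together span no edge, so that a single colour
  -- serves them all.
  B-triple : ∀ m i j → i ≡ m ⊎ j ≡ m ⊎ Exclusive (B m) (B i) ⊎ Exclusive (B m) (B j) ⊎
             Exclusive (B i) (B j) ⊎ Apart (B i) (B j)
  B-triple = from-yes (all? λ m → all? λ i → all? λ j → (i ≟ m) ⊎-dec (j ≟ m) ⊎-dec exclusive? (B m) (B i) ⊎-dec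
                       exclusive? (B m) (B j) ⊎-dec exclusive? (B i) (B j) ⊎-dec apart? (B i) (B j))

  B-same : ∀ i → Apart (B i) (B i)
  B-same = from-yes (all? λ i → apart? (B i) (B i))

-- The distribution of six colours over the classes

minus : Fin 5 → Fin 5 → Fin 5
minus j 0F = j
minus j 1F = next (next (next (next j)))
minus j 2F = next (next (next j))
minus j 3F = next (next j)
minus j 4F = next j

Colour : Set
Colour = Fin 3 ⊎ Fin 3

_≟ᶜ_ : (x y : Colour) → Dec (x ≡ y)
_≟ᶜ_ = Sum.≡-dec _≟_ _≟_

pattern low x  = inj₁ x
pattern high x = inj₂ x

-- The classes A true i form a blown-up pentagon; the colour 2 is used only for i = m + 3, so that a class
-- A false m meets only colour 0 among its neighbours.
hubColour : Fin 5 → Fin 5 → Fin 3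
hubColour m j = lookup (1F ∷ 0F ∷ 1F ∷ 2F ∷ 0F ∷ []) (minus j m)

-- The classes D i form a blown-up pentagon too; only D e gets the third colour, which F and E use as well.
dColour : Fin 5 → Fin 5 → Fin 3
dColour e j = lookup (2F ∷ 0F ∷ 1F ∷ 0F ∷ 1F ∷ []) (minus j e)

spare : Fin 3 → Fin 3
spare 0F = 1F
spare 1F = 0F
spare 2F = 0F

-- The first colour is high because a vertex isolated among the classes `A false` may see any class
-- `A true`. The other vertices see only classes `A true j` with `j` next to their own index: beside
-- `m` these have colour `low 0F`, and elsewhere `low (hubColour m i)` is safe as `hubColour` is
-- proper. Only class `m` can meet vertices of `D`, hence its single high colour `δ`.
palette : Fin 5 → Fin 3 → Fin 5 → Fin 3 → Colour
palette m δ i q = if ⌊ i ≟ m ⌋ then lookup (high δ ∷ low 1F ∷ low 2F ∷ []) q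
                               else lookup (high 0F ∷ high 1F ∷ low (hubColour m i) ∷ []) q

opaque

  hubColour-proper : ∀ m i j → ring i j ≡ true → hubColour m i ≢ hubColour m j
  hubColour-proper = from-yes (all? λ m → all? λ i → all? λ j → ring? i j →-dec ¬? (hubColour m i ≟ hubColour m j))

  hubColour-near : ∀ m j → m ≡ j ⊎ ring m j ≡ true → hubColour m j ≢ 2F
  hubColour-near = from-yes (all? λ m → all? λ j → ((m ≟ j) ⊎-dec ring? m j) →-dec ¬? (hubColour m j ≟ 2F))

  dColour-proper : ∀ e i j → ring i j ≡ true → dColour e i ≢ dColour e j
  dColour-proper = from-yes (all? λ e → all? λ i → all? λ j → ring? i j →-dec ¬? (dColour e i ≟ dColour e j))

  dColour-special : ∀ e i → dColour e i ≡ 2F → i ≡ e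
  dColour-special = from-yes (all? λ e → all? λ i → (dColour e i ≟ 2F) →-dec (i ≟ e))

  spare-≢ : ∀ x → x ≢ spare x × spare x ≢ 2F
  spare-≢ = from-yes (all? λ x → ¬? (x ≟ spare x) ×-dec ¬? (spare x ≟ 2F))

  palette-injective : ∀ m δ i q r → palette m δ i q ≡ palette m δ i r → q ≡ r
  palette-injective = from-yes (all? λ m → all? λ δ → all? λ i → all? λ q → all? λ r →
    (palette m δ i q ≟ᶜ palette m δ i r) →-dec (q ≟ r))

  palette-≢2 : ∀ m δ i q → δ ≢ 2F → palette m δ i q ≢ high 2F
  palette-≢2 = from-yes (all? λ m → all? λ δ → all? λ i → all? λ q → ¬? (δ ≟ 2F) →-dec ¬? (palette m δ i q ≟ᶜ high 2F))

  palette-hub : ∀ m δ i j q → ring m i ≡ false → ring i j ≡ true → palette m δ i q ≢ low (hubColour m j)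
  palette-hub = from-yes (all? λ m → all? λ δ → all? λ i → all? λ j → all? λ q →
    (ring m i Bool.≟ false) →-dec ring? i j →-dec ¬? (palette m δ i q ≟ᶜ low (hubColour m j)))

  palette-first : ∀ m δ i j → palette m δ i 0F ≢ low j
  palette-first = from-yes (all? λ m → all? λ δ → all? λ i → all? λ j → ¬? (palette m δ i 0F ≟ᶜ low j))

  palette-main : ∀ m δ q d → palette m δ m q ≡ high d → d ≡ δ
  palette-main = from-yes (all? λ m → all? λ δ → all? λ q → all? λ d → (palette m δ m q ≟ᶜ high d) →-dec (d ≟ δ))

  common-neighbour : ∀ i j → ring i j ≡ false → ∃[ k ] ring i k ≡ true × ring j k ≡ true
  common-neighbour = from-yes (all? λ i → all? λ j → (ring i j Bool.≟ false) →-dec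
    any? λ k → ring? i k ×-dec ring? j k)

  ring-irrefl : ∀ i → ring i i ≡ false
  ring-irrefl = from-yes (all? λ i → ring i i Bool.≟ false)

  ring-sym : ∀ i j → ring i j ≡ ring j i
  ring-sym = from-yes (all? λ i → all? λ j → ring i j Bool.≟ ring j i)

Middle : Class → Set
Middle (Z _) = ⊥
Middle (F _) = ⊥
Middle _     = ⊤

private
  HalfSeen : Class → Set
  HalfSeen c = ∃[ i ] ∃[ j ] ring i j ≡ true × profile c (suc i) ≡ true × profile c (suc j) ≡ false

  halfSeen? : ∀ c → Dec (HalfSeen c)
  halfSeen? c = any? λ i → any? λ j → ring? i j ×-dec (profile c (suc i) Bool.≟ true) ×-dec (profile c (suc j) Bool.≟ false)

opaque
  -- Supplies the last two vertices of the P₅ in `mid-homogeneous`.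
  half-seen : ∀ c → Middle c → ∃[ i ] ∃[ j ] ring i j ≡ true × profile c (suc i) ≡ true × profile c (suc j) ≡ false
  half-seen (A h i) _ = from-yes (allBool? λ h → all? λ i → halfSeen? (A h i)) h i
  half-seen (B i)   _ = from-yes (all? λ i → halfSeen? (B i)) i
  half-seen (D i)   _ = from-yes (all? λ i → halfSeen? (D i)) i
  half-seen (E i)   _ = from-yes (all? λ i → halfSeen? (E i)) i

ring-next : ∀ i → ring i (next i) ≡ true
ring-next = from-yes (all? λ i → ring? i (next i))

∨-true : ∀ {a b} → a ∨ b ≡ true → a ≡ true ⊎ b ≡ true
∨-true {true}  eq = inj₁ refl
∨-true {false} eq = inj₂ eq

not-true : ∀ {a} → not a ≡ true → a ≡ false
not-true {false} eq = refl

-- Adjacency and the forbidden subgraphs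

module _ (G : Graph) where

  V : Set
  V = Fin (n G)

  infix 4 _~_ _≁_ _~?_

  _~_ _≁_ : V → V → Set
  u ~ v = Adj G u v
  u ≁ v = ¬ u ~ v

  _~?_ : ∀ u v → Dec (u ~ v)
  u ~? v = adj G u v Bool.≟ true

  ~-sym : ∀ {u v} → u ~ v → v ~ u
  ~-sym {u} {v} = trans (sym G v u)

  ≁-sym : ∀ {u v} → u ≁ v → v ≁ u
  ≁-sym u≁v v~u = u≁v (~-sym v~u)

  ~-irrefl : ∀ {v} → v ≁ v
  ~-irrefl {v} v~v with () ← trans (≡-sym v~v) (irrefl G v)

  ≁⇒false : ∀ {u v} → u ≁ v → adj G u v ≡ false
  ≁⇒false = Bool.¬-not

  false⇒≁ : ∀ {u v} → adj G u v ≡ false → u ≁ v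
  false⇒≁ eq u~v with () ← trans (≡-sym u~v) eq

  travel : ∀ {u v} (Q : V → Set) → (∀ {v w} → v ~ w → Q v → Q w) → Walk G u v → Q u → Q v
  travel Q keep here       q = q
  travel Q keep (step e w) q = travel Q keep w (keep e q)

  P5-Free : Set
  P5-Free = ∀ {a b c d e} → a ~ b → b ~ c → c ~ d → d ~ e →
            a ≁ c → a ≁ d → a ≁ e → b ≁ d → b ≁ e → c ≁ e → ⊥

  HVN-Free : Set
  HVN-Free = ∀ {a b c d e} → a ~ b → a ~ c → a ~ d → b ~ c → b ~ d → c ~ d →
             a ~ e → b ~ e → c ≁ e → d ≁ e → ⊥

  K4-Free : Set
  K4-Free = ∀ {a b c d} → a ~ b → a ~ c → a ~ d → b ~ c → b ~ d → c ~ d → ⊥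

  p5-free : (P5 -free) G → P5-Free
  p5-free free {a} {b} {c} {d} {e} ab bc cd de ac ad ae bd be ce =
    free (induced P5 G f (from-yes (twinFree? P5)) eq)
    where
    f : Fin 5 → V
    f = lookup (a ∷ b ∷ c ∷ d ∷ e ∷ [])
    fr : ∀ {u v} → u ≁ v → adj G u v ≡ false
    fr = ≁⇒false
    eq : ∀ i j → adj G (f i) (f j) ≡ p5adj i j
    eq zero zero = irrefl G a
    eq zero (suc zero) = ab
    eq zero (suc (suc zero)) = fr ac
    eq zero (suc (suc (suc zero))) = fr ad
    eq zero (suc (suc (suc (suc zero)))) = fr ae
    eq (suc zero) zero = ~-sym ab
    eq (suc zero) (suc zero) = irrefl G b
    eq (suc zero) (suc (suc zero)) = bc
    eq (suc zero) (suc (suc (suc zero))) = fr bd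
    eq (suc zero) (suc (suc (suc (suc zero)))) = fr be
    eq (suc (suc zero)) zero = fr (≁-sym ac)
    eq (suc (suc zero)) (suc zero) = ~-sym bc
    eq (suc (suc zero)) (suc (suc zero)) = irrefl G c
    eq (suc (suc zero)) (suc (suc (suc zero))) = cd
    eq (suc (suc zero)) (suc (suc (suc (suc zero)))) = fr ce
    eq (suc (suc (suc zero))) zero = fr (≁-sym ad)
    eq (suc (suc (suc zero))) (suc zero) = fr (≁-sym bd)
    eq (suc (suc (suc zero))) (suc (suc zero)) = ~-sym cd
    eq (suc (suc (suc zero))) (suc (suc (suc zero))) = irrefl G d
    eq (suc (suc (suc zero))) (suc (suc (suc (suc zero)))) = de
    eq (suc (suc (suc (suc zero)))) zero = fr (≁-sym ae)
    eq (suc (suc (suc (suc zero)))) (suc zero) = fr (≁-sym be)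
    eq (suc (suc (suc (suc zero)))) (suc (suc zero)) = fr (≁-sym ce)
    eq (suc (suc (suc (suc zero)))) (suc (suc (suc zero))) = ~-sym de
    eq (suc (suc (suc (suc zero)))) (suc (suc (suc (suc zero)))) = irrefl G e

  hvn-free : (HVN -free) G → HVN-Free
  hvn-free free {a} {b} {c} {d} {e} ab ac ad bc bd cd ae be ce de =
    free (induced HVN G f (from-yes (twinFree? HVN)) eq)
    where
    f : Fin 5 → V
    f = lookup (a ∷ b ∷ c ∷ d ∷ e ∷ [])
    fr : ∀ {u v} → u ≁ v → adj G u v ≡ false
    fr = ≁⇒false
    eq : ∀ i j → adj G (f i) (f j) ≡ hvnadj i j
    eq zero zero = irrefl G a
    eq zero (suc zero) = ab
    eq zero (suc (suc zero)) = ac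
    eq zero (suc (suc (suc zero))) = ad
    eq zero (suc (suc (suc (suc zero)))) = ae
    eq (suc zero) zero = ~-sym ab
    eq (suc zero) (suc zero) = irrefl G b
    eq (suc zero) (suc (suc zero)) = bc
    eq (suc zero) (suc (suc (suc zero))) = bd
    eq (suc zero) (suc (suc (suc (suc zero)))) = be
    eq (suc (suc zero)) zero = ~-sym ac
    eq (suc (suc zero)) (suc zero) = ~-sym bc
    eq (suc (suc zero)) (suc (suc zero)) = irrefl G c
    eq (suc (suc zero)) (suc (suc (suc zero))) = cd
    eq (suc (suc zero)) (suc (suc (suc (suc zero)))) = fr ce
    eq (suc (suc (suc zero))) zero = ~-sym ad
    eq (suc (suc (suc zero))) (suc zero) = ~-sym bd
    eq (suc (suc (suc zero))) (suc (suc zero)) = ~-sym cd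
    eq (suc (suc (suc zero))) (suc (suc (suc zero))) = irrefl G d
    eq (suc (suc (suc zero))) (suc (suc (suc (suc zero)))) = fr de
    eq (suc (suc (suc (suc zero)))) zero = ~-sym ae
    eq (suc (suc (suc (suc zero)))) (suc zero) = ~-sym be
    eq (suc (suc (suc (suc zero)))) (suc (suc zero)) = fr (≁-sym ce)
    eq (suc (suc (suc (suc zero)))) (suc (suc (suc zero))) = fr (≁-sym de)
    eq (suc (suc (suc (suc zero)))) (suc (suc (suc (suc zero)))) = irrefl G e

  -- Components of an induced subgraph

  module Components {P : V → Set} (P? : ∀ v → Dec (P v)) where

    infixl 5 _▸_

    data Path (u : V) : V → Set where
      stop : P u → Path u u
      _▸_  : ∀ {v w} → Path u v → v ~ w × P w → Path u w

    target : ∀ {u v} → Path u v → P v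
    target (stop Pu)      = Pu
    target (_ ▸ (_ , Pw)) = Pw

    _++ᵖ_ : ∀ {u v w} → Path u v → Path v w → Path u w
    p ++ᵖ stop _  = p
    p ++ᵖ (q ▸ e) = (p ++ᵖ q) ▸ e

    edge : ∀ {u v} → P u → P v → u ~ v → Path u v
    edge Pu Pv u~v = stop Pu ▸ (u~v , Pv)

    reverse : ∀ {u v} → Path u v → Path v u
    reverse (stop Pu)         = stop Pu
    reverse (p ▸ (v~w , Pw)) = edge Pw (target p) (~-sym v~w) ++ᵖ reverse p

    walk : ∀ {u v} (Q : V → Set) → (∀ {v w} → P v → P w → v ~ w → Q v → Q w) →
           Path u v → Q u → Q v
    walk Q keep (stop _)         Qu = Qu
    walk Q keep (p ▸ (v~w , Pw)) Qu = keep (target p) Pw v~w (walk Q keep p Qu)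

    private
      Rooted : (V → V) → Set
      Rooted r = ∀ {v} → P v → Path (r v) v

      Respects : (V → V) → V × V → Set
      Respects r (u , v) = P u → P v → u ~ v → r u ≡ r v

      redirect : V → V → V → V
      redirect a b x = case x ≟ a of λ { (yes _) → b ; (no _) → x }

      redirect-hit : ∀ a b → redirect a b a ≡ b
      redirect-hit a b with a ≟ a
      ... | yes _  = refl
      ... | no a≢a = contradiction refl a≢a

      redirect-self : ∀ a b → redirect a b b ≡ b
      redirect-self a b with b ≟ a
      ... | yes _ = refl
      ... | no _  = refl

      rooted-redirect : ∀ {r} → Rooted r → ∀ {u v} → P u → P v → u ~ v →
                        Rooted (redirect (r u) (r v) ∘ r)
      rooted-redirect {r} ρ {u} {v} Pu Pv u~v {w} Pw with r w ≟ r u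
      ... | yes rw≡ru = (ρ Pv ++ᵖ edge Pv Pu (~-sym u~v)) ++ᵖ
                        (reverse (ρ Pu) ++ᵖ subst (λ x → Path x w) rw≡ru (ρ Pw))
      ... | no _      = ρ Pw

      -- Union-find over a list of pairs: an edge inside `P` redirects the root of one end to the
      -- root of the other. The paths to the roots persist because the new edge links the two old
      -- classes.
      label : (es : List (V × V)) → ∃[ r ] Rooted r × (∀ {e} → e ∈ˡ es → Respects r e)
      label [] = (λ v → v) , stop , λ ()
      label ((u , v) ∷ es) with label es | P? u | P? v | u ~? v
      ... | r , ρ , resp | yes Pu | yes Pv | yes u~v =
        redirect (r u) (r v) ∘ r , rooted-redirect ρ Pu Pv u~v , λ
          { (here refl) _ _ _ → trans (redirect-hit (r u) (r v)) (≡-sym (redirect-self (r u) (r v)))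
          ; (there e∈) Px Py x~y → cong (redirect (r u) (r v)) (resp e∈ Px Py x~y) }
      ... | r , ρ , resp | no ¬Pu | _ | _ =
        r , ρ , λ { (here refl) Pu _ _ → contradiction Pu ¬Pu ; (there e∈) → resp e∈ }
      ... | r , ρ , resp | yes _ | no ¬Pv | _ =
        r , ρ , λ { (here refl) _ Pv _ → contradiction Pv ¬Pv ; (there e∈) → resp e∈ }
      ... | r , ρ , resp | yes _ | yes _ | no u≁v =
        r , ρ , λ { (here refl) _ _ u~v → contradiction u~v u≁v ; (there e∈) → resp e∈ }

      labelling = label (cartesianProduct (allFin (n G)) (allFin (n G)))

    opaque
      root : V → V
      root = proj₁ labelling

      root-path : ∀ {v} → P v → Path (root v) v
      root-path = proj₁ (proj₂ labelling)

      root-cong : ∀ {u v} → P u → P v → u ~ v → root u ≡ root v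
      root-cong {u} {v} = proj₂ (proj₂ labelling) (∈-cartesianProduct⁺ (∈-allFin u) (∈-allFin v))

    path⇒root : ∀ {u v} → Path u v → root u ≡ root v
    path⇒root {u} p = walk (λ v → root u ≡ root v) (λ Pv Pw v~w eq → trans eq (root-cong Pv Pw v~w)) p refl

    connected : ∀ {u v} → P u → P v → root u ≡ root v → Path u v
    connected {v = v} Pu Pv eq = reverse (root-path Pu) ++ᵖ subst (λ r → Path r v) (≡-sym eq) (root-path Pv)

    spread : (Q : V → Set) → (∀ {v w} → P v → P w → v ~ w → Q v → Q w) →
             ∀ {u v} → P u → P v → root u ≡ root v → Q u → Q v
    spread Q keep Pu Pv eq = walk Q keep (connected Pu Pv eq)

  -- Colouring triangle-free P₅-free graphs

  ProperOn : ∀ {k} → (V → Set) → (V → Fin k) → Set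
  ProperOn P col = ∀ {u v} → P u → P v → u ~ v → col u ≢ col v

  TriangleFree : (V → Set) → Set
  TriangleFree P = ∀ {a b c} → P a → P b → P c → a ~ b → b ~ c → a ~ c → ⊥

  C5 : V → V → V → V → V → Set
  C5 a b c d e = (a ~ b × b ~ c × c ~ d × d ~ e × e ~ a) × a ≁ c × b ≁ d × c ≁ e × d ≁ a × e ≁ b

  C5? : ∀ a b c d e → Dec (C5 a b c d e)
  C5? a b c d e =
    ((a ~? b) ×-dec (b ~? c) ×-dec (c ~? d) ×-dec (d ~? e) ×-dec (e ~? a)) ×-dec
    ¬? (a ~? c) ×-dec ¬? (b ~? d) ×-dec ¬? (c ~? e) ×-dec ¬? (d ~? a) ×-dec ¬? (e ~? b)

  C5Free : (V → Set) → Set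
  C5Free P = ∀ {a b c d e} → P a → P b → P c → P d → P e → C5 a b c d e → ⊥

  Pentagon : (V → Set) → Set
  Pentagon P = ∃[ a ] P a × ∃[ b ] P b × ∃[ c ] P c × ∃[ d ] P d × ∃[ e ] P e × C5 a b c d e

  pentagon? : ∀ {P} → (∀ v → Dec (P v)) → Dec (Pentagon P)
  pentagon? P? = any? λ a → P? a ×-dec any? λ b → P? b ×-dec any? λ c → P? c ×-dec
                 any? λ d → P? d ×-dec any? λ e → P? e ×-dec C5? a b c d e

  no-pentagon : ∀ {P} → ¬ Pentagon P → C5Free P
  no-pentagon none Pa Pb Pc Pd Pe abcde = none (_ , Pa , _ , Pb , _ , Pc , _ , Pd , _ , Pe , abcde)

  module TriangleFreeColouring (p5 : P5-Free) {P : V → Set} (P? : ∀ v → Dec (P v)) (△ : TriangleFree P) where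

    open Components P?

    In : V → V → Set
    In r v = P v × root v ≡ r

    In? : ∀ r v → Dec (In r v)
    In? r v = P? v ×-dec (root v ≟ r)

    glue : ∀ {k} → (∀ r → Σ[ col ∈ (V → Fin k) ] ProperOn (In r) col) →
           Σ[ col ∈ (V → Fin k) ] ProperOn P col
    glue local = (λ v → proj₁ (local (root v)) v) , λ {u} {v} Pu Pv u~v eq →
      let same = root-cong Pu Pv u~v in
      proj₂ (local (root u)) (Pu , refl) (Pv , ≡-sym same) u~v
        (trans eq (cong (λ r → proj₁ (local r) v) (≡-sym same)))

    module Blowup (c : Fin 5 → V) (inP : ∀ i → P (c i)) (side : ∀ i → c i ~ c (next i))
                  (chord : ∀ i → c i ≁ c (next (next i))) where

      Seen : V → Set
      Seen v = ∃[ i ] v ~ c i × v ~ c (next (next i))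

      seen? : ∀ v → Dec (Seen v)
      seen? v = any? λ i → (v ~? c i) ×-dec (v ~? c (next (next i)))

      private
        after : ∀ {v} i → P v → v ~ c i → v ≁ c (next i)
        after i Pv v~ci v~ci⁺ = △ Pv (inP i) (inP (next i)) v~ci (side i) v~ci⁺

        before : ∀ {v} i → P v → v ~ c (next i) → v ≁ c i
        before i Pv v~ci⁺ v~ci = after i Pv v~ci v~ci⁺

        -- Triangle-freeness excludes `c (i + 1)`; if `w` also missed `i + 2` and `i + 3`, then `w`
        -- and the cycle vertices from `i` to `i + 3` would form a P₅.
        touching : ∀ {w} → P w → ∀ i → w ~ c i → Seen w
        touching {w} Pw i w~ci with w ~? c (next (next i)) | w ~? c (next (next (next i)))
        ... | yes e | _ = i , w~ci , e
        ... | no  _ | yes e = next (next (next i)) , e , subst (λ j → w ~ c j) (≡-sym (next⁵ i)) w~ci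
        ... | no ¬2 | no ¬3 = ⊥-elim (p5 w~ci (side i) (side (next i)) (side (next (next i)))
          (after i Pw w~ci) ¬2 ¬3 (chord i)
          (λ e → chord (next (next (next i))) (subst (λ j → c (next (next (next i))) ~ c j) (≡-sym (next⁵ i)) (~-sym e)))
          (chord (next i)))

      -- A vertex `w` without neighbours on the cycle would start the P₅ through `v` and the cycle
      -- vertices `i + 2`, `i + 3`, `i + 4`. So the blown-up pentagon swallows its whole component.
      seen-step : ∀ {v w} → P v → P w → v ~ w → Seen v → Seen w
      seen-step {v} {w} Pv Pw v~w (i , v~i , v~i²) with any? (λ j → w ~? c j)
      ... | yes (j , e) = touching Pw j e
      ... | no none = ⊥-elim (p5 (~-sym v~w) v~i² (side (next (next i))) (side (next (next (next i))))
          (λ e → none (_ , e)) (λ e → none (_ , e)) (λ e → none (_ , e))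
          (after _ Pv v~i²) (before _ Pv (subst (λ j → v ~ c j) (≡-sym (next⁵ i)) v~i)) (chord _))

      colour : V → Fin 3
      colour v = case seen? v of λ { (yes (i , _)) → pentagonColour i ; (no _) → 0F }

      seen-cycle : Seen (c 0F)
      seen-cycle = 4F , ~-sym (side 4F) , side 0F

      colour-proper : ProperOn (λ v → P v × Seen v) colour
      colour-proper {u} {v} (Pu , su) (Pv , sv) u~v eq with seen? u | seen? v
      ... | no ¬su | _ = ¬su su
      ... | yes _ | no ¬sv = ¬sv sv
      ... | yes (i , ui , ui²) | yes (j , vj , vj²) with pentagonColour-meet i j eq
      ...   | inj₁ refl = △ Pu Pv (inP i) u~v vj ui
      ...   | inj₂ (inj₁ refl) = △ Pu Pv (inP i) u~v vj² ui
      ...   | inj₂ (inj₂ refl) = △ Pu Pv (inP j) u~v vj ui²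

    module Levels (r : V) (none : C5Free (In r)) where

      Second : V → Set
      Second v = ∃[ s ] P s × r ~ s × s ~ v

      data Level (v : V) : Set where
        L₀ : v ≡ r → Level v
        L₁ : r ~ v → Level v
        L₂ : r ≁ v → Second v → Level v
        L₃ : v ≢ r → r ≁ v → ¬ Second v → Level v

      level : ∀ v → Level v
      level v with v ≟ r | r ~? v | any? (λ s → P? s ×-dec (r ~? s) ×-dec (s ~? v))
      ... | yes e | _ | _ = L₀ e
      ... | no _ | yes e | _ = L₁ e
      ... | no _ | no ¬e | yes s = L₂ ¬e s
      ... | no v≢r | no ¬e | no ¬s = L₃ v≢r ¬e ¬s

      parity : ∀ {v} → Level v → Fin 2
      parity (L₀ _)     = 0F
      parity (L₁ _)     = 1F
      parity (L₂ _ _)   = 0F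
      parity (L₃ _ _ _) = 1F

      -- Distance at most three from `r`. The last case keeps the vertices of the path, because `r`,
      -- `s`, `q` followed by an edge between two vertices of the last level would be a P₅.
      data Near (v : V) : Set where
        N₀ : v ≡ r → Near v
        N₁ : r ~ v → Near v
        N₂ : Second v → Near v
        N₃ : ∀ {s q} → P s → P q → r ~ s → s ~ q → r ≁ q → q ~ v → Near v

      near-step : ∀ {v w} → P v → P w → v ~ w → Near v → Near w
      near-step Pv Pw v~w (N₀ refl) = N₁ v~w
      near-step Pv Pw v~w (N₁ r~v)  = N₂ (_ , Pv , r~v , v~w)
      near-step {v} {w} Pv Pw v~w (N₂ (s , Ps , r~s , s~v)) with r ~? v
      ... | yes r~v = N₂ (_ , Pv , r~v , v~w)
      ... | no r≁v  = N₃ Ps Pv r~s s~v r≁v v~w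
      near-step {v} {w} Pv Pw v~w (N₃ {s} {q} Ps Pq r~s s~q r≁q q~v)
        with r ~? w | s ~? w | r ~? v | s ~? v | q ~? w
      ... | yes e | _ | _ | _ | _ = N₁ e
      ... | no _ | yes e | _ | _ | _ = N₂ (s , Ps , r~s , e)
      ... | no _ | no _ | yes e | _ | _ = N₂ (v , Pv , e , v~w)
      ... | no _ | no _ | no r≁v | yes e | _ = N₃ Ps Pv r~s e r≁v v~w
      ... | no _ | no _ | no _ | no _ | yes e = N₃ Ps Pq r~s s~q r≁q e
      ... | no r≁w | no s≁w | no r≁v | no s≁v | no q≁w =
        ⊥-elim (p5 r~s s~q q~v v~w r≁q r≁v r≁w s≁v s≁w q≁w)

      colour : V → Fin 2
      colour v = parity (level v)

      module _ {u v : V} (u∈ : In r u) (v∈ : In r v) (u~v : u ~ v) where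

        private
          Pu = proj₁ u∈
          Pv = proj₁ v∈
          r-path : Path r u
          r-path = subst (λ x → Path x u) (proj₂ u∈) (root-path Pu)
          Pr : P r
          Pr = target (reverse r-path)
          r∈ : In r r
          r∈ = Pr , trans (path⇒root r-path) (proj₂ u∈)
          near : Near u
          near = walk Near near-step r-path (N₀ refl)

        first-in : ∀ {s} → P s → r ~ s → In r s
        first-in Ps r~s = Ps , trans (≡-sym (root-cong Pr Ps r~s)) (proj₂ r∈)

        levels-proper : (lu : Level u) (lv : Level v) → parity lu ≢ parity lv
        levels-proper (L₀ refl) (L₀ refl) _ = ~-irrefl u~v
        levels-proper (L₀ refl) (L₂ r≁v _) _ = r≁v u~v
        levels-proper (L₂ r≁u _) (L₀ refl) _ = r≁u (~-sym u~v)
        -- An edge inside the second level closes a pentagon through `r`.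
        levels-proper (L₂ r≁u (s , Ps , r~s , s~u)) (L₂ r≁v (t , Pt , r~t , t~v)) _ =
          none r∈ (first-in Ps r~s) u∈ v∈ (first-in Pt r~t)
            ((r~s , s~u , u~v , ~-sym t~v , ~-sym r~t) ,
             r≁u , (λ s~v → △ Ps Pu Pv s~u u~v s~v) , (λ u~t → △ Pt Pu Pv (~-sym u~t) u~v t~v) ,
             ≁-sym r≁v , (λ t~s → △ Pr Pt Ps r~t t~s r~s))
        levels-proper (L₁ r~u) (L₁ r~v) _ = △ Pr Pu Pv r~u u~v r~v
        levels-proper (L₁ r~u) (L₃ _ _ ¬s) _ = ¬s (u , Pu , r~u , u~v)
        levels-proper (L₃ _ _ ¬s) (L₁ r~v) _ = ¬s (v , Pv , r~v , ~-sym u~v)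
        levels-proper (L₃ u≢r r≁u ¬su) (L₃ v≢r r≁v ¬sv) _ with near
        ... | N₀ e = u≢r e
        ... | N₁ e = r≁u e
        ... | N₂ e = ¬su e
        ... | N₃ {s} {q} Ps Pq r~s s~q r≁q q~u =
          p5 r~s s~q q~u u~v r≁q r≁u r≁v (λ s~u → ¬su (s , Ps , r~s , s~u))
             (λ s~v → ¬sv (s , Ps , r~s , s~v)) (λ q~v → △ Pq Pu Pv q~u u~v q~v)

      colour-proper : ProperOn (In r) colour
      colour-proper {u} {v} u∈ v∈ u~v = levels-proper u∈ v∈ u~v (level u) (level v)

    opaque
      bipartite : C5Free P → Σ[ col ∈ (V → Fin 2) ] ProperOn P col
      bipartite none = glue λ r → let open Levels r (λ a b c d e → none (proj₁ a) (proj₁ b) (proj₁ c) (proj₁ d) (proj₁ e))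
                                  in colour , colour-proper

    opaque
      threeColour : Σ[ col ∈ (V → Fin 3) ] ProperOn P col
      threeColour = glue local
        where
        local : ∀ r → Σ[ col ∈ (V → Fin 3) ] ProperOn (In r) col
        local r with pentagon? (In? r)
        ... | no none = inject₁ ∘ colour , λ u∈ v∈ u~v eq → colour-proper u∈ v∈ u~v (inject₁-injective eq)
          where open Levels r (no-pentagon none)
        ... | yes (c₀ , (P₀ , r₀) , c₁ , (P₁ , _) , c₂ , (P₂ , _) , c₃ , (P₃ , _) , c₄ , (P₄ , _) ,
                   (s₀ , s₁ , s₂ , s₃ , s₄) , d₀ , d₁ , d₂ , d₃ , d₄) =
          colour , λ u∈ v∈ → colour-proper (reach u∈) (reach v∈)
          where
          c : Fin 5 → V
          c = λ { 0F → c₀ ; 1F → c₁ ; 2F → c₂ ; 3F → c₃ ; 4F → c₄ }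
          c∈ : ∀ i → P (c i)
          c∈ = λ { 0F → P₀ ; 1F → P₁ ; 2F → P₂ ; 3F → P₃ ; 4F → P₄ }
          side : ∀ i → c i ~ c (next i)
          side = λ { 0F → s₀ ; 1F → s₁ ; 2F → s₂ ; 3F → s₃ ; 4F → s₄ }
          chord : ∀ i → c i ≁ c (next (next i))
          chord = λ { 0F → d₀ ; 1F → d₁ ; 2F → d₂ ; 3F → d₃ ; 4F → d₄ }
          open Blowup c c∈ side chord
          reach : ∀ {v} → In r v → P v × Seen v
          reach (Pv , rv) = Pv , spread Seen seen-step P₀ Pv (trans r₀ (≡-sym rv)) seen-cycle

    Isolated : V → Set
    Isolated v = ∀ {u} → P u → v ≁ u

    opaque
      -- A vertex without neighbours in `P` can still have neighbours in other layers; its fixed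
      -- colour is chosen to be harmless there.
      threeColour-isolated : Σ[ col ∈ (V → Fin 3) ] ProperOn P col × (∀ {v} → Isolated v → col v ≡ 0F)
      threeColour-isolated = col , proper , isolated
        where
        neighbour? : ∀ v → Dec (∃[ u ] P u × v ~ u)
        neighbour? v = any? λ u → P? u ×-dec (v ~? u)
        col : V → Fin 3
        col v = case neighbour? v of λ { (yes _) → proj₁ threeColour v ; (no _) → 0F }
        proper : ProperOn P col
        proper {u} {v} Pu Pv u~v eq with neighbour? u | neighbour? v
        ... | yes _ | yes _ = proj₂ threeColour Pu Pv u~v eq
        ... | no ¬n | _ = ¬n (v , Pv , u~v)
        ... | yes _ | no ¬n = ¬n (u , Pu , ~-sym u~v)
        isolated : ∀ {v} → Isolated v → col v ≡ 0F
        isolated {v} iso with neighbour? v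
        ... | yes (u , Pu , v~u) = contradiction v~u (iso Pu)
        ... | no _ = refl

  -- Cliques

  neighbours-triangle-free : K4-Free → ∀ {h} → TriangleFree (h ~_)
  neighbours-triangle-free k4 ha hb hc ab bc ac = k4 ha hb hc ab ac bc

  clique : ∀ {k} (f : Fin k → V) → (∀ i j → i ≢ j → f i ~ f j) → HasClique G k
  clique f joined = f , (λ {i} {j} eq → inj i j eq) , joined
    where
    inj : ∀ i j → f i ≡ f j → i ≡ j
    inj i j eq with i ≟ j
    ... | yes i≡j = i≡j
    ... | no i≢j = contradiction (subst (_~ f j) eq (joined i j i≢j)) ~-irrefl

  shrink : ∀ {k l} → k ≤ l → HasClique G l → HasClique G k
  shrink k≤l (f , _ , joined) = clique (λ i → f (inject≤ i k≤l)) λ i j i≢j →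
    joined _ _ λ eq → i≢j (inject≤-injective k≤l k≤l i j eq)

  clique-length : ∀ {w} → ¬ HasClique G (ℕ.suc w) → ∀ {xs} → AllPairs _~_ xs → length xs ≤ w
  clique-length {w} none {xs} ps with length xs ≤? w
  ... | yes le = le
  ... | no ≰ = contradiction (shrink (ℕ.≰⇒> ≰) (clique (List.lookup xs) joined)) none
    where
    joined : ∀ i j → i ≢ j → List.lookup xs i ~ List.lookup xs j
    joined i j i≢j with <-cmp i j
    ... | tri< i<j _ _ = allPairs-lookup ps i j i<j
    ... | tri≈ _ i≡j _ = contradiction i≡j i≢j
    ... | tri> _ _ j<i = ~-sym (allPairs-lookup ps j i j<i)

  -- K₄-free graphs

  module K4FreeColouring (p5 : P5-Free) (k4 : K4-Free) (conn : Connected G) where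

    Wheel : Set
    Wheel = ∃[ h ] Pentagon (h ~_)

    wheel? : Dec Wheel
    wheel? = any? λ h → pentagon? (h ~?_)

    -- K₄-free graphs without a five-wheel

    module Wheelless (noWheel : ¬ Wheel) (o : V) where

      no-rim : ∀ h → C5Free (h ~_)
      no-rim h = no-pentagon λ p → noWheel (h , p)

      -- This includes `o` itself, as a component of its own, so that the three layers cover every
      -- vertex.
      Far : V → Set
      Far v = o ≁ v

      far? : ∀ v → Dec (Far v)
      far? v = ¬? (o ~? v)

      module Far = Components far?

      Attached : V → V → Set
      Attached r x = o ~ x × ∃[ t ] Far t × Far.root t ≡ r × x ~ t

      attached? : ∀ r → Dec (∃ (Attached r))
      attached? r = any? λ x → (o ~? x) ×-dec any? λ t → far? t ×-dec (Far.root t ≟ r) ×-dec (x ~? t)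

      gate : V → V
      gate r = case attached? r of λ { (yes (x , _)) → x ; (no _) → o }

      attached : ∀ {t} → Far t → t ≢ o → Attached (Far.root t) (gate (Far.root t))
      attached {t} ft t≢o with attached? (Far.root t)
      ... | yes (x , a) = a
      ... | no none = contradiction (travel Q keep (conn o t) (λ _ o≢o → contradiction refl o≢o) ft t≢o) none
        where
        Q : V → Set
        Q t = Far t → t ≢ o → ∃ (Attached (Far.root t))
        keep : ∀ {v w} → v ~ w → Q v → Q w
        keep {v} {w} v~w q fw w≢o with v ≟ o | o ~? v
        ... | yes refl | _ = contradiction v~w fw
        ... | no _ | yes o~v = v , o~v , w , fw , refl , v~w
        ... | no v≢o | no fv with q fv v≢o
        ...   | x , o~x , t , ft , eq , x~t = x , o~x , t , ft , trans eq (Far.root-cong fv fw v~w) , x~t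

      Inner Outer : V → Set
      Inner t = Far t × gate (Far.root t) ~ t
      Outer t = Far t × gate (Far.root t) ≁ t

      inner? : ∀ t → Dec (Inner t)
      inner? t = far? t ×-dec (gate (Far.root t) ~? t)

      outer? : ∀ t → Dec (Outer t)
      outer? t = far? t ×-dec ¬? (gate (Far.root t) ~? t)

      same-gate : ∀ {s t} → Far s → Far t → s ~ t → gate (Far.root s) ≡ gate (Far.root t)
      same-gate fs ft s~t = cong gate (Far.root-cong fs ft s~t)

      shift : ∀ {s t} → Inner s → Inner t → s ~ t → ∀ {x} → x ≡ gate (Far.root s) → x ≡ gate (Far.root t)
      shift (fs , _) (ft , _) s~t eq = trans eq (same-gate fs ft s~t)

      sees : ∀ {x t} → x ≡ gate (Far.root t) → Inner t → x ~ t
      sees refl (_ , e) = e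

      inner-triangle-free : TriangleFree Inner
      inner-triangle-free {a} ia ib ic ab bc ac =
        neighbours-triangle-free k4 (proj₂ ia) (sees (shift ia ib ab refl) ib) (sees (shift ia ic ac refl) ic) ab bc ac

      inner-pentagon-free : C5Free Inner
      inner-pentagon-free {a} ia ib ic id ie abcde@((ab , bc , cd , de , ea) , _) =
        no-rim (gate (Far.root a)) (proj₂ ia) (sees gb ib) (sees gc ic) (sees gd id)
          (sees (shift ia ie (~-sym ea) refl) ie) abcde
        where
        gb = shift ia ib ab refl
        gc = shift ib ic bc gb
        gd = shift ic id cd gc

      -- Otherwise `b`, `a`, `y`, their common gate and `o` form a P₅. Consequently a component of
      -- `Outer` lies in the neighbourhood of any inner vertex that it touches.
      homogeneous : ∀ {y a b} → Inner y → Outer a → Outer b → a ~ b → y ~ a → y ~ b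
      homogeneous {y} {a} {b} (fy , gy) (fa , ga) (fb , gb) a~b y~a with y ~? b | a ≟ o
      ... | yes y~b | _ = y~b
      ... | no _ | yes refl = contradiction a~b fb
      ... | no y≁b | no a≢o = ⊥-elim (p5 (~-sym a~b) (~-sym y~a) (~-sym gy) (~-sym (proj₁ (attached fy y≢o)))
          (≁-sym y≁b) (λ b~g → gb (subst (_~ b) (trans (same-gate fy fa y~a) (same-gate fa fb a~b)) (~-sym b~g)))
          (≁-sym fb)
          (λ a~g → ga (subst (_~ a) (same-gate fy fa y~a) (~-sym a~g))) (≁-sym fa) (≁-sym fy))
        where
        y≢o : y ≢ o
        y≢o refl = fa y~a

      -- An isolated vertex of Far may fail to have such a neighbour (it may be o itself).
      dominated : ∀ {t u} → Outer t → Far u → t ~ u → ∃[ y ] Inner y × y ~ t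
      dominated {t} {u} (ft , gt) fu t~u with attached ft t≢o
        where
        t≢o : t ≢ o
        t≢o refl = fu t~u
      ... | o~g , t₀ , ft₀ , eq , g~t₀ =
        finish (Far.spread Q keep ft₀ ft eq (inj₁ (ft₀ , subst (λ r → gate r ~ t₀) (≡-sym eq) g~t₀)))
        where
        Q : V → Set
        Q t = Inner t ⊎ ∃[ y ] Inner y × y ~ t
        keep : ∀ {v w} → Far v → Far w → v ~ w → Q v → Q w
        keep fv fw v~w (inj₁ iv) = inj₂ (_ , iv , v~w)
        keep {v} {w} fv fw v~w (inj₂ (y , iy , y~v)) with gate (Far.root v) ~? v | gate (Far.root w) ~? w
        ... | yes gv | _ = inj₂ (v , (fv , gv) , v~w)
        ... | no _ | yes gw = inj₁ (fw , gw)
        ... | no ¬gv | no ¬gw = inj₂ (y , iy , homogeneous iy (fv , ¬gv) (fw , ¬gw) v~w y~v)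
        finish : Q t → ∃[ y ] Inner y × y ~ t
        finish (inj₁ (_ , e)) = contradiction e gt
        finish (inj₂ q) = q

      outer-triangle-free : TriangleFree Outer
      outer-triangle-free oa ob oc ab bc ac with dominated oa (proj₁ ob) ab
      ... | y , iy , y~a = k4 y~a (homogeneous iy oa ob ab y~a) (homogeneous iy oa oc ac y~a) ab ac bc

      outer-pentagon-free : C5Free Outer
      outer-pentagon-free oa ob oc od oe abcde@((ab , bc , cd , de , ea) , _) with dominated oa (proj₁ ob) ab
      ... | y , iy , y~a = no-rim y y~a y~b y~c (homogeneous iy oc od cd y~c)
                             (homogeneous iy oa oe (~-sym ea) y~a) abcde
        where
        y~b = homogeneous iy oa ob ab y~a
        y~c = homogeneous iy ob oc bc y~b

      private
        module N = TriangleFreeColouring p5 (o ~?_) (neighbours-triangle-free k4)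
        module I = TriangleFreeColouring p5 inner? inner-triangle-free
        module O = TriangleFreeColouring p5 outer? outer-triangle-free
        near  = N.bipartite (no-rim o)
        inner = I.bipartite inner-pentagon-free
        outer = O.bipartite outer-pentagon-free

      data Layer (v : V) : Set where
        near-layer  : o ~ v → Layer v
        inner-layer : Inner v → Layer v
        outer-layer : Outer v → Layer v

      layer : ∀ v → Layer v
      layer v with o ~? v | gate (Far.root v) ~? v
      ... | yes e | _     = near-layer e
      ... | no ¬e | yes g = inner-layer (¬e , g)
      ... | no ¬e | no ¬g = outer-layer (¬e , ¬g)

      shade : ∀ {v} → Layer v → Fin 3 × Fin 2
      shade {v} (near-layer _)  = 0F , proj₁ near v
      shade {v} (inner-layer _) = 1F , proj₁ inner v
      shade {v} (outer-layer _) = 2F , proj₁ outer v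

      shade-proper : ∀ {u v} → u ~ v → (lu : Layer u) (lv : Layer v) →
        proj₁ (shade lu) ≡ proj₁ (shade lv) → proj₂ (shade lu) ≢ proj₂ (shade lv)
      shade-proper u~v (near-layer nu)  (near-layer nv)  _ = proj₂ near nu nv u~v
      shade-proper u~v (inner-layer iu) (inner-layer iv) _ = proj₂ inner iu iv u~v
      shade-proper u~v (outer-layer ou) (outer-layer ov) _ = proj₂ outer ou ov u~v

      colouring : Colourable G 6
      colouring = (λ v → let (i , j) = shade (layer v) in combine i j) , λ u v u~v eq →
        let (eq₁ , eq₂) = combine-injective _ _ _ _ eq in shade-proper u~v (layer u) (layer v) eq₁ eq₂

  -- Soundness of the search for clashes

  module Realised (p5 : P5-Free) (k4 : K4-Free) {m : ℕ} (M : Fin m → Fin m → Bool)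
                  (f : Fin m → Fin (n G)) (real : ∀ i j → adj G (f i) (f j) ≡ M i j) where

    private
      on : ∀ i j → M i j ≡ true → f i ~ f j
      on i j = trans (real i j)

      off : ∀ i j → not (M i j) ≡ true → f i ≁ f j
      off i j eq = false⇒≁ (trans (real i j) (not-true eq))

    pathFrom-sound : ∀ {a b} → f a ~ f b → pathFrom M a b ≢ true
    pathFrom-sound {a} {b} ab eq with some-true _ eq
    ... | c , eq with &&-true eq
    ... | bc , eq with &&-true eq
    ... | ac , eq with some-true _ eq
    ... | d , eq with &&-true eq
    ... | cd , eq with &&-true eq
    ... | ad , eq with &&-true eq
    ... | bd , eq with some-true _ eq
    ... | e , eq with &&-true eq
    ... | de , eq with &&-true eq
    ... | ae , eq with &&-true eq
    ... | be , ce = p5 ab (on b c bc) (on c d cd) (on d e de) (off a c ac) (off a d ad) (off a e ae) (off b d bd) (off b e be) (off c e ce)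

    pathThrough-sound : ∀ {b c} → f b ~ f c → pathThrough M b c ≢ true
    pathThrough-sound {b} {c} bc eq with some-true _ eq
    ... | a , eq with &&-true eq
    ... | ab , eq with &&-true eq
    ... | ac , eq with some-true _ eq
    ... | d , eq with &&-true eq
    ... | cd , eq with &&-true eq
    ... | ad , eq with &&-true eq
    ... | bd , eq with some-true _ eq
    ... | e , eq with &&-true eq
    ... | de , eq with &&-true eq
    ... | ae , eq with &&-true eq
    ... | be , ce = p5 (on a b ab) bc (on c d cd) (on d e de) (off a c ac) (off a d ad) (off a e ae) (off b d bd) (off b e be) (off c e ce)

    cliqueOn-sound : ∀ {a b} → f a ~ f b → cliqueOn M a b ≢ true
    cliqueOn-sound {a} {b} ab eq with some-true _ eq
    ... | c , eq with &&-true eq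
    ... | ac , eq with &&-true eq
    ... | bc , eq with some-true _ eq
    ... | d , eq with &&-true eq
    ... | ad , eq with &&-true eq
    ... | bd , cd = k4 ab (on a c ac) (on a d ad) (on b c bc) (on b d bd) (on c d cd)

    edgeIn-sound : ∀ {a b} → M a b ≡ true → edgeIn M a b ≢ true
    edgeIn-sound {a} {b} ab eq with ∨-true {pathFrom M a b} eq
    ... | inj₁ x = pathFrom-sound (on a b ab) x
    ... | inj₂ eq with ∨-true {pathFrom M b a} eq
    ... | inj₁ x = pathFrom-sound (~-sym (on a b ab)) x
    ... | inj₂ eq with ∨-true {pathThrough M a b} eq
    ... | inj₁ x = pathThrough-sound (on a b ab) x
    ... | inj₂ eq with ∨-true {pathThrough M b a} eq
    ... | inj₁ x = pathThrough-sound (~-sym (on a b ab)) x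
    ... | inj₂ x = cliqueOn-sound (on a b ab) x

    some-edgeIn-sound : ∀ {a} → some (λ k → M a k && edgeIn M a k) ≢ true
    some-edgeIn-sound {a} eq with some-true _ eq
    ... | k , eq with &&-true eq
    ... | ak , x = edgeIn-sound {a} {k} ak x

  -- Five-wheels: vertices with neighbours on the rim

  module WheelColouring (p5 : P5-Free) (k4 : K4-Free) (conn : Connected G)
                        (wheel : Fin 6 → V) (wheel-adj : ∀ k l → adj G (wheel k) (wheel l) ≡ wheelAdj k l) where

    rim : Fin 5 → V
    rim i = wheel (suc i)

    infix 4 _∈_

    record _∈_ (v : V) (c : Class) : Set where
      constructor member
      field at : ∀ k → adj G v (wheel k) ≡ profile c k

    open _∈_ public

    module Pair {u v : V} {p q : Profile}
                (up : ∀ k → adj G u (wheel k) ≡ p k) (vq : ∀ k → adj G v (wheel k) ≡ q k) where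

      place : Fin 8 → V
      place 0F            = u
      place 1F            = v
      place (suc (suc k)) = wheel k

      module _ {b : Bool} (uv : adj G u v ≡ b) where

        realises : ∀ i j → adj G (place i) (place j) ≡ extend p q b i j
        realises 0F            0F            = irrefl G u
        realises 0F            1F            = uv
        realises 0F            (suc (suc k)) = up k
        realises 1F            0F            = trans (sym G v u) uv
        realises 1F            1F            = irrefl G v
        realises 1F            (suc (suc k)) = vq k
        realises (suc (suc k)) 0F            = trans (sym G _ u) (up k)
        realises (suc (suc k)) 1F            = trans (sym G _ v) (vq k)
        realises (suc (suc k)) (suc (suc l)) = wheel-adj k l

      edgeClash-sound : edgeClash p q ≡ true → u ≁ v
      edgeClash-sound eq u~v = edgeIn-sound {0F} {1F} refl eq
        where open Realised p5 k4 (extend p q true) place (realises u~v)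

      clash-sound : clash p q ≡ true → u ~ v
      clash-sound eq = decidable-stable (u ~? v) λ u≁v →
        let open Realised p5 k4 (extend p q false) place (realises (≁⇒false u≁v)) in some-edgeIn-sound {0F} eq

    apart : ∀ {u v c d} → Apart c d → u ∈ c → v ∈ d → u ≁ v
    apart {c = c} {d} a u∈ v∈ = Pair.edgeClash-sound {p = profile c} {profile d} (at u∈) (at v∈) (Apart.clashes a)

    joined : ∀ {u v c d} → Joined c d → u ∈ c → v ∈ d → u ~ v
    joined {c = c} {d} j u∈ v∈ = Pair.clash-sound {p = profile c} {profile d} (at u∈) (at v∈) (Joined.clashes j)

    exclusive : ∀ {u v c d} → Exclusive c d → u ∈ c → v ∈ d → ⊥
    exclusive (a , j) u∈ v∈ = apart a u∈ v∈ (joined j u∈ v∈)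

    opaque
      class : ∀ v → ∃[ c ] v ∈ c
      class v = decide (classify bits)
        where
        bits : Vec Bool 6
        bits = tabulate λ k → adj G v (wheel k)
        agree : ∀ k → adj G v (wheel k) ≡ lookup bits k
        agree k = ≡-sym (lookup∘tabulate (λ k → adj G v (wheel k)) k)
        decide : Absurd (lookup bits) ⊎ (∃[ c ] ∀ k → lookup bits k ≡ profile c k) → ∃[ c ] v ∈ c
        decide (inj₁ absurd) = ⊥-elim (~-irrefl
          (Pair.clash-sound {p = lookup bits} {lookup bits} agree agree (Absurd.clashes absurd)))
        decide (inj₂ (c , eq)) = c , member λ k → trans (agree k) (eq k)

    _∈?_ : ∀ v c → Dec (v ∈ c)
    v ∈? c = map′ member at (all? λ k → adj G v (wheel k) Bool.≟ profile c k)

    Occupied : Class → Set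
    Occupied c = ∃[ v ] v ∈ c

    occupied? : ∀ c → Dec (Occupied c)
    occupied? c = any? λ v → v ∈? c

    sees : ∀ {v c} → v ∈ c → ∀ k → profile c k ≡ true → v ~ wheel k
    sees v∈ k eq = trans (at v∈ k) eq

    misses : ∀ {v c} → v ∈ c → ∀ k → profile c k ≡ false → v ≁ wheel k
    misses v∈ k eq = false⇒≁ (trans (at v∈ k) eq)

    rim-edge : ∀ i j → ring i j ≡ true → rim i ~ rim j
    rim-edge i j eq = trans (wheel-adj (suc i) (suc j)) eq

    PendantA : V → Set
    PendantA v = ∃[ i ] v ∈ A false i

    pendantA? : ∀ v → Dec (PendantA v)
    pendantA? v = any? λ i → v ∈? A false i

    pendantA-edge : ∀ {u v i j} → u ∈ A false i → v ∈ A false j → u ~ v → i ≡ j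
    pendantA-edge {i = i} {j} u∈ v∈ u~v with A-A i j
    ... | inj₁ i≡j = i≡j
    ... | inj₂ a = contradiction u~v (apart a u∈ v∈)

    pendantA-triangle-free : TriangleFree PendantA
    pendantA-triangle-free (i , a∈) (j , b∈) (k , c∈) ab bc ac
      with pendantA-edge a∈ b∈ ab | pendantA-edge a∈ c∈ ac
    ... | refl | refl = k4 (~-sym (sees a∈ (suc (next i)) e)) (~-sym (sees b∈ (suc (next i)) e))
                           (~-sym (sees c∈ (suc (next i)) e)) ab ac bc
      where
      e : ring i (next i) ≡ true
      e = ring-next i

    private
      module PA = TriangleFreeColouring p5 pendantA? pendantA-triangle-free
      pa = PA.threeColour-isolated

    opaque
      q : V → Fin 3
      q = proj₁ pa

      q-proper : ∀ {u v i} → u ∈ A false i → v ∈ A false i → u ~ v → q u ≢ q v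
      q-proper u∈ v∈ = proj₁ (proj₂ pa) (_ , u∈) (_ , v∈)

      q-isolated : ∀ {u} → PA.Isolated u → q u ≡ 0F
      q-isolated = proj₂ (proj₂ pa)

    -- If `i` and `j` are not adjacent on the rim, they have a common rim neighbour `k`. Then either
    -- `u`, `u′`, `s`, `rim k` is a K₄, or `u′` misses `s` and `u′`, `u`, `s`, the hub, `rim i` is a
    -- P₅.
    pendantA-hub-edge : ∀ {u u′ s i j} → u ∈ A false i → u′ ∈ A false i → u ~ u′ → s ∈ A true j → u ~ s →
                        ring i j ≡ true
    pendantA-hub-edge {u} {u′} {s} {i} {j} u∈ u′∈ u~u′ s∈ u~s with ring i j in eq
    ... | true = refl
    ... | false with common-neighbour i j eq | u′ ~? s
    ... | k , ik , jk | yes u′~s = ⊥-elim (k4 u~u′ u~s (sees u∈ (suc k) ik) u′~s (sees u′∈ (suc k) ik) (sees s∈ (suc k) jk))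
    ... | _ | no u′≁s = ⊥-elim (p5 (~-sym u~u′) u~s (sees s∈ 0F refl) (wheel-adj 0F (suc i))
      u′≁s (misses u′∈ 0F refl) (misses u′∈ (suc i) (ring-irrefl i)) (misses u∈ 0F refl)
      (misses u∈ (suc i) (ring-irrefl i)) (misses s∈ (suc i) (trans (ring-sym j i) eq)))

    q-hub-edge : ∀ {u s i j} → u ∈ A false i → q u ≢ 0F → s ∈ A true j → u ~ s → ring i j ≡ true
    q-hub-edge {u} {s} {i} {j} u∈ qu≢0 s∈ u~s =
      decidable-stable (ring i j Bool.≟ true) λ ¬r → qu≢0 (q-isolated λ (k , u′∈) u~u′ → ¬r
        (pendantA-hub-edge u∈ (subst (λ l → _ ∈ A false l) (≡-sym (pendantA-edge u∈ u′∈ u~u′)) u′∈) u~u′ s∈ u~s))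

    -- m is an index such that no other A false i is nonempty together with D i, and δ is the colour (among
    -- the upper three) given to the vertices of A false m without neighbours in A false m.
    record Scheme : Set where
      field
        m       : Fin 5
        dCol    : Fin 5 → Fin 3
        bCol    : Fin 5 → Colour
        δ       : Fin 3
        δ≢2     : δ ≢ 2F
        δ≢main  : dCol m ≢ δ
        a-range : ∀ {v i} → v ∈ A false i → ring m i ≡ false
        a-d     : ∀ {u v i} → u ∈ A false i → v ∈ D i → i ≡ m
        d-d     : ∀ {u v i j} → u ∈ D i → v ∈ D j → u ~ v → dCol i ≢ dCol j
        d-e     : ∀ {u v i j} → u ∈ D i → v ∈ E j → u ~ v → dCol i ≢ 2F
        b≢2     : ∀ i → bCol i ≢ high 2F
        b-b     : ∀ {u v i j} → u ∈ B i → v ∈ B j → u ~ v → bCol i ≢ bCol j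
        b-d     : ∀ {u v i j} → u ∈ B i → v ∈ D j → bCol i ≢ high (dCol j)
        b-a     : ∀ {u v i j} → u ∈ B i → v ∈ A false j → u ≁ v
        b-h     : ∀ {u v i j} → u ∈ B i → v ∈ A true j → u ~ v → bCol i ≢ low (hubColour m j)

    module Shading (scheme : Scheme) where

      open Scheme scheme

      shade : Class → Fin 3 → Colour
      shade (Z _)       r = low 0F
      shade (F _)       r = high 2F
      shade (E _)       r = high 2F
      shade (A true i)  r = low (hubColour m i)
      shade (A false i) r = palette m δ i r
      shade (B i)       r = bCol i
      shade (D i)       r = high (dCol i)

      a-h : ∀ {u v i j} → u ∈ A false i → v ∈ A true j → u ~ v → palette m δ i (q u) ≢ low (hubColour m j)
      a-h {u} {v} {i} {j} u∈ v∈ u~v eq with q u ≟ 0F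
      ... | yes q≡0 = palette-first m δ i _ (subst (λ r → palette m δ i r ≡ _) q≡0 eq)
      ... | no q≢0 = palette-hub m δ i j (q u) (a-range u∈) (q-hub-edge u∈ q≢0 v∈ u~v) eq

      a-d′ : ∀ {u v i j} → u ∈ A false i → v ∈ D j → u ~ v → palette m δ i (q u) ≢ high (dCol j)
      a-d′ {u} {v} {i} {j} u∈ v∈ u~v eq with A-D i j
      ... | inj₂ a = apart a u∈ v∈ u~v
      ... | inj₁ refl with a-d u∈ v∈
      ... | refl = δ≢main (palette-main m δ (q u) (dCol m) eq)

      data Core : Class → Set where
        F : ∀ h → Core (F h)
        A : ∀ h i → Core (A h i)
        B : ∀ i → Core (B i)
        D : ∀ i → Core (D i)
        E : ∀ i → Core (E i)

      shade-proper : ∀ {u v c d} → Core c → Core d → u ∈ c → v ∈ d → u ~ v → shade c (q u) ≢ shade d (q v)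
      shade-proper (F h) (F h′) u∈ v∈ u~v _ = apart (F-F h h′) u∈ v∈ u~v
      shade-proper (F h) (A true i) u∈ v∈ u~v ()
      shade-proper {u} {v} (F h) (A false i) u∈ v∈ u~v eq = palette-≢2 m δ i (q v) δ≢2 (≡-sym eq)
      shade-proper (F h) (B i) u∈ v∈ u~v _ = apart (F-B h i) u∈ v∈ u~v
      shade-proper (F h) (D i) u∈ v∈ u~v _ = apart (F-D h i) u∈ v∈ u~v
      shade-proper (F h) (E i) u∈ v∈ u~v _ = apart (F-E h i) u∈ v∈ u~v
      shade-proper (E i) (E j) u∈ v∈ u~v _ = apart (E-E i j) u∈ v∈ u~v
      shade-proper (E i) (F h) u∈ v∈ u~v _ = apart (F-E h i) v∈ u∈ (~-sym u~v)
      shade-proper (E i) (A true j) u∈ v∈ u~v ()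
      shade-proper {u} {v} (E i) (A false j) u∈ v∈ u~v eq = palette-≢2 m δ j (q v) δ≢2 (≡-sym eq)
      shade-proper (E i) (B j) u∈ v∈ u~v eq = b≢2 j (≡-sym eq)
      shade-proper (E i) (D j) u∈ v∈ u~v eq = d-e v∈ u∈ (~-sym u~v) (inj₂-injective (≡-sym eq))
      shade-proper (A true i) (A true j) u∈ v∈ u~v eq with H-H i j
      ... | inj₁ r = hubColour-proper m i j r (inj₁-injective eq)
      ... | inj₂ a = apart a u∈ v∈ u~v
      shade-proper (A true i) (A false j) u∈ v∈ u~v eq = a-h v∈ u∈ (~-sym u~v) (≡-sym eq)
      shade-proper (A true i) (F h) u∈ v∈ u~v ()
      shade-proper (A true i) (E j) u∈ v∈ u~v ()
      shade-proper (A true i) (D j) u∈ v∈ u~v ()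
      shade-proper (A true i) (B j) u∈ v∈ u~v eq = b-h v∈ u∈ (~-sym u~v) (≡-sym eq)
      shade-proper (A false i) (A true j) u∈ v∈ u~v eq = a-h u∈ v∈ u~v eq
      shade-proper {u} {v} (A false i) (A false j) u∈ v∈ u~v eq with pendantA-edge u∈ v∈ u~v
      ... | refl = q-proper u∈ v∈ u~v (palette-injective m δ i (q u) (q v) eq)
      shade-proper (A false i) (B j) u∈ v∈ u~v _ = b-a v∈ u∈ (~-sym u~v)
      shade-proper (A false i) (D j) u∈ v∈ u~v eq = a-d′ u∈ v∈ u~v eq
      shade-proper {u} {v} (A false i) (E j) u∈ v∈ u~v eq = palette-≢2 m δ i (q u) δ≢2 eq
      shade-proper {u} {v} (A false i) (F h) u∈ v∈ u~v eq = palette-≢2 m δ i (q u) δ≢2 eq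
      shade-proper (B i) (A true j) u∈ v∈ u~v eq = b-h u∈ v∈ u~v eq
      shade-proper (B i) (A false j) u∈ v∈ u~v _ = b-a u∈ v∈ u~v
      shade-proper (B i) (B j) u∈ v∈ u~v eq = b-b u∈ v∈ u~v eq
      shade-proper (B i) (D j) u∈ v∈ u~v eq = b-d u∈ v∈ eq
      shade-proper (B i) (E j) u∈ v∈ u~v eq = b≢2 i eq
      shade-proper (B i) (F h) u∈ v∈ u~v _ = apart (F-B h i) v∈ u∈ (~-sym u~v)
      shade-proper (D i) (A true j) u∈ v∈ u~v ()
      shade-proper (D i) (A false j) u∈ v∈ u~v eq = a-d′ v∈ u∈ (~-sym u~v) (≡-sym eq)
      shade-proper (D i) (B j) u∈ v∈ u~v eq = b-d v∈ u∈ (≡-sym eq)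
      shade-proper (D i) (D j) u∈ v∈ u~v eq = d-d u∈ v∈ u~v (inj₂-injective eq)
      shade-proper (D i) (E j) u∈ v∈ u~v eq = d-e u∈ v∈ u~v (inj₂-injective eq)
      shade-proper (D i) (F h) u∈ v∈ u~v _ = apart (F-D h i) v∈ u∈ (~-sym u~v)

    -- An occupied `B m` empties every `D i` and every `A false i` with `i ≢ m`. So one colour
    -- suffices for `D`, and `B m` may take `low 2F`, which `hubColour m` avoids on the classes
    -- `A true j` that `B m` can see.
    withB : ∀ {w m} → w ∈ B m → Scheme
    withB {w} {m} w∈ = record
      { m = m ; dCol = λ _ → 0F ; bCol = bCol ; δ = 1F ; δ≢2 = λ () ; δ≢main = λ ()
      ; a-range = λ {v} {i} v∈ → case B-A m i of λ where
          (inj₁ x)          → ⊥-elim (exclusive x w∈ v∈)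
          (inj₂ (refl , _)) → ring-irrefl m
      ; a-d = λ u∈ v∈ → ≡-sym (d-main v∈)
      ; d-d = λ {u} {v} {i} {j} u∈ v∈ u~v _ → case D-D i j of λ where
          (inj₁ r) → case trans (≡-sym (ring-irrefl m)) (subst₂ (λ i j → ring i j ≡ true) (≡-sym (d-main u∈)) (≡-sym (d-main v∈)) r) of λ ()
          (inj₂ a) → apart a u∈ v∈ u~v
      ; d-e = λ _ _ _ ()
      ; b≢2 = b≢2
      ; b-b = λ {u} {v} {i} {j} → b-b u v i j
      ; b-d = λ {u} {v} {i} {j} → b-d u v i j
      ; b-a = λ {u} {v} {i} {j} u∈ v∈ → case B-A i j of λ where
          (inj₁ x)       → ⊥-elim (exclusive x u∈ v∈)
          (inj₂ (_ , a)) → apart a u∈ v∈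
      ; b-h = λ {u} {v} {i} {j} → b-h u v i j }
      where
      bCol : Fin 5 → Colour
      bCol i = if ⌊ i ≟ m ⌋ then low 2F else high 0F

      b≢2 : ∀ i → bCol i ≢ high 2F
      b≢2 i eq with i ≟ m
      b≢2 i () | yes _
      b≢2 i () | no _

      d-main : ∀ {v i} → v ∈ D i → m ≡ i
      d-main {v} {i} v∈ with B-D m i
      ... | inj₁ eq = eq
      ... | inj₂ x = ⊥-elim (exclusive x w∈ v∈)

      b-b : ∀ u v i j → u ∈ B i → v ∈ B j → u ~ v → bCol i ≢ bCol j
      b-b u v i j u∈ v∈ u~v eq with i ≟ m | j ≟ m | B-triple m i j
      b-b u v i j u∈ v∈ u~v eq | yes refl | yes refl | _ = apart (B-same m) u∈ v∈ u~v
      b-b u v i j u∈ v∈ u~v () | yes _ | no _ | _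
      b-b u v i j u∈ v∈ u~v () | no _ | yes _ | _
      ... | no i≢m | no _ | inj₁ i≡m = i≢m i≡m
      ... | no _ | no j≢m | inj₂ (inj₁ j≡m) = j≢m j≡m
      ... | no _ | no _ | inj₂ (inj₂ (inj₁ x)) = exclusive x w∈ u∈
      ... | no _ | no _ | inj₂ (inj₂ (inj₂ (inj₁ x))) = exclusive x w∈ v∈
      ... | no _ | no _ | inj₂ (inj₂ (inj₂ (inj₂ (inj₁ x)))) = exclusive x u∈ v∈
      ... | no _ | no _ | inj₂ (inj₂ (inj₂ (inj₂ (inj₂ a)))) = apart a u∈ v∈ u~v

      b-d : ∀ u v i j → u ∈ B i → v ∈ D j → bCol i ≢ high 0F
      b-d u v i j u∈ v∈ eq with i ≟ m | B-D i j
      b-d u v i j u∈ v∈ () | yes _ | _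
      ... | no i≢m | inj₁ refl = i≢m (≡-sym (d-main v∈))
      ... | no _ | inj₂ x = exclusive x u∈ v∈

      b-h : ∀ u v i j → u ∈ B i → v ∈ A true j → u ~ v → bCol i ≢ low (hubColour m j)
      b-h u v i j u∈ v∈ u~v eq with i ≟ m
      b-h u v i j u∈ v∈ u~v () | no _
      ... | yes refl with B-H m j
      ... | inj₁ a = apart a u∈ v∈ u~v
      ... | inj₂ near = hubColour-near m j near (inj₁-injective (≡-sym eq))

    d-joined : ∀ {u v i} → u ∈ D i → v ∈ D (next i) → u ~ v
    d-joined {i = i} = joined (D-D-joined i)

    d-apart : ∀ {u v i j} → ring i j ≡ false → u ∈ D i → v ∈ D j → u ≁ v
    d-apart {i = i} {j} r u∈ v∈ with D-D i j
    ... | inj₁ r′ = case trans (≡-sym r) r′ of λ ()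
    ... | inj₂ a = apart a u∈ v∈

    -- For distinct non-adjacent indices `a`, `d`, `rim i`, `e`, `b` is a P₅; for adjacent ones the
    -- two classes `A false` exclude each other.
    a-d-pair : ∀ {a b d e i j} → a ∈ A false i → b ∈ A false j → d ∈ D i → e ∈ D j → i ≡ j
    a-d-pair {a} {b} {d} {e} {i} {j} a∈ b∈ d∈ e∈ with A-A i j | ring i j in r
    ... | inj₁ i≡j | _ = i≡j
    ... | inj₂ _ | true = ⊥-elim (exclusive (A-A-exclusive i j r) a∈ b∈)
    ... | inj₂ a≁b | false with A-D i j | A-D j i
    ... | inj₁ i≡j | _ = i≡j
    ... | inj₂ _ | inj₁ j≡i = ≡-sym j≡i
    ... | inj₂ a≁e | inj₂ b≁d = ⊥-elim (p5 (joined (A-D-joined i) a∈ d∈)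
          (sees d∈ (suc i) (cong not (ring-irrefl i)))
          (~-sym (sees e∈ (suc i) (cong not (trans (ring-sym j i) r))))
          (~-sym (joined (A-D-joined j) b∈ e∈))
          (misses a∈ (suc i) (ring-irrefl i)) (apart a≁e a∈ e∈) (apart a≁b a∈ b∈)
          (d-apart r d∈ e∈) (≁-sym (apart b≁d b∈ d∈))
          (≁-sym (misses b∈ (suc i) (trans (ring-sym j i) r))))

    main? : ∀ i → Dec (Occupied (A false i) × Occupied (D i))
    main? i = occupied? (A false i) ×-dec occupied? (D i)

    chooseMain : ∃[ m ] (∀ {v i} → v ∈ A false i → ring m i ≡ false) ×
                        (∀ {u v i} → u ∈ A false i → v ∈ D i → i ≡ m)
    chooseMain with any? main?
    ... | yes (m , (a , a∈) , (d , d∈)) = m , range a∈ , λ u∈ v∈ → a-d-pair u∈ a∈ v∈ d∈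
      where
      range : ∀ {w m} → w ∈ A false m → ∀ {v i} → v ∈ A false i → ring m i ≡ false
      range {m = m} w∈ {i = i} v∈ with ring m i in r
      ... | false = refl
      ... | true = ⊥-elim (exclusive (A-A-exclusive m i r) w∈ v∈)
    ... | no none with any? (λ i → occupied? (A false i))
    ... | no empty = 0F , (λ v∈ → ⊥-elim (empty (_ , _ , v∈))) , λ u∈ v∈ → ⊥-elim (none (_ , (_ , u∈) , (_ , v∈)))
    ... | yes (m , w , w∈) = m , range , λ u∈ v∈ → ⊥-elim (none (_ , (_ , u∈) , (_ , v∈)))
      where
      range : ∀ {v i} → v ∈ A false i → ring m i ≡ false
      range {i = i} v∈ with ring m i in r
      ... | false = refl
      ... | true = ⊥-elim (exclusive (A-A-exclusive m i r) w∈ v∈)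

    e-apart : ∀ {u v i j} → i ≢ next (next j) → j ≢ next (next i) → u ∈ D i → v ∈ E j → u ≁ v
    e-apart {i = i} {j} p r u∈ v∈ with D-E i j
    ... | inj₁ eq = contradiction eq p
    ... | inj₂ (inj₁ eq) = contradiction eq r
    ... | inj₂ (inj₂ a) = apart a u∈ v∈

    -- The classes `D` may form a full blown-up pentagon and then need the third high colour, which
    -- `E` also has. Either some class `D e` is empty, or an edge from `D 0F` to `E` continues
    -- around the pentagon, away from the second class of `D` that this `E` can see, to a P₅.
    chooseSpecial : ∃[ e ] ∀ {u v j} → u ∈ D e → v ∈ E j → u ≁ v
    chooseSpecial with all? (λ i → occupied? (D i))
    ... | no some-empty = let (e , empty) = ¬∀⟶∃¬ 5 _ (λ i → occupied? (D i)) some-empty in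
                          e , λ u∈ _ → ⊥-elim (empty (_ , u∈))
    ... | yes full = 0F , no-edge
      where
      d : Fin 5 → V
      d i = proj₁ (full i)
      d∈ : ∀ i → d i ∈ D i
      d∈ i = proj₂ (full i)
      no-edge : ∀ {u v j} → u ∈ D 0F → v ∈ E j → u ≁ v
      no-edge {j = j} u∈ v∈ u~v with D-E 0F j
      ... | inj₂ (inj₂ a) = apart a u∈ v∈ u~v
      ... | inj₂ (inj₁ refl) = p5 (~-sym u~v) (d-joined u∈ (d∈ 1F)) (d-joined (d∈ 1F) (d∈ 2F)) (d-joined (d∈ 2F) (d∈ 3F))
          (≁-sym (e-apart (λ ()) (λ ()) (d∈ 1F) v∈)) (≁-sym (e-apart (λ ()) (λ ()) (d∈ 2F) v∈))
          (≁-sym (e-apart (λ ()) (λ ()) (d∈ 3F) v∈))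
          (d-apart refl u∈ (d∈ 2F)) (d-apart refl u∈ (d∈ 3F)) (d-apart refl (d∈ 1F) (d∈ 3F))
      no-edge {j = 4F} u∈ v∈ u~v | inj₁ ()
      no-edge {j = 3F} u∈ v∈ u~v | inj₁ _ = p5 (~-sym u~v) (~-sym (d-joined (d∈ 4F) u∈))
          (~-sym (d-joined (d∈ 3F) (d∈ 4F))) (~-sym (d-joined (d∈ 2F) (d∈ 3F)))
          (≁-sym (e-apart (λ ()) (λ ()) (d∈ 4F) v∈)) (≁-sym (e-apart (λ ()) (λ ()) (d∈ 3F) v∈))
          (≁-sym (e-apart (λ ()) (λ ()) (d∈ 2F) v∈))
          (d-apart refl u∈ (d∈ 3F)) (d-apart refl u∈ (d∈ 2F)) (d-apart refl (d∈ 4F) (d∈ 2F))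

    withoutB : (∀ {v i} → ¬ v ∈ B i) → Scheme
    withoutB noB = let (m , range , a-d) = chooseMain; (e , special) = chooseSpecial in record
      { m = m ; dCol = dColour e ; bCol = λ _ → low 0F ; δ = spare (dColour e m)
      ; δ≢2 = proj₂ (spare-≢ (dColour e m)) ; δ≢main = proj₁ (spare-≢ (dColour e m))
      ; a-range = range ; a-d = a-d
      ; d-d = λ {u} {v} {i} {j} u∈ v∈ u~v → case D-D i j of λ where
          (inj₁ r) → dColour-proper e i j r
          (inj₂ a) → contradiction u~v (apart a u∈ v∈)
      ; d-e = λ {u} {v} {i} {j} u∈ v∈ u~v eq → case dColour-special e i eq of λ where
          refl → special u∈ v∈ u~v
      ; b≢2 = λ _ ()
      ; b-b = λ u∈ → ⊥-elim (noB u∈)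
      ; b-d = λ u∈ → ⊥-elim (noB u∈)
      ; b-a = λ u∈ → ⊥-elim (noB u∈)
      ; b-h = λ u∈ → ⊥-elim (noB u∈) }

    opaque
      scheme : Scheme
      scheme with any? (λ i → occupied? (B i))
      ... | yes (m , w , w∈) = withB w∈
      ... | no none = withoutB λ v∈ → none (_ , _ , v∈)

    -- Five-wheels: vertices without neighbours on the rim

    data Kind (v : V) : Set where
      rimless : ∀ h → v ∈ Z h → Kind v
      full    : ∀ h → v ∈ F h → Kind v
      middle  : ∀ c → Middle c → v ∈ c → Kind v

    opaque
      kind : ∀ v → Kind v
      kind v with class v
      ... | Z h   , v∈ = rimless h v∈
      ... | F h   , v∈ = full h v∈
      ... | A h i , v∈ = middle (A h i) tt v∈
      ... | B i   , v∈ = middle (B i) tt v∈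
      ... | D i   , v∈ = middle (D i) tt v∈
      ... | E i   , v∈ = middle (E i) tt v∈

    Rimless Full Mid : V → Set
    Rimless v = ∀ i → v ≁ rim i
    Full v = ∀ i → v ~ rim i
    Mid v = ∃[ i ] ∃[ j ] rim i ~ rim j × v ~ rim i × v ≁ rim j

    opaque
      rimless? : ∀ v → Dec (Rimless v)
      rimless? v = all? λ i → ¬? (v ~? rim i)

    opaque
      full? : ∀ v → Dec (Full v)
      full? v = all? λ i → v ~? rim i

    opaque
      mid? : ∀ v → Dec (Mid v)
      mid? v = any? λ i → any? λ j → (rim i ~? rim j) ×-dec (v ~? rim i) ×-dec ¬? (v ~? rim j)

    middle⇒mid : ∀ {v c} → Middle c → v ∈ c → Mid v
    middle⇒mid {c = c} mc v∈ = let (i , j , ij , vi , vj) = half-seen c mc in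
      i , j , rim-edge i j ij , sees v∈ (suc i) vi , misses v∈ (suc j) vj

    opaque
      trichotomy : ∀ v → Rimless v ⊎ Full v ⊎ Mid v
      trichotomy v with kind v
      ... | rimless h v∈ = inj₁ λ i → misses v∈ (suc i) refl
      ... | full h v∈ = inj₂ (inj₁ λ i → sees v∈ (suc i) refl)
      ... | middle c mc v∈ = inj₂ (inj₂ (middle⇒mid mc v∈))

    -- Otherwise `z′`, `z`, `u`, `rim i`, `rim j` form a P₅.
    mid-homogeneous : ∀ {u z z′} → Mid u → Rimless z → Rimless z′ → z ~ z′ → u ~ z → u ~ z′
    mid-homogeneous {u} {z} {z′} (i , j , ij , ui , uj) rz rz′ zz′ uz = decidable-stable (u ~? z′) λ u≁z′ →
      p5 (~-sym zz′) (~-sym uz) ui ij (≁-sym u≁z′) (rz′ i) (rz′ j) (rz i) (rz j) uj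

    full-apart : ∀ {f g} → Full f → Full g → f ≁ g
    full-apart Ff Fg f~g = k4 (Ff 0F) (Ff 1F) f~g (rim-edge 0F 1F refl) (~-sym (Fg 0F)) (~-sym (Fg 1F))

    Touched : V → Set
    Touched z = ∃[ u ] Mid u × u ~ z

    opaque
      touched? : ∀ z → Dec (Touched z)
      touched? z = any? λ u → mid? u ×-dec (u ~? z)

    Z₁ Z₂ : V → Set
    Z₁ z = Rimless z × Touched z
    Z₂ z = Rimless z × ¬ Touched z

    opaque
      z₁? : ∀ z → Dec (Z₁ z)
      z₁? z = rimless? z ×-dec touched? z

    opaque
      z₂? : ∀ z → Dec (Z₂ z)
      z₂? z = rimless? z ×-dec ¬? (touched? z)

    z₁-triangle-free : TriangleFree Z₁
    z₁-triangle-free (ra , u , mu , u~a) (rb , _) (rc , _) ab bc ac =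
      k4 u~a (mid-homogeneous mu ra rb ab u~a) (mid-homogeneous mu ra rc ac u~a) ab ac bc

    open Components z₂?

    Candidate : V → V → Set
    Candidate r f = Full f × ∃[ z ] Z₂ z × root z ≡ r × f ~ z

    opaque
      candidate? : ∀ r f → Dec (Candidate r f)
      candidate? r f = full? f ×-dec any? λ z → z₂? z ×-dec (root z ≟ r) ×-dec (f ~? z)

    some-candidate : ∀ {z} → Z₂ z → ∃ (Candidate (root z))
    some-candidate {z} z∈ = travel Q keep (conn (rim 0F) z) (λ (r , _) → ⊥-elim (r 1F (rim-edge 0F 1F refl))) z∈
      where
      Q : V → Set
      Q z = Z₂ z → ∃ (Candidate (root z))
      keep : ∀ {v w} → v ~ w → Q v → Q w
      keep {v} {w} v~w q w∈ with trichotomy v | touched? v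
      ... | inj₂ (inj₁ Fv) | _ = v , Fv , w , w∈ , refl , v~w
      ... | inj₂ (inj₂ mv) | _ = contradiction (v , mv , v~w) (proj₂ w∈)
      ... | inj₁ rv | yes (u , mu , u~v) = contradiction (u , mu , mid-homogeneous mu rv (proj₁ w∈) v~w u~v) (proj₂ w∈)
      ... | inj₁ rv | no ¬t with q (rv , ¬t)
      ... | f , Ff , z , z∈ , eq , f~z = f , Ff , z , z∈ , trans eq (root-cong (rv , ¬t) w∈ v~w) , f~z

    Twins : V → V → Set
    Twins u v = ∀ g → Full g → (g ~ u → g ~ v) × (g ~ v → g ~ u)

    -- Such an edge is seen by a full vertex entirely or not at all; the exchange argument of
    -- `⊑-total` needs both ends to obtain a K₄.
    TwinEdge : V → V → V → Set
    TwinEdge r u v = (Z₂ u × root u ≡ r) × (Z₂ v × root v ≡ r) × u ~ v × Twins u v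

    opaque
      twinEdge? : ∀ r u v → Dec (TwinEdge r u v)
      twinEdge? r u v = (z₂? u ×-dec (root u ≟ r)) ×-dec (z₂? v ×-dec (root v ≟ r)) ×-dec (u ~? v) ×-dec
        all? λ g → full? g →-dec (((g ~? u) →-dec (g ~? v)) ×-dec ((g ~? v) →-dec (g ~? u)))

    -- By K₄-freeness the sets of twin edges seen by the vertices complete to the rim form a chain.
    _⊑[_]_ : V → V → V → Set
    f ⊑[ r ] g = ∀ u v → TwinEdge r u v → f ~ u → g ~ u

    ⊑-total : ∀ r {f g} → Full f → Full g → f ⊑[ r ] g ⊎ g ⊑[ r ] f
    ⊑-total r {f} {g} Ff Fg with any? (λ u → any? λ v → twinEdge? r u v ×-dec (f ~? u) ×-dec ¬? (g ~? u))
    ... | no none = inj₁ λ u v te f~u → decidable-stable (g ~? u) λ g≁u → none (u , v , te , f~u , g≁u)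
    ... | yes (u , v , (((ru , _) , _) , ((rv , _) , _) , u~v , uv) , f~u , g≁u) = inj₂ λ
      p q (((rp , _) , _) , ((rq , _) , _) , p~q , pq) g~p → decidable-stable (f ~? p) λ f≁p →
      let f~v = proj₁ (uv f Ff) f~u
          g~q = proj₁ (pq g Fg) g~p
          g≁v = λ e → g≁u (proj₂ (uv g Fg) e)
          f≁q = λ e → f≁p (proj₂ (pq f Ff) e)
      in k4 u~v (cross ru rp f~u g~p g≁u f≁p) (cross ru rq f~u g~q g≁u f≁q)
            (cross rv rp f~v g~p g≁v f≁p) (cross rv rq f~v g~q g≁v f≁q) p~q
      where
      -- Without the edge, `x`, `f`, `rim 0F`, `g`, `y` is a P₅. Applied to all four pairs of ends,
      -- this joins the two twin edges to a K₄.
      cross : ∀ {x y} → Rimless x → Rimless y → f ~ x → g ~ y → g ≁ x → f ≁ y → x ~ y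
      cross {x} {y} rx ry f~x g~y g≁x f≁y = decidable-stable (x ~? y) λ x≁y →
        p5 (~-sym f~x) (Ff 0F) (~-sym (Fg 0F)) g~y (rx 0F) (≁-sym g≁x) x≁y
           (full-apart Ff Fg) f≁y (≁-sym (ry 0F))

    Best : V → V → Set
    Best r f = Candidate r f × ∀ {g} → Candidate r g → g ⊑[ r ] f

    best : ∀ {r} → ∃ (Candidate r) → ∃ (Best r)
    best {r} (f , cf) = select (maximal {C = Candidate r} (candidate? r) (λ f g → f ⊑[ r ] g)
        (λ p q u v te e → q u v te (p u v te e)) (λ c c′ → ⊑-total r (proj₁ c) (proj₁ c′)) (allFin (n G)))
      where
      select : (∀ {x} → Candidate r x → ¬ x ∈ˡ allFin (n G)) ⊎
               ∃[ m ] Candidate r m × (∀ {x} → Candidate r x → x ∈ˡ allFin (n G) → x ⊑[ r ] m) → ∃ (Best r)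
      select (inj₁ none) = contradiction (∈-allFin f) (none {f} cf)
      select (inj₂ (m , cm , top)) = m , cm , λ {g} cg → top {g} cg (∈-allFin g)

    opaque
      apex : V → V
      apex r = case any? (candidate? r) of λ { (yes c) → proj₁ (best c) ; (no _) → r }

      apex-best : ∀ {z} → Z₂ z → Best (root z) (apex (root z))
      apex-best {z} z∈ with any? (candidate? (root z))
      ... | yes c = proj₂ (best c)
      ... | no none = contradiction (some-candidate z∈) none

    Upper Lower : V → Set
    Upper z = Z₂ z × apex (root z) ~ z
    Lower z = Z₂ z × apex (root z) ≁ z

    opaque
      upper? : ∀ z → Dec (Upper z)
      upper? z = z₂? z ×-dec (apex (root z) ~? z)

    opaque
      lower? : ∀ z → Dec (Lower z)
      lower? z = z₂? z ×-dec ¬? (apex (root z) ~? z)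

    same-apex : ∀ {y z} → Z₂ y → Z₂ z → y ~ z → apex (root y) ≡ apex (root z)
    same-apex y∈ z∈ y~z = cong apex (root-cong y∈ z∈ y~z)

    upper-triangle-free : TriangleFree Upper
    upper-triangle-free (a∈ , ga) (b∈ , gb) (c∈ , gc) ab bc ac = neighbours-triangle-free k4 ga
      (subst (_~ _) (≡-sym (same-apex a∈ b∈ ab)) gb) (subst (_~ _) (≡-sym (same-apex a∈ c∈ ac)) gc) ab bc ac

    apex-full : ∀ {z} → Z₂ z → Full (apex (root z))
    apex-full z∈ = proj₁ (proj₁ (apex-best z∈))

    lower-homogeneous : ∀ {y z z′} → Upper y → Lower z → Lower z′ → z ~ z′ → y ~ z → y ~ z′
    lower-homogeneous {y} {z} {z′} (y∈ , gy) (z∈ , gz) (z′∈ , gz′) zz′ yz = decidable-stable (y ~? z′) λ y≁z′ →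
      p5 (~-sym zz′) (~-sym yz) (~-sym gy) (apex-full y∈ 0F) (≁-sym y≁z′)
         (≁-sym (subst (_≁ z′) (≡-sym (trans g₁ g₂)) gz′)) (proj₁ z′∈ 0F)
         (≁-sym (subst (_≁ z) (≡-sym g₁) gz)) (proj₁ z∈ 0F) (proj₁ y∈ 0F)
      where
      g₁ = same-apex y∈ z∈ yz
      g₂ = same-apex z∈ z′∈ zz′

    -- Otherwise `z′`, `z`, `f`, `rim 0F` and the apex form a P₅. This makes every edge of `Lower` a
    -- twin edge.
    lower-full-homogeneous : ∀ {f z z′} → Full f → Lower z → Lower z′ → z ~ z′ → f ~ z → f ~ z′
    lower-full-homogeneous {f} {z} {z′} Ff (z∈ , gz) (z′∈ , gz′) zz′ fz = decidable-stable (f ~? z′) λ f≁z′ →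
      p5 (~-sym zz′) (~-sym fz) (Ff 0F) (~-sym (apex-full z∈ 0F)) (≁-sym f≁z′) (proj₁ z′∈ 0F)
         (≁-sym (subst (_≁ z′) (≡-sym (same-apex z∈ z′∈ zz′)) gz′)) (proj₁ z∈ 0F) (≁-sym gz)
         (full-apart Ff (apex-full z∈))

    lower-dominated : ∀ {z} → Lower z → ∃[ y ] Upper y × y ~ z
    lower-dominated {z} (z∈ , gz) with proj₁ (apex-best z∈)
    ... | _ , z₀ , z₀∈ , eq , g~z₀ =
      case spread Q keep z₀∈ z∈ eq (inj₁ (z₀∈ , subst (λ r → apex r ~ z₀) (≡-sym eq) g~z₀)) of λ where
        (inj₁ (_ , e)) → contradiction e gz
        (inj₂ found)   → found
      where
      Q : V → Set
      Q z = Upper z ⊎ ∃[ y ] Upper y × y ~ z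
      keep : ∀ {v w} → Z₂ v → Z₂ w → v ~ w → Q v → Q w
      keep v∈ w∈ v~w (inj₁ uv) = inj₂ (_ , uv , v~w)
      keep {v} {w} v∈ w∈ v~w (inj₂ (y , uy , y~v)) with apex (root v) ~? v | apex (root w) ~? w
      ... | yes gv | _ = inj₂ (v , (v∈ , gv) , v~w)
      ... | no _ | yes gw = inj₁ (w∈ , gw)
      ... | no ¬gv | no ¬gw = inj₂ (y , uy , lower-homogeneous uy (v∈ , ¬gv) (w∈ , ¬gw) v~w y~v)

    lower-triangle-free : TriangleFree Lower
    lower-triangle-free la lb lc ab bc ac with lower-dominated la
    ... | y , uy , y~a = k4 y~a (lower-homogeneous uy la lb ab y~a) (lower-homogeneous uy la lc ac y~a) ab ac bc

    -- The apex sees every twin edge that some candidate sees, but it sees nothing of `Lower`. So a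
    -- vertex of `Lower` below a full vertex is isolated in `Lower` and avoids the colour `high 2F`
    -- of the full vertices.
    lower-edge-unseen : ∀ {f z z′} → Full f → Lower z → Lower z′ → z ~ z′ → f ≁ z
    lower-edge-unseen {f} {z} {z′} Ff lz@(z∈ , gz) lz′@(z′∈ , _) zz′ fz =
      gz (proj₂ (apex-best z∈) (Ff , z , z∈ , refl , fz) z z′ twins fz)
      where
      twins : TwinEdge (root z) z z′
      twins = (z∈ , refl) , (z′∈ , ≡-sym (root-cong z∈ z′∈ zz′)) , zz′ , λ g Fg →
        lower-full-homogeneous Fg lz lz′ zz′ , lower-full-homogeneous Fg lz′ lz (~-sym zz′)

    private
      module C₁ = TriangleFreeColouring p5 z₁? z₁-triangle-free
      module U = TriangleFreeColouring p5 upper? upper-triangle-free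
      module L = TriangleFreeColouring p5 lower? lower-triangle-free
      c₁ = C₁.threeColour
      cᵤ = U.threeColour
      cₗ = L.threeColour-isolated

    data Zone (z : V) : Set where
      zone₁ : Z₁ z → Zone z
      upper : Upper z → Zone z
      lower : Lower z → Zone z

    zone : ∀ {z} → Rimless z → Zone z
    zone {z} rz with touched? z | apex (root z) ~? z
    ... | yes t | _ = zone₁ (rz , t)
    ... | no ¬t | yes g = upper ((rz , ¬t) , g)
    ... | no ¬t | no ¬g = lower ((rz , ¬t) , ¬g)

    -- The middle classes with neighbours off the rim are among `D` and `E`, both coloured high, and
    -- they reach only `Z₁`. Low colours therefore never conflict with the coloured wheel classes,
    -- and the high ones of `Lower` have to respect the full vertices only.
    zColour : ∀ {z} → Zone z → Colour
    zColour {z} (zone₁ _) = low (proj₁ c₁ z)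
    zColour {z} (upper _) = low (proj₁ cᵤ z)
    zColour {z} (lower _) = high (proj₁ cₗ z)

    z₁-closed : ∀ {z z′} → Z₁ z → Z₂ z′ → z ≁ z′
    z₁-closed (rz , u , mu , uz) (rz′ , ¬t) zz′ = ¬t (u , mu , mid-homogeneous mu rz rz′ zz′ uz)

    zColour-proper : ∀ {y z} → y ~ z → (ζ : Zone y) (ξ : Zone z) → zColour ζ ≢ zColour ξ
    zColour-proper yz (zone₁ p) (zone₁ q) eq = proj₂ c₁ p q yz (inj₁-injective eq)
    zColour-proper yz (zone₁ p) (upper (q , _)) eq = z₁-closed p q yz
    zColour-proper yz (upper (p , _)) (zone₁ q) eq = z₁-closed q p (~-sym yz)
    zColour-proper yz (upper p) (upper q) eq = proj₂ cᵤ p q yz (inj₁-injective eq)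
    zColour-proper yz (lower p) (lower q) eq = proj₁ (proj₂ cₗ) p q yz (inj₂-injective eq)

    zColour-full : ∀ {f z} → Full f → f ~ z → (ζ : Zone z) → zColour ζ ≢ high 2F
    zColour-full {f} {z} Ff fz (lower lz) eq = case trans (≡-sym (inj₂-injective eq)) isolated of λ ()
      where
      isolated : proj₁ cₗ z ≡ 0F
      isolated = proj₂ (proj₂ cₗ) λ lz′ zz′ → lower-edge-unseen Ff lz lz′ zz′ fz

    zColour-mid : ∀ {u z} → Mid u → u ~ z → (ζ : Zone z) → ∃[ i ] zColour ζ ≡ low i
    zColour-mid mu uz (zone₁ _) = _ , refl
    zColour-mid mu uz (upper ((_ , ¬t) , _)) = contradiction (_ , mu , uz) ¬t
    zColour-mid mu uz (lower ((_ , ¬t) , _)) = contradiction (_ , mu , uz) ¬t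

    open Shading scheme

    colour : ∀ {v} → Kind v → Colour
    colour (rimless h z∈)     = zColour (zone λ i → misses z∈ (suc i) refl)
    colour {v} (full h _)     = shade (F h) (q v)
    colour {v} (middle c _ _) = shade c (q v)

    rimless-middle : ∀ {z v h c} → z ∈ Z h → v ∈ c → z ~ v → (mc : Middle c) (ζ : Zone z) → zColour ζ ≢ shade c (q v)
    rimless-middle {h = h} {A h′ i} z∈ v∈ zv _ ζ _ = apart (Z-A h h′ i) z∈ v∈ zv
    rimless-middle {h = h} {B i} z∈ v∈ zv _ ζ _ = apart (Z-B h i) z∈ v∈ zv
    rimless-middle {c = D i} z∈ v∈ zv mc ζ eq with zColour-mid (middle⇒mid mc v∈) (~-sym zv) ζ
    ... | j , eq′ = case trans (≡-sym eq′) eq of λ ()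
    rimless-middle {c = E i} z∈ v∈ zv mc ζ eq with zColour-mid (middle⇒mid mc v∈) (~-sym zv) ζ
    ... | j , eq′ = case trans (≡-sym eq′) eq of λ ()

    core : ∀ c → Middle c → Core c
    core (A h i) _ = A h i
    core (B i)   _ = B i
    core (D i)   _ = D i
    core (E i)   _ = E i

    colour-proper : ∀ {u v} → u ~ v → (κ : Kind u) (μ : Kind v) → colour κ ≢ colour μ
    colour-proper uv (rimless h u∈) (rimless h′ v∈) = zColour-proper uv _ _
    colour-proper uv (rimless h u∈) (full h′ v∈) = zColour-full (λ i → sees v∈ (suc i) refl) (~-sym uv) _
    colour-proper uv (rimless h u∈) (middle c mc v∈) = rimless-middle u∈ v∈ uv mc _
    colour-proper uv (full h u∈) (rimless h′ v∈) eq = zColour-full (λ i → sees u∈ (suc i) refl) uv _ (≡-sym eq)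
    colour-proper uv (full h u∈) (full h′ v∈) = shade-proper (F h) (F h′) u∈ v∈ uv
    colour-proper uv (full h u∈) (middle c mc v∈) = shade-proper (F h) (core c mc) u∈ v∈ uv
    colour-proper uv (middle c mc u∈) (rimless h v∈) eq = rimless-middle v∈ u∈ (~-sym uv) mc _ (≡-sym eq)
    colour-proper uv (middle c mc u∈) (full h v∈) = shade-proper (core c mc) (F h) u∈ v∈ uv
    colour-proper uv (middle c mc u∈) (middle d md v∈) = shade-proper (core c mc) (core d md) u∈ v∈ uv

    colouring : Colourable G 6
    colouring = (λ v → join 3 3 (colour (kind v))) , λ u v uv eq →
      colour-proper uv (kind u) (kind v)
        (trans (≡-sym (splitAt-join 3 3 _)) (trans (cong (splitAt 3) eq) (splitAt-join 3 3 _)))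

  module _ (p5 : P5-Free) (k4 : K4-Free) (conn : Connected G) where

    K4-free-colouring : Colourable G 6
    K4-free-colouring with wheel?
      where open K4FreeColouring p5 k4 conn
    ... | no noWheel with any? {P = λ (_ : V) → ⊤} (λ _ → yes tt)
    ...   | yes (o , _) = K4FreeColouring.Wheelless.colouring p5 k4 conn noWheel o
    ...   | no empty = (λ v → ⊥-elim (empty (v , tt))) , λ v → ⊥-elim (empty (v , tt))
    K4-free-colouring | yes (h , a , ha , b , hb , c , hc , d , hd , e , he ,
                             (ab , bc , cd , de , ea) , ac , bd , ce , da , eb) =
      WheelColouring.colouring p5 k4 conn wheel wheel-adj
      where
      wheel : Fin 6 → V
      wheel = lookup (h ∷ a ∷ b ∷ c ∷ d ∷ e ∷ [])
      fr : ∀ {u v} → u ≁ v → adj G u v ≡ false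
      fr = ≁⇒false
      wheel-adj : ∀ k l → adj G (wheel k) (wheel l) ≡ wheelAdj k l
      wheel-adj 0F 0F = irrefl G h
      wheel-adj 0F 1F = ha
      wheel-adj 0F 2F = hb
      wheel-adj 0F 3F = hc
      wheel-adj 0F 4F = hd
      wheel-adj 0F 5F = he
      wheel-adj 1F 0F = ~-sym ha
      wheel-adj 2F 0F = ~-sym hb
      wheel-adj 3F 0F = ~-sym hc
      wheel-adj 4F 0F = ~-sym hd
      wheel-adj 5F 0F = ~-sym he
      wheel-adj 1F 1F = irrefl G a
      wheel-adj 1F 2F = ab
      wheel-adj 1F 3F = fr ac
      wheel-adj 1F 4F = fr (≁-sym da)
      wheel-adj 1F 5F = ~-sym ea
      wheel-adj 2F 1F = ~-sym ab
      wheel-adj 2F 2F = irrefl G b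
      wheel-adj 2F 3F = bc
      wheel-adj 2F 4F = fr bd
      wheel-adj 2F 5F = fr (≁-sym eb)
      wheel-adj 3F 1F = fr (≁-sym ac)
      wheel-adj 3F 2F = ~-sym bc
      wheel-adj 3F 3F = irrefl G c
      wheel-adj 3F 4F = cd
      wheel-adj 3F 5F = fr ce
      wheel-adj 4F 1F = fr da
      wheel-adj 4F 2F = fr (≁-sym bd)
      wheel-adj 4F 3F = ~-sym cd
      wheel-adj 4F 4F = irrefl G d
      wheel-adj 4F 5F = de
      wheel-adj 5F 1F = ea
      wheel-adj 5F 2F = fr eb
      wheel-adj 5F 3F = fr (≁-sym ce)
      wheel-adj 5F 4F = ~-sym de
      wheel-adj 5F 5F = irrefl G e

  -- Graphs with a clique of size at least four

  -- Olariu: a connected paw-free graph with a triangle is complete multipartite.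
  module Multipartite (hvn : HVN-Free) {P : Fin (n G) → Set} (P? : ∀ v → Dec (P v)) where

    open Components P?

    Dominates : V → V → Set
    Dominates y x = ∀ {x′} → P x′ → root x′ ≡ root x → y ~ x′

    record Big (r : V) : Set where
      constructor triangle
      field corners : ∃[ a ] (P a × root a ≡ r) × ∃[ b ] (P b × root b ≡ r) × ∃[ c ] (P c × root c ≡ r) ×
                      a ~ b × a ~ c × b ~ c

    opaque
      big? : ∀ r → Dec (Big r)
      big? r = map′ triangle Big.corners
        (any? λ a → in? a ×-dec any? λ b → in? b ×-dec any? λ c → in? c ×-dec
         (a ~? b) ×-dec (a ~? c) ×-dec (b ~? c))
        where
        in? : ∀ v → Dec (P v × root v ≡ r)
        in? v = P? v ×-dec (root v ≟ r)

    Two : V → V → V → V → Set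
    Two a b c x = (x ~ a × x ~ b) ⊎ (x ~ a × x ~ c) ⊎ (x ~ b × x ~ c)

    -- Non-adjacency will be an equivalence relation on a big component, and this picks the first
    -- member of the class of `v`.
    rep : V → V
    rep v = first v (λ u → (P? u ×-dec (root u ≟ root v)) ×-dec ¬? (u ~? v)) (allFin (n G))

    Rep : V → V → Set
    Rep r u = (P u × root u ≡ r) × rep u ≡ u

    rep? : ∀ r u → Dec (Rep r u)
    rep? r u = (P? u ×-dec (root u ≟ r)) ×-dec (rep u ≟ u)

    reps : V → List V
    reps r = filter (rep? r) (allFin (n G))

    position : V → ℕ
    position v = indexOf (rep v) (reps (root v))

    rep-spec : ∀ {v} → P v → (P (rep v) × root (rep v) ≡ root v) × rep v ≁ v
    rep-spec {v} Pv = first-sat (λ u → (P? u ×-dec (root u ≟ root v)) ×-dec ¬? (u ~? v)) (∈-allFin v) ((Pv , refl) , ~-irrefl)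

    module Component {o y : V} (Po : P o) (dom : Dominates y o) (big : Big (root o)) where

      In : V → Set
      In v = P v × root v ≡ root o

      -- A paw together with the dominating vertex `y` is an HVN: `y`, `a`, `b`, `c` form the K₄,
      -- and `d` sees only `y` and `a` of it.
      paw : ∀ {a b c d} → In a → In b → In c → In d → a ~ b → a ~ c → b ~ c → d ~ a → d ~ b ⊎ d ~ c
      paw {a} {b} {c} {d} (Pa , ra) (Pb , rb) (Pc , rc) (Pd , rd) ab ac bc da with d ~? b | d ~? c
      ... | yes e | _ = inj₁ e
      ... | no _ | yes e = inj₂ e
      ... | no ¬b | no ¬c = ⊥-elim (hvn (dom Pa ra) (dom Pb rb) (dom Pc rc) ab ac bc (dom Pd rd) (~-sym da)
                                        (≁-sym ¬b) (≁-sym ¬c))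

      module Triangle {a b c : V} (ia : In a) (ib : In b) (ic : In c) (ab : a ~ b) (ac : a ~ c) (bc : b ~ c) where

        two-from-a : ∀ {x} → In x → x ~ a → Two a b c x
        two-from-a ix xa with paw ia ib ic ix ab ac bc xa
        ... | inj₁ xb = inj₁ (xa , xb)
        ... | inj₂ xc = inj₂ (inj₁ (xa , xc))

        two-from-b : ∀ {x} → In x → x ~ b → Two a b c x
        two-from-b ix xb with paw ib ia ic ix (~-sym ab) bc ac xb
        ... | inj₁ xa = inj₁ (xa , xb)
        ... | inj₂ xc = inj₂ (inj₂ (xb , xc))

        two-from-c : ∀ {x} → In x → x ~ c → Two a b c x
        two-from-c ix xc with paw ic ia ib ix (~-sym ac) (~-sym bc) ab xc
        ... | inj₁ xa = inj₂ (inj₁ (xa , xc))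
        ... | inj₂ xb = inj₂ (inj₂ (xb , xc))

        two-step : ∀ {v w} → In v → In w → v ~ w → Two a b c v → Two a b c w
        two-step iv iw vw (inj₁ (va , vb)) with paw iv ia ib iw va vb ab (~-sym vw)
        ... | inj₁ e = two-from-a iw e
        ... | inj₂ e = two-from-b iw e
        two-step iv iw vw (inj₂ (inj₁ (va , vc))) with paw iv ia ic iw va vc ac (~-sym vw)
        ... | inj₁ e = two-from-a iw e
        ... | inj₂ e = two-from-c iw e
        two-step iv iw vw (inj₂ (inj₂ (vb , vc))) with paw iv ib ic iw vb vc bc (~-sym vw)
        ... | inj₁ e = two-from-b iw e
        ... | inj₂ e = two-from-c iw e

        -- The property spreads through the component: two seen corners form a triangle with `v`,
        -- and by `paw` a neighbour of `v` sees one of these corners, hence two corners of the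
        -- original triangle.
        two : ∀ {v} → In v → Two a b c v
        two (Pv , rv) = proj₂ (spread (λ v → In v × Two a b c v)
          (λ Pv Pw vw (iv , t) → let iw = Pw , trans (≡-sym (root-cong Pv Pw vw)) (proj₂ iv) in iw , two-step iv iw vw t)
          (proj₁ ia) Pv (trans (proj₂ ia) (≡-sym rv)) (ia , inj₂ (inj₂ (ab , ac))))

      third : ∀ {u v} → In u → In v → u ~ v → ∃[ d ] In d × u ~ d × v ~ d
      third {u} {v} iu iv uv = choose big
        where
        choose : Big (root o) → ∃[ d ] In d × u ~ d × v ~ d
        choose (triangle (a , ia , b , ib , c , ic , ab , ac , bc)) with Triangle.two ia ib ic ab ac bc iu | Triangle.two ia ib ic ab ac bc iv
        ... | inj₁ (ua , _) | inj₁ (va , _) = a , ia , ua , va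
        ... | inj₁ (ua , _) | inj₂ (inj₁ (va , _)) = a , ia , ua , va
        ... | inj₁ (_ , ub) | inj₂ (inj₂ (vb , _)) = b , ib , ub , vb
        ... | inj₂ (inj₁ (ua , _)) | inj₁ (va , _) = a , ia , ua , va
        ... | inj₂ (inj₁ (ua , _)) | inj₂ (inj₁ (va , _)) = a , ia , ua , va
        ... | inj₂ (inj₁ (_ , uc)) | inj₂ (inj₂ (_ , vc)) = c , ic , uc , vc
        ... | inj₂ (inj₂ (ub , _)) | inj₁ (_ , vb) = b , ib , ub , vb
        ... | inj₂ (inj₂ (_ , uc)) | inj₂ (inj₁ (_ , vc)) = c , ic , uc , vc
        ... | inj₂ (inj₂ (ub , _)) | inj₂ (inj₂ (vb , _)) = b , ib , ub , vb

      -- By `third` every edge lies in a triangle, and two of its three corners always include an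
      -- end of the edge. This is transitivity of non-adjacency.
      edge-dominates : ∀ {u v x} → In u → In v → In x → u ~ v → x ~ u ⊎ x ~ v
      edge-dominates iu iv ix uv with third iu iv uv
      ... | d , id , ud , vd with Triangle.two iu iv id uv ud vd ix
      ... | inj₁ (xu , _) = inj₁ xu
      ... | inj₂ (inj₁ (xu , _)) = inj₁ xu
      ... | inj₂ (inj₂ (xv , _)) = inj₂ xv

      ≁-trans : ∀ {u v w} → In u → In v → In w → u ≁ v → v ≁ w → u ≁ w
      ≁-trans iu iv iw u≁v v≁w u~w with edge-dominates iu iw iv u~w
      ... | inj₁ v~u = u≁v (~-sym v~u)
      ... | inj₂ v~w = v≁w v~w

      rep-cong : ∀ {u v} → In u → In v → u ≁ v → rep u ≡ rep v
      rep-cong {u} {v} iu@(Pu , ru) iv@(Pv , rv) u≁v =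
        first-cong (λ x → (P? x ×-dec (root x ≟ root u)) ×-dec ¬? (x ~? u))
                   (λ x → (P? x ×-dec (root x ≟ root v)) ×-dec ¬? (x ~? v))
          (λ ((Px , rx) , x≁u) → (Px , trans rx (trans ru (≡-sym rv))) ,
            ≁-trans (Px , trans rx ru) iu iv x≁u u≁v)
          (λ ((Px , rx) , x≁v) → (Px , trans rx (trans rv (≡-sym ru))) ,
            ≁-trans (Px , trans rx rv) iv iu x≁v (≁-sym u≁v))
          (∈-allFin u) ((Pu , refl) , ~-irrefl)

      rep-separates : ∀ {u v} → In u → In v → u ~ v → rep u ≢ rep v
      rep-separates {u} {v} iu@(Pu , ru) iv@(Pv , rv) u~v eq with rep-spec Pu | rep-spec Pv
      ... | (Pr , rr) , r≁u | _ , r≁v =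
        ≁-trans iu (Pr , trans rr ru) iv (≁-sym r≁u) (subst (_≁ v) (≡-sym eq) r≁v) u~v

      in-rep : ∀ {v} → In v → In (rep v)
      in-rep (Pv , rv) = let ((Pr , rr) , _) = rep-spec Pv in Pr , trans rr rv

      rep∈reps : ∀ {v} → In v → rep v ∈ˡ reps (root o)
      rep∈reps iv@(Pv , _) = ∈-filter⁺ (rep? (root o)) (∈-allFin _) (in-rep iv , rep-cong (in-rep iv) iv (proj₂ (rep-spec Pv)))

      reps-in : ∀ {u} → u ∈ˡ reps (root o) → In u
      reps-in u∈ = proj₁ (proj₂ (∈-filter⁻ (rep? (root o)) {xs = allFin (n G)} u∈))

      reps-clique : AllPairs _~_ (reps (root o))
      reps-clique = allPairs (filter⁺ (rep? (root o)) (allFin⁺ (n G))) λ {u} {v} u∈ v∈ u≢v →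
        let (_ , iu , ru) = ∈-filter⁻ (rep? (root o)) {xs = allFin (n G)} u∈
            (_ , iv , rv) = ∈-filter⁻ (rep? (root o)) {xs = allFin (n G)} v∈
        in decidable-stable (u ~? v) λ u≁v → u≢v (trans (≡-sym ru) (trans (rep-cong iu iv u≁v) rv))

      position< : ∀ {v} → In v → position v < length (reps (root o))
      position< {v} iv@(_ , rv) = subst (λ r → indexOf (rep v) (reps r) < length (reps (root o))) (≡-sym rv)
                                        (indexOf-< (rep∈reps iv))

      position-proper : ∀ {u v} → In u → In v → u ~ v → position u ≢ position v
      position-proper {u} {v} iu@(_ , ru) iv@(_ , rv) u~v eq = rep-separates iu iv u~v
        (indexOf-injective (rep∈reps iu) (rep∈reps iv)
          (subst₂ (λ r s → indexOf (rep u) (reps r) ≡ indexOf (rep v) (reps s)) ru rv eq))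

      position-cong : ∀ {u v} → In u → In v → u ≁ v → position u ≡ position v
      position-cong iu@(_ , ru) iv@(_ , rv) u≁v = cong₂ indexOf (rep-cong iu iv u≁v) (cong reps (trans ru (≡-sym rv)))

  -- Colouring two layers

  MixedOn : (V → Set) → V → V → V → Set
  MixedOn N t x y = N x × N y × x ~ y × x ~ t × y ≁ t

  record LayerColouring (N T : V → Set) (m : ℕ) (π : ℕ → ℕ) (forb : V → ℕ) : Set where
    field
      colour        : V → ℕ
      colour-proper : ∀ {u v} → N u ⊎ T u → N v ⊎ T v → u ~ v → colour u ≢ colour v
      colour-range  : ∀ {v} → N v ⊎ T v → ∃[ k ] k < m × colour v ≡ π k
      colour-forb   : ∀ {v} → T v → colour v ≢ forb v

  module Layers (p5 : P5-Free) (hvn : HVN-Free)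
                {N T : Fin (n G) → Set} (N? : ∀ v → Dec (N v)) (T? : ∀ v → Dec (T v)) where

    private
      module CN = Components N?
      module CT = Components T?
      module MN = Multipartite hvn N?
      module MT = Multipartite hvn T?

    module Colour
      (w₁ : ℕ) (3≤w₁ : 3 ≤ w₁) (noClique : ¬ HasClique G (ℕ.suc (ℕ.suc w₁)))
      (disjoint : ∀ {v} → N v → ¬ T v)
      (hom : ∀ {x t t′} → N x → T t → T t′ → t ~ t′ → x ~ t → x ~ t′)
      (attached : ∀ {t} → T t → ∃[ x ] N x × x ~ t)
      -- A vertex complete to the component of `x` bounds the number of its parts by ω - 1; since it
      -- misses the partially attached vertices of `T`, it also completes the HVNs of `mixed-part`.
      (cap : ∀ {x} → N x → ∃[ y ] MN.Dominates y x ×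
             (∀ {t x₁ x₂} → T t → CN.root x₁ ≡ CN.root x → MixedOn N t x₁ x₂ → y ≁ t))
      (π : ℕ → ℕ) (π-injective : ∀ {i j} → π i ≡ π j → i ≡ j)
      (forb : V → ℕ)
      (forb-parts : ∀ {t t′} → T t → T t′ → CT.root t ≡ CT.root t′ → t ≁ t′ → forb t ≡ forb t′)
      (forb-mixed : ∀ {t x y} → T t → MixedOn N t x y → ∀ k → π k ≢ forb t)
      (forb-top : ∀ t {k} → w₁ ≤ k → π k ≢ forb t)
      where

      w : ℕ
      w = ℕ.suc w₁

      hom* : ∀ {x t t′} → N x → T t → T t′ → CT.root t ≡ CT.root t′ → x ~ t → x ~ t′
      hom* {x} Nx Tt Tt′ = CT.spread (x ~_) (λ Tv Tw vw xv → hom Nx Tv Tw vw xv) Tt Tt′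

      module BN {o} (No : N o) = MN.Component No (proj₁ (proj₂ (cap No)))
      module BT {o} (To : T o) = MT.Component To
        (λ {x′} Tx′ eq → hom* (proj₁ (proj₂ (attached To))) To Tx′ (≡-sym eq) (proj₂ (proj₂ (attached To))))

      SmallN SmallT : V → Set
      SmallN v = N v × ¬ MN.Big (CN.root v)
      SmallT v = T v × ¬ MT.Big (CT.root v)

      opaque
        smallN? : ∀ v → Dec (SmallN v)
        smallN? v = N? v ×-dec ¬? (MN.big? (CN.root v))

        smallT? : ∀ v → Dec (SmallT v)
        smallT? v = T? v ×-dec ¬? (MT.big? (CT.root v))

      smallN-triangle-free : TriangleFree SmallN
      smallN-triangle-free {a} {b} {c} (Na , ¬big) (Nb , _) (Nc , _) ab bc ac = ¬big (MN.triangle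
        (a , (Na , refl) , b , (Nb , ≡-sym (CN.root-cong Na Nb ab)) , c , (Nc , ≡-sym (CN.root-cong Na Nc ac)) , ab , ac , bc))

      smallT-triangle-free : TriangleFree SmallT
      smallT-triangle-free {a} {b} {c} (Ta , ¬big) (Tb , _) (Tc , _) ab bc ac = ¬big (MT.triangle
        (a , (Ta , refl) , b , (Tb , ≡-sym (CT.root-cong Ta Tb ab)) , c , (Tc , ≡-sym (CT.root-cong Ta Tc ac)) , ab , ac , bc))

      private
        module SN = TriangleFreeColouring p5 smallN? smallN-triangle-free
        module ST = TriangleFreeColouring p5 smallT? smallT-triangle-free
        cN = SN.threeColour-isolated
        cT = ST.threeColour

      opaque
        level : V → ℕ
        level v = case MN.big? (CN.root v) of λ { (yes _) → MN.position v ; (no _) → toℕ (proj₁ cN v) }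

        level-big : ∀ {x} → MN.Big (CN.root x) → level x ≡ MN.position x
        level-big {x} big with MN.big? (CN.root x)
        ... | yes _ = refl
        ... | no ¬big = contradiction big ¬big

        level-small : ∀ {x} → ¬ MN.Big (CN.root x) → level x ≡ toℕ (proj₁ cN x)
        level-small {x} ¬big with MN.big? (CN.root x)
        ... | yes big = contradiction big ¬big
        ... | no _ = refl

        capped : ∀ {x} → N x → MN.Big (CN.root x) → length (MN.reps (CN.root x)) ≤ w₁
        capped Nx big = ℕ.s≤s⁻¹ (clique-length noClique (All.tabulate (λ u∈ →
          let (Nu , ru) = BN.reps-in Nx big u∈ in proj₁ (proj₂ (cap Nx)) Nu ru) ∷ BN.reps-clique Nx big))

        attachedT : ∀ {t} → T t → MT.Big (CT.root t) → length (MT.reps (CT.root t)) ≤ w₁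
        attachedT {t} Tt big with attached Tt
        ... | x , Nx , xt = ℕ.s≤s⁻¹ (clique-length noClique (All.tabulate (λ u∈ →
          let (Tu , ru) = BT.reps-in Tt big u∈ in hom* Nx Tt Tu (≡-sym ru) xt) ∷ BT.reps-clique Tt big))

        level< : ∀ {x} → N x → level x < w₁
        level< {x} Nx with MN.big? (CN.root x)
        ... | yes big = ℕ.<-≤-trans (BN.position< Nx big (Nx , refl)) (capped Nx big)
        ... | no _ = ℕ.<-≤-trans (toℕ<n (proj₁ cN x)) 3≤w₁

        level-proper : ∀ {x y} → N x → N y → x ~ y → level x ≢ level y
        level-proper {x} {y} Nx Ny xy eq with MN.big? (CN.root x) | MN.big? (CN.root y)
        ... | yes big | yes _ = BN.position-proper Nx big (Nx , refl) (Ny , ≡-sym (CN.root-cong Nx Ny xy)) xy eq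
        ... | yes big | no ¬big = ¬big (subst MN.Big (CN.root-cong Nx Ny xy) big)
        ... | no ¬big | yes big = ¬big (subst MN.Big (≡-sym (CN.root-cong Nx Ny xy)) big)
        ... | no ¬bx | no ¬by = proj₁ (proj₂ cN) (Nx , ¬bx) (Ny , ¬by) xy (toℕ-injective eq)

      Mixed : V → Set
      Mixed t = ∃[ x ] ∃[ y ] MixedOn N t x y

      opaque
        mixed? : ∀ t → Dec (Mixed t)
        mixed? t = any? λ x → any? λ y → N? x ×-dec N? y ×-dec (x ~? y) ×-dec (x ~? t) ×-dec ¬? (y ~? t)

      MixedAt : V → V → Set
      MixedAt t r = ∃[ x ] ∃[ y ] MixedOn N t x y × CN.root x ≡ r

      opaque
        mixedAt? : ∀ t r → Dec (MixedAt t r)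
        mixedAt? t r = any? λ x → any? λ y →
          (N? x ×-dec N? y ×-dec (x ~? y) ×-dec (x ~? t) ×-dec ¬? (y ~? t)) ×-dec (CN.root x ≟ r)

      -- Edges in two different components, each with one end seen by `t`, would form a P₅ with `t`
      -- in the middle.
      mixed-unique : ∀ {t x y x′ y′} → MixedOn N t x y → MixedOn N t x′ y′ → CN.root x ≡ CN.root x′
      mixed-unique {t} {x} {y} {x′} {y′} (Nx , Ny , xy , xt , yt) (Nx′ , Ny′ , xy′ , xt′ , yt′) =
        decidable-stable (CN.root x ≟ CN.root x′) λ different →
          let ry  = CN.root-cong Nx Ny xy
              ry′ = CN.root-cong Nx′ Ny′ xy′
          in p5 (~-sym xy) xt (~-sym xt′) xy′ yt
               (λ e → different (trans ry (CN.root-cong Ny Nx′ e)))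
               (λ e → different (trans ry (trans (CN.root-cong Ny Ny′ e) (≡-sym ry′))))
               (λ e → different (CN.root-cong Nx Nx′ e))
               (λ e → different (trans (CN.root-cong Nx Ny′ e) (≡-sym ry′)))
               (≁-sym yt′)

      -- Otherwise an edge pq of neighbours of t lies in a K₄ with the vertex z that dominates the component,
      -- giving an HVN.
      mixed-part : ∀ {t o p q x y} → T t → MN.Big (CN.root o) → N o → MixedOn N t x y → CN.root x ≡ CN.root o →
                   N p → CN.root p ≡ CN.root o → N q → CN.root q ≡ CN.root o → p ~ t → q ~ t → p ≁ q
      mixed-part {t} {o} {p} {q} {x} {y} Tt big No mx@(Nx , Ny , xy , xt , yt) rx Np rp Nq rq pt qt pq =
        go (third ip iq pq)
        where
        open BN No big
        z = proj₁ (cap No)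
        ip : In p
        ip = Np , rp
        iq : In q
        iq = Nq , rq
        iy : In y
        iy = Ny , trans (≡-sym (CN.root-cong Nx Ny xy)) rx
        top : ∀ {v} → In v → z ~ v
        top (Nv , rv) = proj₁ (proj₂ (cap No)) Nv rv
        z≁t : z ≁ t
        z≁t = proj₂ (proj₂ (cap No)) Tt rx mx
        bad : ∀ {a b} → In a → In b → a ~ b → a ~ t → b ~ t → y ~ a → y ~ b → ⊥
        bad ia ib ab at bt ya yb = hvn ab (~-sym (top ia)) (~-sym ya) (~-sym (top ib)) (~-sym yb) (top iy) at bt z≁t yt
        go : ∃[ d ] In d × p ~ d × q ~ d → ⊥
        go (d , id , pd , qd) with d ~? t
        ... | no d≁t = hvn pq (~-sym (top ip)) pd (~-sym (top iq)) qd (top id) pt qt z≁t d≁t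
        ... | yes dt with Triangle.two ip iq id pq pd qd iy
        ... | inj₁ (yp , yq) = bad ip iq pq pt qt yp yq
        ... | inj₂ (inj₁ (yp , yd)) = bad ip id pd pt dt yp yd
        ... | inj₂ (inj₂ (yq , yd)) = bad iq id qd qt dt yq yd

      tabooAt : (x : V) → Dec (MN.Big (CN.root x)) → ℕ
      tabooAt x (yes _) = π (level x)
      tabooAt x (no _)  = π 2

      tabooAt-spec : ∀ x (d : Dec (MN.Big (CN.root x))) →
        (MN.Big (CN.root x) × tabooAt x d ≡ π (level x)) ⊎ (¬ MN.Big (CN.root x) × tabooAt x d ≡ π 2)
      tabooAt-spec x (yes big) = inj₁ (big , refl)
      tabooAt-spec x (no ¬big) = inj₂ (¬big , refl)

      opaque
        -- A vertex of T with mixed neighbours in N has them in a single component, where it conflicts with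
        -- a single colour at the top: that of a part, or the third colour of a triangle-free component.
        taboo : V → ℕ
        taboo t = case mixed? t of λ
          { (yes (x , _)) → tabooAt x (MN.big? (CN.root x))
          ; (no _)        → forb t }

        taboo-unmixed : ∀ {t} → ¬ Mixed t → taboo t ≡ forb t
        taboo-unmixed {t} ¬mixed with mixed? t
        ... | yes mixed = contradiction mixed ¬mixed
        ... | no _ = refl

        taboo-mixed : ∀ {t} → Mixed t → ∃[ x ] ∃[ y ] MixedOn N t x y ×
          ((MN.Big (CN.root x) × taboo t ≡ π (level x)) ⊎ (¬ MN.Big (CN.root x) × taboo t ≡ π 2))
        taboo-mixed {t} mixed with mixed? t
        ... | no ¬mixed = contradiction mixed ¬mixed
        ... | yes (x , y , mx) = x , y , mx , tabooAt-spec x (MN.big? (CN.root x))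

      -- The palette has the indices up to `suc w`. A big component of `T` takes the highest of
      -- them, one more than it has parts, as `greedy` requires.
      base : V → ℕ
      base r = ℕ.suc w ∸ length (MT.reps r)

      colours : V → List ℕ
      colours r = applyUpTo (λ i → π (base r + i)) (ℕ.suc (length (MT.reps r)))

      opaque
        paint : ∀ r → Painting taboo (MT.reps r) (colours r)
        paint r = greedy taboo (MT.reps r) (colours r)
          (applyUpTo⁺₁ (λ i → π (base r + i)) (ℕ.suc (length (MT.reps r)))
            λ i<j _ eq → ℕ.<⇒≢ i<j (ℕ.+-cancelˡ-≡ (base r) _ _ (π-injective eq)))
          (subst (length (MT.reps r) <_) (≡-sym (length-applyUpTo (λ i → π (base r + i)) (ℕ.suc (length (MT.reps r))))) ℕ.≤-refl)

      module BigT {t} (Tt : T t) (big : MT.Big (CT.root t)) where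

        r = CT.root t
        s = MT.rep t
        open BT Tt big public using (rep∈reps; in-rep; reps-clique; reps-in; rep-separates)

        s∈ : s ∈ˡ MT.reps r
        s∈ = rep∈reps (Tt , refl)

        Ts : T s
        Ts = proj₁ (in-rep (Tt , refl))

        rs : CT.root s ≡ r
        rs = proj₂ (in-rep (Tt , refl))

        painted : ∃[ i ] i < ℕ.suc (length (MT.reps r)) × proj₁ (paint r) s ≡ π (base r + i)
        painted = ∈-applyUpTo⁻ (λ i → π (base r + i)) (proj₁ (proj₁ (proj₂ (paint r)) s∈))

        base+ : base r + length (MT.reps r) ≡ ℕ.suc w
        base+ = ℕ.m∸n+n≡m (ℕ.≤-trans (attachedT Tt big) (ℕ.≤-trans (ℕ.n≤1+n w₁) (ℕ.n≤1+n w)))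

        allowed : proj₁ (paint r) s ≢ taboo s
        allowed = proj₂ (proj₁ (proj₂ (paint r)) s∈)

        avoids-level : ∀ {x} → N x → x ~ t → π (level x) ≢ proj₁ (paint r) s
        avoids-level {x} Nx xt eq = case mixedAt? s (CN.root x) of λ { (yes m) → mixed m ; (no ¬m) → unmixed ¬m }
          where
          xs : x ~ s
          xs = hom* Nx Tt Ts (≡-sym rs) xt

          parts : ℕ
          parts = length (MT.reps r)

          parts≤ : parts ≤ w₁
          parts≤ = attachedT Tt big

          -- The colours painted on this component have indices from `base r` upwards, so a conflict
          -- forces `level x + parts` to be at least `suc w`.
          too-low : ¬ level x + parts < ℕ.suc w
          too-low lt = let (i , _ , eq′) = painted in ℕ.<⇒≱ lt
            (subst₂ _≤_ base+ (cong (_+ parts) (≡-sym (π-injective (trans eq eq′)))) (ℕ.+-monoˡ-≤ parts (ℕ.m≤m+n (base r) i)))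

          joined : ∀ {y u} → N y → y ~ s → u ∈ˡ MT.reps r → y ~ u
          joined Ny ys u∈ = let (Tu , ru) = reps-in u∈ in hom* Ny Ts Tu (trans rs (≡-sym ru)) ys

          unmixed : ¬ MixedAt s (CN.root x) → ⊥
          unmixed ¬mixed with MN.big? (CN.root x) | any? (λ y → N? y ×-dec (x ~? y))
          -- The whole component of `x` sees `s`, so its representatives and those of the component
          -- of `t` form one clique.
          ... | yes big′ | _ = too-low (ℕ.<-≤-trans
                  (ℕ.+-monoˡ-< parts (subst (_< length (MN.reps (CN.root x))) (≡-sym (level-big big′)) (BN.position< Nx big′ (Nx , refl))))
                  (ℕ.≤-trans (subst (_≤ w) (length-++ (MN.reps (CN.root x)))
                      (clique-length noClique (AllPairs.++⁺ (BN.reps-clique Nx big′) reps-clique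
                        (All.tabulate λ u∈ → All.tabulate λ v∈ →
                          let (Nu , ru) = BN.reps-in Nx big′ u∈ in joined Nu (full Nu ru) v∈))))
                    (ℕ.n≤1+n w)))
            where
            full : ∀ {u} → N u → CN.root u ≡ CN.root x → u ~ s
            full {u} Nu ru = proj₁ (CN.spread (λ y → y ~ s × CN.root y ≡ CN.root x)
              (λ {y} {z} Ny Nz yz (ys , ry) →
                (decidable-stable (z ~? s) λ zs → ¬mixed (y , z , (Ny , Nz , yz , ys , zs) , ry)) ,
                trans (≡-sym (CN.root-cong Ny Nz yz)) ry) Nx Nu (≡-sym ru) (xs , refl))
          -- Both `x` and `y` extend the clique of representatives, so there are at most `w` - 2
          -- parts, while the level is at most 2.
          ... | no ¬big | yes (y , Ny , xy) = too-low (ℕ.≤-<-trans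
                  (ℕ.+-monoˡ-≤ parts (ℕ.≤-trans (ℕ.≤-reflexive (level-small ¬big)) (ℕ.s≤s⁻¹ (toℕ<n (proj₁ cN x)))))
                  (s≤s (clique-length noClique ((xy ∷ All.tabulate (joined Nx xs)) ∷ All.tabulate (joined Ny ys) ∷ reps-clique))))
            where
            ys : y ~ s
            ys = decidable-stable (y ~? s) λ y≁s → ¬mixed (x , y , (Nx , Ny , xy , xs , y≁s) , refl)
          -- An isolated vertex has level 0, and `parts` is at most `w₁`.
          ... | no ¬big | no alone = too-low (ℕ.≤-<-trans
                  (ℕ.+-monoˡ-≤ parts (ℕ.≤-reflexive (trans (level-small ¬big) (cong toℕ (proj₂ (proj₂ cN) λ (Ny , _) xy → alone (_ , Ny , xy))))))
                  (s≤s (ℕ.≤-trans parts≤ (ℕ.n≤1+n w₁))))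

          mixed : MixedAt s (CN.root x) → ⊥
          mixed (y , z , my , ry) with taboo-mixed (y , z , my)
          ... | x′ , y′ , mx@(Nx′ , Ny′ , xy′ , xs′ , ys′) , value = by-size value
            where
            rx′ : CN.root x′ ≡ CN.root x
            rx′ = trans (mixed-unique mx my) ry
            by-size : (MN.Big (CN.root x′) × taboo s ≡ π (level x′)) ⊎ (¬ MN.Big (CN.root x′) × taboo s ≡ π 2) → ⊥
            by-size (inj₁ (big′ , tab)) = allowed (trans (≡-sym eq) (trans (cong π same) (≡-sym tab)))
              where
              bigx : MN.Big (CN.root x)
              bigx = subst MN.Big rx′ big′
              same : level x ≡ level x′
              same = trans (level-big bigx) (trans (BN.position-cong Nx bigx (Nx , refl) (Nx′ , rx′)
                (mixed-part Ts bigx Nx mx rx′ Nx refl Nx′ rx′ xs xs′)) (≡-sym (level-big big′)))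
            by-size (inj₂ (¬big′ , tab)) with level x ℕ.≟ 2
            ... | yes l≡2 = allowed (trans (≡-sym eq) (trans (cong π l≡2) (≡-sym tab)))
            -- A remaining level is at most 1, and 1 + `w₁` is still below `suc w`.
            ... | no l≢2 = too-low (ℕ.≤-<-trans (ℕ.+-mono-≤ (ℕ.s≤s⁻¹ (ℕ.≤∧≢⇒< l≤2 l≢2)) parts≤) ℕ.≤-refl)
              where
              l≤2 : level x ≤ 2
              l≤2 = ℕ.≤-trans (ℕ.≤-reflexive (level-small λ b → ¬big′ (subst MN.Big (≡-sym rx′) b)))
                              (ℕ.s≤s⁻¹ (toℕ<n (proj₁ cN x)))

        avoids-forb : proj₁ (paint r) s ≢ forb t
        avoids-forb eq with mixed? s
        ... | no ¬mixed = allowed (trans eq (trans (forb-parts Tt Ts (≡-sym rs) (≁-sym (proj₂ (MT.rep-spec Tt))))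
                                                   (≡-sym (taboo-unmixed ¬mixed))))
        -- For a mixed vertex `taboo` is occupied by the conflict with `N`, but then `forb` lies
        -- outside the palette.
        ... | yes (x , y , mx) = let (i , _ , eq′) = painted in
          forb-mixed Ts mx _ (trans (≡-sym eq′) (trans eq (forb-parts Tt Ts (≡-sym rs) (≁-sym (proj₂ (MT.rep-spec Tt))))))

        in-range : ∃[ k ] k < 2 + w × proj₁ (paint r) s ≡ π k
        in-range = let (i , i< , eq) = painted in
          base r + i , s≤s (subst (base r + i ≤_) base+ (ℕ.+-monoʳ-≤ (base r) (ℕ.s≤s⁻¹ i<))) , eq

      opaque
        tColour : V → ℕ
        tColour t = case MT.big? (CT.root t) of λ
          { (yes _) → proj₁ (paint (CT.root t)) (MT.rep t)
          -- The three highest indices, above every level in `N`.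
          ; (no _)  → π (w₁ + toℕ (proj₁ cT t)) }

        tColour-avoids-level : ∀ {x t} → N x → T t → x ~ t → π (level x) ≢ tColour t
        tColour-avoids-level {x} {t} Nx Tt xt eq with MT.big? (CT.root t)
        ... | yes big = BigT.avoids-level Tt big Nx xt eq
        ... | no _ = ℕ.<⇒≢ (ℕ.<-≤-trans (level< Nx) (ℕ.m≤m+n w₁ _)) (π-injective eq)

        tColour-proper : ∀ {t u} → T t → T u → t ~ u → tColour t ≢ tColour u
        tColour-proper {t} {u} Tt Tu tu eq with MT.big? (CT.root t) | MT.big? (CT.root u)
        ... | yes big | no ¬big = ¬big (subst MT.Big (CT.root-cong Tt Tu tu) big)
        ... | no ¬big | yes big = ¬big (subst MT.Big (≡-sym (CT.root-cong Tt Tu tu)) big)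
        ... | no ¬bt | no ¬bu = proj₂ cT (Tt , ¬bt) (Tu , ¬bu) tu (toℕ-injective (ℕ.+-cancelˡ-≡ w₁ _ _ (π-injective eq)))
        ... | yes big | yes _ = rep-separates (Tt , refl) iu tu (proj₂ (proj₂ (paint r)) (rep∈reps (Tt , refl)) (rep∈reps iu)
            (trans eq (cong (λ r → proj₁ (paint r) (MT.rep u)) (proj₂ iu))))
          where
          open BigT Tt big
          iu : T u × CT.root u ≡ r
          iu = Tu , ≡-sym (CT.root-cong Tt Tu tu)

        tColour-range : ∀ {t} → T t → ∃[ k ] k < 2 + w × tColour t ≡ π k
        tColour-range {t} Tt with MT.big? (CT.root t)
        ... | yes big = BigT.in-range Tt big
        ... | no _ = w₁ + toℕ (proj₁ cT t) ,
          subst (w₁ + toℕ (proj₁ cT t) <_) (ℕ.+-comm w₁ 3) (ℕ.+-monoʳ-< w₁ (toℕ<n (proj₁ cT t))) , refl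

        tColour-forb : ∀ {t} → T t → tColour t ≢ forb t
        tColour-forb {t} Tt eq with MT.big? (CT.root t)
        ... | yes big = BigT.avoids-forb Tt big eq
        ... | no _ = forb-top t (ℕ.m≤m+n w₁ _) eq

      opaque
        colour : V → ℕ
        colour v = case N? v of λ { (yes _) → π (level v) ; (no _) → tColour v }

        colour-N : ∀ {v} → N v → colour v ≡ π (level v)
        colour-N {v} Nv with N? v
        ... | yes _ = refl
        ... | no ¬N = contradiction Nv ¬N

        colour-T : ∀ {v} → T v → colour v ≡ tColour v
        colour-T {v} Tv with N? v
        ... | yes Nv = contradiction Tv (disjoint Nv)
        ... | no _ = refl

      colour-proper : ∀ {u v} → N u ⊎ T u → N v ⊎ T v → u ~ v → colour u ≢ colour v
      colour-proper (inj₁ Nu) (inj₁ Nv) uv eq =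
        level-proper Nu Nv uv (π-injective (trans (≡-sym (colour-N Nu)) (trans eq (colour-N Nv))))
      colour-proper (inj₁ Nu) (inj₂ Tv) uv eq =
        tColour-avoids-level Nu Tv uv (trans (≡-sym (colour-N Nu)) (trans eq (colour-T Tv)))
      colour-proper (inj₂ Tu) (inj₁ Nv) uv eq =
        tColour-avoids-level Nv Tu (~-sym uv) (trans (≡-sym (colour-N Nv)) (trans (≡-sym eq) (colour-T Tu)))
      colour-proper (inj₂ Tu) (inj₂ Tv) uv eq =
        tColour-proper Tu Tv uv (trans (≡-sym (colour-T Tu)) (trans eq (colour-T Tv)))

      colour-range : ∀ {v} → N v ⊎ T v → ∃[ k ] k < 2 + w × colour v ≡ π k
      colour-range (inj₁ Nv) = _ , ℕ.<-≤-trans (level< Nv) (ℕ.m≤n+m w₁ 3) , colour-N Nv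
      colour-range (inj₂ Tv) = let (k , k< , eq) = tColour-range Tv in k , k< , trans (colour-T Tv) eq

      colour-forb : ∀ {v} → T v → colour v ≢ forb v
      colour-forb Tv eq = tColour-forb Tv (trans (≡-sym (colour-T Tv)) eq)

      layer-colouring : LayerColouring N T (2 + w) π forb
      layer-colouring = record
        { colour = colour ; colour-proper = colour-proper ; colour-range = colour-range ; colour-forb = colour-forb }

  -- The complete multipartite graph around a maximum clique, and its complement

  module LargeClique (p5 : P5-Free) (hvn : HVN-Free) (conn : Connected G)
                     (w₁ : ℕ) (3≤w₁ : 3 ≤ w₁) (K : Fin (ℕ.suc w₁) → Fin (n G))
                     (K-joined : ∀ i j → i ≢ j → Adj G (K i) (K j))
                     (noClique : ¬ HasClique G (ℕ.suc (ℕ.suc w₁))) where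

    w : ℕ
    w = ℕ.suc w₁

    Index : Set
    Index = Fin w

    other : (i j k : Index) → ∃[ l ] l ≢ i × l ≢ j × l ≢ k
    other = avoid (s≤s 3≤w₁)

    M : Index → V → Set
    M i v = v ≁ K i × ∀ j → j ≢ i → v ~ K j

    opaque
      m? : ∀ i v → Dec (M i v)
      m? i v = ¬? (v ~? K i) ×-dec all? λ j → ¬? (j ≟ i) →-dec (v ~? K j)

    K∈M : ∀ i → M i (K i)
    K∈M i = ~-irrefl , λ j j≢i → K-joined i j λ i≡j → j≢i (≡-sym i≡j)

    -- A vertex seeing two vertices of `K` but missing at least two others gives an HVN on these
    -- four; seeing all of `K` would enlarge the clique.
    few : ∀ {v} → (∃[ i ] M i v) ⊎ (∀ {i j} → v ~ K i → v ~ K j → i ≡ j)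
    few {v} with any? (λ i → m? i v)
    ... | yes inM = inj₁ inM
    ... | no notM = inj₂ λ {i} {j} vi vj → decidable-stable (i ≟ j) λ i≢j → two i≢j vi vj
      where
      two : ∀ {i j} → i ≢ j → v ~ K i → v ~ K j → ⊥
      two {i} {j} i≢j vi vj with any? (λ k → ¬? (v ~? K k))
      ... | no all = noClique (clique f joined)
        where
        sees : ∀ k → v ~ K k
        sees k = decidable-stable (v ~? K k) λ e → all (k , e)
        f : Fin (ℕ.suc w) → V
        f zero    = v
        f (suc k) = K k
        joined : ∀ a b → a ≢ b → f a ~ f b
        joined zero zero a≢b = contradiction refl a≢b
        joined zero (suc b) _ = sees b
        joined (suc a) zero _ = ~-sym (sees a)
        joined (suc a) (suc b) a≢b = K-joined a b λ e → a≢b (cong suc e)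
      ... | yes (k , vk) = notM (k , vk , λ l l≢k → decidable-stable (v ~? K l) λ vl →
          hvn (K-joined i j i≢j) (K-joined i k λ { refl → vk vi }) (K-joined i l λ { refl → vl vi })
              (K-joined j k λ { refl → vk vj }) (K-joined j l λ { refl → vl vj }) (K-joined k l λ e → l≢k (≡-sym e))
              (~-sym vi) (~-sym vj) (≁-sym vk) (≁-sym vl))

    -- The two ends of an edge inside part `i` could replace `K i` in the clique.
    M-independent : ∀ {i u v} → M i u → M i v → u ≁ v
    M-independent {i} {u} {v} (_ , mu) (_ , mv) uv = noClique (clique f joined)
      where
      at : Index → V
      at j = case j ≟ i of λ { (yes _) → v ; (no _) → K j }
      u~at : ∀ j → u ~ at j
      u~at j with j ≟ i
      ... | yes _ = uv
      ... | no j≢i = mu j j≢i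
      at-joined : ∀ j k → j ≢ k → at j ~ at k
      at-joined j k j≢k with j ≟ i | k ≟ i
      ... | yes j≡i | yes k≡i = contradiction (trans j≡i (≡-sym k≡i)) j≢k
      ... | yes _ | no k≢i = mv k k≢i
      ... | no j≢i | yes _ = ~-sym (mv j j≢i)
      ... | no _ | no _ = K-joined j k j≢k
      f : Fin (ℕ.suc w) → V
      f zero    = u
      f (suc j) = at j
      joined : ∀ a b → a ≢ b → f a ~ f b
      joined zero zero a≢b = contradiction refl a≢b
      joined zero (suc b) _ = u~at b
      joined (suc a) zero _ = ~-sym (u~at a)
      joined (suc a) (suc b) a≢b = at-joined a b λ e → a≢b (cong suc e)

    -- With two further indices `k` and `l`, the vertices `K k`, `K l`, `K j`, `u` form a K₄; if `u`
    -- and `v` were not adjacent, `v` would see exactly the first two.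
    M-joined : ∀ {i j u v} → i ≢ j → M i u → M j v → u ~ v
    M-joined {i} {j} {u} {v} i≢j (ui , mu) (vj , mv) = decidable-stable (u ~? v) λ uv →
      let (k , k≢i , k≢j , _) = other i j j
          (l , l≢i , l≢j , l≢k) = other i j k
      in hvn (K-joined k l λ e → l≢k (≡-sym e)) (K-joined k j k≢j) (~-sym (mu k k≢i)) (K-joined l j l≢j) (~-sym (mu l l≢i))
             (~-sym (mu j λ e → i≢j (≡-sym e))) (~-sym (mv k k≢j)) (~-sym (mv l l≢j)) (≁-sym vj) uv

    R : V → Set
    R v = ¬ (∃[ i ] M i v)

    opaque
      r? : ∀ v → Dec (R v)
      r? v = ¬? (any? λ i → m? i v)

    lone : ∀ {v} → R v → ∃[ i ] ∀ {k} → k ≢ i → v ≁ K k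
    lone {v} Rv with few {v} | any? (λ i → v ~? K i)
    ... | inj₁ inM | _ = contradiction inM Rv
    ... | inj₂ _ | no none = zero , λ _ e → none (_ , e)
    ... | inj₂ unique | yes (i , vi) = i , λ k≢i e → k≢i (unique e vi)

    -- If `v` misses `K k` and `K l`, these two with `m` and `m′` are the K₄ of an HVN. If it sees
    -- one of them, it misses the rest of `K`, and the K₄ consists of `m′`, the seen vertex, `K i`
    -- and the remaining one.
    one-part : ∀ {v i j m m′} → R v → M i m → M j m′ → v ~ m → v ~ m′ → i ≡ j
    one-part {v} {i} {j} {m} {m′} Rv Mm Mm′ vm vm′ = decidable-stable (i ≟ j) λ i≢j → different i≢j
      where
      different : i ≢ j → ⊥
      different i≢j with few {v} | other i j j
      ... | inj₁ inM | _ = Rv inM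
      ... | inj₂ unique | k , k≢i , k≢j , _ with other i j k
      ... | l , l≢i , l≢j , l≢k with v ~? K k | v ~? K l
      ... | no vk | no vl = hvn (M-joined i≢j Mm Mm′) (proj₂ Mm k k≢i) (proj₂ Mm l l≢i) (proj₂ Mm′ k k≢j) (proj₂ Mm′ l l≢j)
          (K-joined k l λ e → l≢k (≡-sym e)) (~-sym vm) (~-sym vm′) (≁-sym vk) (≁-sym vl)
      ... | yes vk | _ = swap k l k≢i k≢j l≢i l≢j (λ e → l≢k (≡-sym e)) vk
        where
        swap : ∀ k l → k ≢ i → k ≢ j → l ≢ i → l ≢ j → k ≢ l → v ~ K k → ⊥
        swap k l k≢i k≢j l≢i l≢j k≢l vk =
          hvn (proj₂ Mm′ k k≢j) (proj₂ Mm′ i i≢j) (proj₂ Mm′ l l≢j) (K-joined k i k≢i) (K-joined k l k≢l)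
              (K-joined i l λ e → l≢i (≡-sym e)) (~-sym vm′) (~-sym vk)
              (λ e → k≢i (unique vk (~-sym e))) (λ e → k≢l (unique vk (~-sym e)))
      ... | no _ | yes vl = hvn (proj₂ Mm′ l l≢j) (proj₂ Mm′ i i≢j) (proj₂ Mm′ k k≢j) (K-joined l i l≢i) (K-joined l k l≢k)
              (K-joined i k λ e → k≢i (≡-sym e)) (~-sym vm′) (~-sym vl)
              (λ e → l≢i (unique vl (~-sym e))) (λ e → l≢k (unique vl (~-sym e)))

    Meets : Index → V → Set
    Meets i v = R v × ∃[ m ] M i m × v ~ m

    opaque
      meets? : ∀ i v → Dec (Meets i v)
      meets? i v = r? v ×-dec any? λ m → m? i m ×-dec (v ~? m)

    meets-unique : ∀ {i j v} → Meets i v → Meets j v → i ≡ j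
    meets-unique (Rv , _ , Mm , vm) (_ , _ , Mm′ , vm′) = one-part Rv Mm Mm′ vm vm′

    -- The path y′ y x m Kₖ, where k is neither i nor an index seen by y or y′.
    path-homogeneous : ∀ {i x y y′ m} → R x → M i m → x ~ m → R y → R y′ → y ≁ m → y′ ≁ m →
                       y ~ y′ → x ~ y → x ~ y′
    path-homogeneous {i} {x} {y} {y′} {m} Rx Mm xm Ry Ry′ ym y′m yy′ xy = decidable-stable (x ~? y′) λ xy′ →
      let (a , ya) = lone Ry
          (b , y′b) = lone Ry′
          (k , k≢i , k≢a , k≢b) = other i a b
      in p5 (~-sym yy′) (~-sym xy) xm (proj₂ Mm k k≢i) (≁-sym xy′) y′m (y′b k≢b) ym (ya k≢a)
            (λ e → k≢i (≡-sym (one-part Rx Mm (K∈M k) xm e)))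

    homogeneous : ∀ {i x y y′} → Meets i x → R y → R y′ → ¬ Meets i y → ¬ Meets i y′ → y ~ y′ → x ~ y → x ~ y′
    homogeneous (Rx , m , Mm , xm) Ry Ry′ ¬By ¬By′ =
      path-homogeneous Rx Mm xm Ry Ry′ (λ e → ¬By (Ry , m , Mm , e)) (λ e → ¬By′ (Ry′ , m , Mm , e))

    open Components r?

    In : V → V → Set
    In r v = R v × root v ≡ r

    opaque
      in? : ∀ r v → Dec (In r v)
      in? r v = r? v ×-dec (root v ≟ r)

    in-step : ∀ {r u v} → In r u → R v → u ~ v → In r v
    in-step (Ru , ru) Rv uv = Rv , trans (≡-sym (root-cong Ru Rv uv)) ru

    reaches : ∀ {v} → R v → ∃[ i ] ∃[ u ] In (root v) u × Meets i u
    reaches {v} Rv = travel Q keep (conn (K zero) v) (λ Rk → ⊥-elim (Rk (zero , K∈M zero))) Rv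
      where
      Q : V → Set
      Q v = R v → ∃[ i ] ∃[ u ] In (root v) u × Meets i u
      keep : ∀ {v w} → v ~ w → Q v → Q w
      keep {v} {w} vw q Rw with any? (λ i → m? i v)
      ... | yes (i , Mv) = i , w , (Rw , refl) , Rw , v , Mv , ~-sym vw
      ... | no Rv = let (i , u , (Ru , ru) , Bu) = q Rv in i , u , (Ru , trans ru (root-cong Rv Rw vw)) , Bu

    -- Along a path from `x`, a step that leaves `N` has its last vertex in `N` as a neighbour, and
    -- homogeneity carries this neighbour on until `N` is entered again.
    dominated : ∀ {r} {N : V → Set} {x} → (∀ v → Dec (N v)) → In r x → N x →
                (∀ {y t t′} → In r y → N y → In r t → ¬ N t → In r t′ → ¬ N t′ → t ~ t′ → y ~ t → y ~ t′) →
                ∀ {t} → In r t → ¬ N t → ∃[ y ] (In r y × N y) × y ~ t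
    dominated {r} {N} {x} N? ix Nx hom {t} it ¬Nt =
      case proj₂ (spread Q keep (proj₁ ix) (proj₁ it) (trans (proj₂ ix) (≡-sym (proj₂ it))) (ix , inj₁ Nx)) of λ where
        (inj₁ Nt) → contradiction Nt ¬Nt
        (inj₂ found) → found
      where
      Q : V → Set
      Q t = In r t × (N t ⊎ ∃[ y ] (In r y × N y) × y ~ t)
      keep : ∀ {v w} → R v → R w → v ~ w → Q v → Q w
      keep Rv Rw vw (iv , inj₁ Nv) = in-step iv Rw vw , inj₂ (_ , (iv , Nv) , vw)
      keep {v} {w} Rv Rw vw (iv , inj₂ (y , (iy , Ny) , yv)) with N? v | N? w
      ... | yes Nv | _ = in-step iv Rw vw , inj₂ (v , (iv , Nv) , vw)
      ... | no _ | yes Nw = in-step iv Rw vw , inj₁ Nw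
      ... | no ¬Nv | no ¬Nw = let iw = in-step iv Rw vw in
        iw , inj₂ (y , (iy , Ny) , hom iy Ny iv ¬Nv iw ¬Nw vw yv)

    record Local (r : V) : Set where
      field
        colour : V → ℕ
        proper : ∀ {u v} → In r u → In r v → u ~ v → colour u ≢ colour v
        range  : ∀ {v} → In r v → colour v < w + 3
        avoids : ∀ {v i} → In r v → Meets i v → colour v ≢ toℕ i

    module Split {r : V} (i₀ : Index) {N : V → Set} (N? : ∀ v → Dec (N v)) where

      Nr Tr : V → Set
      Nr v = In r v × N v
      Tr v = In r v × ¬ N v

      opaque
        nr? : ∀ v → Dec (Nr v)
        nr? v = in? r v ×-dec N? v

      opaque
        tr? : ∀ v → Dec (Tr v)
        tr? v = in? r v ×-dec ¬? (N? v)

      π : ℕ → ℕ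
      π = skip (toℕ i₀)

      split : ∀ {v} → In r v → Nr v ⊎ Tr v
      split {v} iv with N? v
      ... | yes Nv = inj₁ (iv , Nv)
      ... | no ¬Nv = inj₂ (iv , ¬Nv)

      range′ : ∀ {c} → ∃[ k ] k < 2 + w × c ≡ π k → c < w + 3
      range′ (k , k< , refl) = subst (π k <_) (ℕ.+-comm 3 w) (skip-< (toℕ i₀) k<)

    -- Here N consists of the neighbours of m, and only the colour i is unavailable.
    single : ∀ {r i x m} → In r x → M i m → x ~ m → (∀ {j v} → In r v → Meets j v → j ≡ i) → Local r
    single {r} {i} {x} {m} ix Mm xm only = record
      { colour = colour
      ; proper = λ iu iv → colour-proper (split iu) (split iv)
      ; range  = λ iv → range′ (colour-range (split iv))
      ; avoids = λ {v} {j} iv Bv eq → let (k , _ , eq′) = colour-range (split iv) in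
          skip-≢ (toℕ i) k (trans (≡-sym eq′) (trans eq (cong toℕ (only iv Bv)))) }
      where
      open Split {r} i {_~ m} (λ v → v ~? m)
      hom : ∀ {y t t′} → Nr y → Tr t → Tr t′ → t ~ t′ → y ~ t → y ~ t′
      hom ((Ry , _) , ym) ((Rt , _) , tm) ((Rt′ , _) , tm′) = path-homogeneous Ry Mm ym Rt Rt′ tm tm′
      layers : LayerColouring Nr Tr (2 + w) π (λ _ → toℕ i)
      layers = Layers.Colour.layer-colouring p5 hvn nr? tr? w₁ 3≤w₁ noClique (λ (_ , Nv) (_ , ¬Nv) → ¬Nv Nv) hom
        (λ (it , ¬Nt) → dominated {N = _~ m} (λ v → v ~? m) ix xm
          (λ iy Ny it ¬Nt it′ ¬Nt′ → hom (iy , Ny) (it , ¬Nt) (it′ , ¬Nt′)) it ¬Nt)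
        -- The vertex `m` itself is the cap: it sees all of `N` and nothing of `T`.
        (λ _ → m , (λ (_ , ym) _ → ~-sym ym) , λ (_ , ¬tm) _ _ mt → ¬tm (~-sym mt))
        π (skip-injective (toℕ i)) (λ _ → toℕ i) (λ _ _ _ _ → refl)
        (λ _ _ k → skip-≢ (toℕ i) k) (λ _ {k} _ → skip-≢ (toℕ i) k)
      open LayerColouring layers

    -- Here N consists of the vertices seeing the part i; the colours of the other parts are handled by forb.
    several : ∀ {r i j x y} → In r x → Meets i x → In r y → Meets j y → i ≢ j → Local r
    several {r} {i} {j} {x} {y} ix Bx iy By i≢j = record
      { colour = colour
      ; proper = λ iu iv → colour-proper (split iu) (split iv)
      ; range  = λ iv → range′ (colour-range (split iv))
      ; avoids = λ iv Bv → avoids iv Bv (split iv) }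
      where
      open Split {r} i {Meets i} (meets? i)
      module CN = Components nr?
      module CT = Components tr?

      hom : ∀ {y t t′} → Nr y → Tr t → Tr t′ → t ~ t′ → y ~ t → y ~ t′
      hom (_ , By) ((Rt , _) , ¬Bt) ((Rt′ , _) , ¬Bt′) = homogeneous By Rt Rt′ ¬Bt ¬Bt′

      attached : ∀ {t} → Tr t → ∃[ y ] Nr y × y ~ t
      attached (it , ¬Bt) = dominated {N = Meets i} (meets? i) ix Bx
        (λ iy Ny it ¬Nt it′ ¬Nt′ → hom (iy , Ny) (it , ¬Nt) (it′ , ¬Nt′)) it ¬Bt

      elsewhere : ∀ {k v} → Meets i v → k ≢ i → ¬ Meets k v
      elsewhere Bv k≢i Bk = k≢i (meets-unique Bk Bv)

      -- The path argument behind `homogeneous` works for part `k` as well, since vertices of `N`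
      -- see part `i` only.
      unmixed : ∀ {k t p q} → Meets k t → k ≢ i → MixedOn Nr t p q → ⊥
      unmixed Bt k≢i (((Rp , _) , Bp) , ((Rq , _) , Bq) , pq , pt , qt) =
        qt (~-sym (homogeneous Bt Rp Rq (elsewhere Bp k≢i) (elsewhere Bq k≢i) pq (~-sym pt)))

      forb : V → ℕ
      -- The default `toℕ i` forbids nothing, as `π` skips this colour.
      forb v = case any? (λ k → meets? k v) of λ { (yes (k , _)) → toℕ k ; (no _) → toℕ i }

      forb-meets : ∀ {k v} → Meets k v → forb v ≡ toℕ k
      forb-meets {k} {v} Bv with any? (λ k → meets? k v)
      ... | yes (l , Bl) = cong toℕ (meets-unique Bl Bv)
      ... | no none = contradiction (k , Bv) none

      forb-none : ∀ {v} → (∀ {k} → ¬ Meets k v) → forb v ≡ toℕ i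
      forb-none {v} none with any? (λ k → meets? k v)
      ... | yes (k , Bk) = contradiction Bk none
      ... | no _ = refl

      -- A vertex `x` of `N` that sees `t` sees all of its component, including `t′`. If `t′` did
      -- not meet part `k`, homogeneity of `t` along the edge from `x` to `t′` would make `t` and
      -- `t′` adjacent.
      forb-carries : ∀ {k t t′} → Tr t → Tr t′ → CT.root t ≡ CT.root t′ → t ≁ t′ → Meets k t → Meets k t′
      forb-carries {k} {t} {t′} Tt@((Rt , _) , ¬Bt) Tt′@((Rt′ , _) , _) rt tt′ Bt =
        decidable-stable (meets? k t′) λ ¬Bt′ →
          let (x , ((Rx , rx) , Bx) , xt) = attached Tt
              xt′ = CT.spread (x ~_) (hom ((Rx , rx) , Bx)) Tt Tt′ rt xt
          in tt′ (homogeneous Bt Rx Rt′ (elsewhere {k} Bx λ { refl → ¬Bt Bt }) ¬Bt′ xt′ (~-sym xt))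

      forb-parts : ∀ {t t′} → Tr t → Tr t′ → CT.root t ≡ CT.root t′ → t ≁ t′ → forb t ≡ forb t′
      forb-parts {t} {t′} Tt Tt′ rt tt′ = compare (any? λ k → meets? k t) (any? λ k → meets? k t′)
        where
        compare : Dec (∃[ k ] Meets k t) → Dec (∃[ k ] Meets k t′) → forb t ≡ forb t′
        compare (yes (k , Bk)) _ = trans (forb-meets Bk) (≡-sym (forb-meets (forb-carries Tt Tt′ rt tt′ Bk)))
        compare (no none) (yes (k , Bk)) = contradiction (k , forb-carries Tt′ Tt (≡-sym rt) (≁-sym tt′) Bk) none
        compare (no none) (no none′) = trans (forb-none λ Bk → none (_ , Bk)) (≡-sym (forb-none λ Bk → none′ (_ , Bk)))

      Cap : V → Set
      Cap p = ∃[ z ] (∀ {p′} → Nr p′ → CN.root p′ ≡ CN.root p → z ~ p′) ×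
              (∀ {t a b} → Tr t → CN.root a ≡ CN.root p → MixedOn Nr t a b → z ≁ t)

      -- The second part `j` provides it: a vertex `z` meeting part `j` is homogeneous to the
      -- components of `N`. As `z` lies in `T`, an edge from `z` to a mixed `t` would contradict
      -- homogeneity of `N` towards `T`.
      cap : ∀ {p} → Nr p → Cap p
      cap {p} Np@(ip , Bp) = build (dominated {N = Meets j} (meets? j) iy By
          (λ iy By (Rt , _) ¬Bt (Rt′ , _) ¬Bt′ → homogeneous By Rt Rt′ ¬Bt ¬Bt′) ip (elsewhere Bp j≢i))
        where
        j≢i : j ≢ i
        j≢i e = i≢j (≡-sym e)
        build : ∃[ z ] (In r z × Meets j z) × z ~ p → Cap p
        build (z , (iz , Bz) , zp) = z , dom , λ {t} {a} {b} Tt ra (Na , Nb , ab , at , bt) zt →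
            bt (hom Nb (iz , elsewhere′) Tt zt (~-sym (dom Nb (trans (≡-sym (CN.root-cong Na Nb ab)) ra))))
          where
          elsewhere′ : ¬ Meets i z
          elsewhere′ Bi = elsewhere Bi j≢i Bz
          dom : ∀ {p′} → Nr p′ → CN.root p′ ≡ CN.root p → z ~ p′
          dom Np′ rp′ = CN.spread (z ~_) (λ ((Ra , _) , Ba) ((Rb , _) , Bb) ab za →
            homogeneous Bz Ra Rb (elsewhere Ba j≢i) (elsewhere Bb j≢i) ab za) Np Np′ (≡-sym rp′) zp

      forb-mixed : ∀ {t p q} → Tr t → MixedOn Nr t p q → ∀ k → π k ≢ forb t
      forb-mixed {t} (_ , ¬Bt) mx k eq = skip-≢ (toℕ i) k (trans eq (forb-none λ {l} Bl →
        unmixed Bl (λ { refl → ¬Bt Bl }) mx))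

      -- From `w₁` on, `π` is the successor, so its values exceed the colours of all parts.
      forb-top : ∀ t {k} → w₁ ≤ k → π k ≢ forb t
      forb-top t {k} w₁≤k eq with any? (λ k → meets? k t)
      ... | no _ = skip-≢ (toℕ i) k eq
      ... | yes (l , _) = ℕ.<⇒≢ (ℕ.<-≤-trans (toℕ<n l) (s≤s w₁≤k))
        (trans (≡-sym eq) (skip-high (toℕ i) (ℕ.≤-trans (ℕ.s≤s⁻¹ (toℕ<n i)) w₁≤k)))

      layers : LayerColouring Nr Tr (2 + w) π forb
      layers = Layers.Colour.layer-colouring p5 hvn nr? tr? w₁ 3≤w₁ noClique (λ (_ , Nv) (_ , ¬Nv) → ¬Nv Nv) hom attached cap
        π (skip-injective (toℕ i)) forb forb-parts forb-mixed forb-top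
      open LayerColouring layers

      avoids : ∀ {v k} → In r v → Meets k v → Nr v ⊎ Tr v → colour v ≢ toℕ k
      avoids iv Bv (inj₁ Nv@(_ , Bi)) eq = let (l , _ , eq′) = colour-range (inj₁ Nv) in
        skip-≢ (toℕ i) l (trans (≡-sym eq′) (trans eq (cong toℕ (meets-unique Bv Bi))))
      avoids iv Bv (inj₂ Tv) eq = colour-forb Tv (trans eq (≡-sym (forb-meets Bv)))

    opaque
      local : ∀ {v} → R v → Local (root v)
      local {v} Rv with reaches Rv
      ... | i , x , ix , Bx@(Rx , m , Mm , xm) with any? (λ j → ¬? (i ≟ j) ×-dec any? λ y → in? (root v) y ×-dec meets? j y)
      ... | yes (j , i≢j , y , iy , By) = several ix Bx iy By i≢j
      ... | no none = single ix Mm xm λ {j} iy By → decidable-stable (j ≟ i) λ j≢i →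
        none (j , (λ e → j≢i (≡-sym e)) , _ , iy , By)

    -- A local colouring is constructed from a vertex of the component. Taking that vertex from a
    -- search depending on `r` alone gives adjacent vertices the same colouring.
    rootLocal : ∀ r → Dec (∃[ v ] In r v) → V → ℕ
    rootLocal r (yes (v , Rv , refl)) = Local.colour (local Rv)
    rootLocal r (no _)                = λ _ → 0

    rootLocal-local : ∀ {r u} → In r u → (d : Dec (∃[ v ] In r v)) → Σ[ L ∈ Local r ] rootLocal r d ≡ Local.colour L
    rootLocal-local iu (yes (v , Rv , refl)) = local Rv , refl
    rootLocal-local iu (no none) = contradiction (_ , iu) none

    inhabited? : ∀ r → Dec (∃[ v ] In r v)
    inhabited? r = any? (in? r)

    rColour : V → ℕ
    rColour v = rootLocal (root v) (inhabited? (root v)) v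

    shade : ∀ {v} → Dec (∃[ i ] M i v) → ℕ
    shade (yes (i , _)) = toℕ i
    shade {v} (no _)    = rColour v

    shade-range : ∀ {v} (d : Dec (∃[ i ] M i v)) → shade d < w + 3
    shade-range (yes (i , _)) = ℕ.<-≤-trans (toℕ<n i) (ℕ.m≤m+n w 3)
    shade-range {v} (no Rv) with rootLocal-local (Rv , refl) (inhabited? (root v))
    ... | L , eq = subst (_< w + 3) (≡-sym (cong (λ f → f v) eq)) (Local.range L (Rv , refl))

    rColour-avoids : ∀ {i u v} → M i u → R v → u ~ v → toℕ i ≢ rColour v
    rColour-avoids {v = v} Mu Rv uv ieq with rootLocal-local (Rv , refl) (inhabited? (root v))
    ... | L , eq = Local.avoids L (Rv , refl) (Rv , _ , Mu , ~-sym uv) (trans (≡-sym (cong (λ f → f v) eq)) (≡-sym ieq))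

    shade-proper : ∀ {u v} → u ~ v → (d : Dec (∃[ i ] M i u)) (e : Dec (∃[ i ] M i v)) → shade d ≢ shade e
    shade-proper uv (yes (i , Mu)) (yes (j , Mv)) eq with toℕ-injective eq
    ... | refl = M-independent Mu Mv uv
    shade-proper uv (yes (i , Mu)) (no Rv) eq = rColour-avoids Mu Rv uv eq
    shade-proper uv (no Ru) (yes (j , Mv)) eq = rColour-avoids Mv Ru (~-sym uv) (≡-sym eq)
    shade-proper {u} {v} uv (no Ru) (no Rv) eq with rootLocal-local (Ru , refl) (inhabited? (root u))
    ... | L , eqL = Local.proper L (Ru , refl) (Rv , ≡-sym ruv) uv
        (trans (≡-sym (cong (λ f → f u) eqL)) (trans eq (trans (cong (λ r → rootLocal r (inhabited? r) v) (≡-sym ruv)) (cong (λ f → f v) eqL))))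
      where
      ruv = root-cong Ru Rv uv

    colouring : Colourable G (w + 3)
    colouring = (λ v → fromℕ< (shade-range (inM? v))) , λ u v uv eq →
      shade-proper uv (inM? u) (inM? v)
        (trans (≡-sym (toℕ-fromℕ< (shade-range (inM? u)))) (trans (cong toℕ eq) (toℕ-fromℕ< (shade-range (inM? v)))))
      where
      inM? : ∀ v → Dec (∃[ i ] M i v)
      inM? v = any? λ i → m? i v

  -- Small clique numbers and the conclusion

  small-clique-colouring : P5-Free → ∀ w → w ≤ 2 → ¬ HasClique G (ℕ.suc w) → Colourable G (w + 3)
  small-clique-colouring p5 w w≤2 none = (λ v → inject≤ (proj₁ threeColour v) (ℕ.m≤n+m 3 w)) , λ u v uv eq →
    proj₂ threeColour u v uv (inject≤-injective (ℕ.m≤n+m 3 w) (ℕ.m≤n+m 3 w) _ _ eq)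
    where
    △ : TriangleFree (λ _ → V)
    △ _ _ _ ab bc ac = ℕ.≤⇒≯ w≤2 (clique-length none ((ab ∷ ac ∷ []) ∷ (bc ∷ []) ∷ [] ∷ []))
    open TriangleFreeColouring p5 {λ _ → V} (λ v → yes v) △

  K4-free : ¬ HasClique G 4 → K4-Free
  K4-free none ab ac ad bc bd cd =
    ℕ.<-irrefl refl (clique-length none ((ab ∷ ac ∷ ad ∷ []) ∷ (bc ∷ bd ∷ []) ∷ (cd ∷ []) ∷ [] ∷ []))

theorem1p2 : (G : Graph) → Connected G → (P5 -free) G → (HVN -free) G →
    (w : ℕ) → IsCliqueNumber G w → Colourable G (w + 3)
theorem1p2 G conn p5 hvn 0 (_ , none) = small-clique-colouring G (p5-free G p5) 0 z≤n none
theorem1p2 G conn p5 hvn 1 (_ , none) = small-clique-colouring G (p5-free G p5) 1 (s≤s z≤n) none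
theorem1p2 G conn p5 hvn 2 (_ , none) = small-clique-colouring G (p5-free G p5) 2 ℕ.≤-refl none
theorem1p2 G conn p5 hvn 3 (_ , none) = K4-free-colouring G (p5-free G p5) (K4-free G none) conn
theorem1p2 G conn p5 hvn (ℕ.suc w₁@(ℕ.suc (ℕ.suc (ℕ.suc _)))) ((K , _ , joined) , none) =
  LargeClique.colouring G (p5-free G p5) (hvn-free G hvn) conn w₁ (s≤s (s≤s (s≤s z≤n))) K joined none
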